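{- Let $p$ be a prime number and let $n$ be a positive integer such that $p\nmid n$. Let $A$ be an $n\times n$ matrix over $\mathbb{Q}_p$ with all entries in the disc $D(1,1/p)$. Then the following conditions hold. (a) $A$ has a simple eigenvalue $\lambda_{\max}\in\mathbb{Q}_p$ such that $|\lambda_{\max}|_p=1$, and $|\lambda|_p<1$ for all other eigenvalues $\lambda\in\mathbb{C}_p$ of $A$. (b) The maximal eigenvalue $\lambda_{\max}$ is an element of the disc $D(n,1/p)$. (c) There exists a $\lambda_{\max}$-eigenvector $\mathbf{x}$ of $A$, all of whose components are elements of the disc $D(1,1/p)$. (d) The ($p$-adic) limit $P_A=\lim_{k\to+\infty}\left(\frac{1}{\lambda_{\max}}A\right)^k$ exists and $P_A$ is a projection operator onto the $\lambda_{\max}$-eigenspace of $A$.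
   Context: $|\cdot|_p$ is the $p$-adic absolute value on $\mathbb{Q}_p$, normalized so that $|p|_p=1/p$. $\mathbb{C}_p$ is the completion of the algebraic closure of $\mathbb{Q}_p$, with $|\cdot|_p$ extended to it. For $c\in\mathbb{Q}_p$ and real $r>0$, $D(c,r)=\{x\in\mathbb{Q}_p : |x-c|_p\leq r\}$. A simple eigenvalue is one of multiplicity one as a root of the characteristic polynomial. Limits of matrices are taken entrywise (equivalently, with respect to the norm given by the maximum of the absolute values of the entries). -}

module Defs where

open import Algebra.Apartness.Bundles using (HeytingField; module HeytingCommutativeRing)
open import Algebra.Bundles using (CommutativeRing)
open import Algebra.Bundles.Raw using (RawRing)
import Algebra.Definitions.RawSemiring as RawSemiringDefinitions
open import Algebra.Morphism.Structures using (module RingMorphisms)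
open import Data.Bool.Base using (if_then_else_)
open import Data.Fin.Base using (zero; suc; toℕ; punchIn)
import Data.Fin.Properties as Fin
open import Data.Integer.Base as ℤ using (ℤ; +_; -[1+_])
open import Data.Integer.Divisibility.Signed
  using (_∣_; divides; ∣-trans; ∣m∣n⇒∣m+n; ∣m⇒∣-m; ∣n⇒∣m*n; *-cancelˡ-∣)
import Data.Integer.Properties as ℤ
open import Data.Integer.Tactic.RingSolver using (solve-∀)
open import Data.List.Base using (List; []; _∷_; _++_; map)
open import Data.Nat.Base as ℕ using (ℕ; zero; suc)
open import Data.Nat.Primality using (Prime; prime⇒nonZero)
open import Data.Product.Base using (∃-syntax; _×_)
open import Data.Rational.Base as ℚ using (ℚ; 0ℚ; floor)
open import Data.Sum.Base using (_⊎_)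
open import Data.Vec.Functional using (Vector)
open import Function.Bundles using (_⇔_)
open import Level as Level using (Level; _⊔_)
open import Relation.Binary.PropositionalEquality as ≡ using (_≡_; cong; subst)
open import Relation.Nullary.Decidable using (does)
open import Relation.Nullary.Negation using (¬_)
open import Relation.Unary using (Pred; _∈_)

private
  variable
    c ℓ ℓ′ : Level

-- A list holds the coefficients in order of increasing degree, and
-- trailing zeros are irrelevant.

module Polynomials (R : RawRing c ℓ) where
  open RawRing R

  coeff : List Carrier → ℕ → Carrier
  coeff []      _       = 0#
  coeff (a ∷ f) zero    = a
  coeff (a ∷ f) (suc k) = coeff f k

  infixl 6 _+ₚ_
  _+ₚ_ : List Carrier → List Carrier → List Carrier
  []      +ₚ g       = g
  (a ∷ f) +ₚ []      = a ∷ f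
  (a ∷ f) +ₚ (b ∷ g) = (a + b) ∷ (f +ₚ g)

  infixl 7 _*ₚ_
  _*ₚ_ : List Carrier → List Carrier → List Carrier
  []      *ₚ g = []
  (a ∷ f) *ₚ g = map (a *_) g +ₚ (0# ∷ (f *ₚ g))

  polynomialRing : RawRing c ℓ
  polynomialRing = record
    { Carrier = List Carrier
    ; _≈_     = λ f g → ∀ k → coeff f k ≈ coeff g k
    ; _+_     = _+ₚ_
    ; _*_     = _*ₚ_
    ; -_      = map (-_)
    ; 0#      = []
    ; 1#      = 1# ∷ []
    }

  constant : Carrier → List Carrier
  constant a = a ∷ []

  X : List Carrier
  X = 0# ∷ 1# ∷ []

  eval : List Carrier → Carrier → Carrier
  eval []      x = 0#
  eval (a ∷ f) x = a + x * eval f x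

  HasRootOfMultiplicity : List Carrier → Carrier → ℕ → Set (c ⊔ ℓ)
  HasRootOfMultiplicity f a m = ((X−a ^ m) ∣ₚ f) × ¬ ((X−a ^ suc m) ∣ₚ f)
    where
    open RawSemiringDefinitions (RawRing.rawSemiring polynomialRing)
      using (_^_) renaming (_∣_ to _∣ₚ_)
    X−a = X +ₚ constant (- a)

module Matrices (R : RawRing c ℓ) where
  open RawRing R
  open RawSemiringDefinitions rawSemiring using (sum; _^_)

  Matrix : ℕ → Set c
  Matrix n = Vector (Vector Carrier n) n

  1ₘ : ∀ {n} → Matrix n
  1ₘ i j = if does (i Fin.≟ j) then 1# else 0#

  infixl 7 _*ₘ_ _*ᵥ_ _∙ₘ_ _∙ᵥ_
  infixr 8 _^ₘ_
  infix  4 _≈ᵥ_ _≈ₘ_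

  _*ₘ_ : ∀ {n} → Matrix n → Matrix n → Matrix n
  (A *ₘ B) i k = sum (λ j → A i j * B j k)

  _^ₘ_ : ∀ {n} → Matrix n → ℕ → Matrix n
  A ^ₘ zero  = 1ₘ
  A ^ₘ suc k = A *ₘ A ^ₘ k

  _*ᵥ_ : ∀ {n} → Matrix n → Vector Carrier n → Vector Carrier n
  (A *ᵥ v) i = sum (λ j → A i j * v j)

  _∙ₘ_ : ∀ {n} → Carrier → Matrix n → Matrix n
  (a ∙ₘ A) i j = a * A i j

  _∙ᵥ_ : ∀ {n} → Carrier → Vector Carrier n → Vector Carrier n
  (a ∙ᵥ v) i = a * v i

  _≈ᵥ_ : ∀ {n} → Vector Carrier n → Vector Carrier n → Set ℓ
  u ≈ᵥ v = ∀ i → u i ≈ v i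

  _≈ₘ_ : ∀ {n} → Matrix n → Matrix n → Set ℓ
  A ≈ₘ B = ∀ i j → A i j ≈ B i j

  -- Laplace expansion along the first row
  det : ∀ {n} → Matrix n → Carrier
  det {zero}  A = 1#
  det {suc n} A =
    sum (λ j → (- 1#) ^ toℕ j * (A zero j * det (λ i k → A (suc i) (punchIn j k))))

module Eigenvalues (R : RawRing c ℓ) where
  open RawRing R
  open Polynomials R
  open Matrices R public

  charPoly : ∀ {n} → Matrix n → List Carrier
  charPoly A = Matrices.det polynomialRing (λ i j → (X *ₚ 1ₚ i j) +ₚ constant (- A i j))
    where
    1ₚ : ∀ {n} → Matrices.Matrix polynomialRing n
    1ₚ = Matrices.1ₘ polynomialRing

  InEigenspace : ∀ {n} → Matrix n → Carrier → Vector Carrier n → Set ℓ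
  InEigenspace A a v = A *ᵥ v ≈ᵥ a ∙ᵥ v

  IsEigenvector : ∀ {n} → Matrix n → Carrier → Vector Carrier n → Set ℓ
  IsEigenvector A a v = ¬ (v ≈ᵥ λ _ → 0#) × InEigenspace A a v

  IsEigenvalue : ∀ {n} → Matrix n → Carrier → Set (c ⊔ ℓ)
  IsEigenvalue A a = ∃[ v ] IsEigenvector A a v

  IsSimpleEigenvalue : ∀ {n} → Matrix n → Carrier → Set (c ⊔ ℓ)
  IsSimpleEigenvalue A a = IsEigenvalue A a × HasRootOfMultiplicity (charPoly A) a 1

  IsProjectionOntoEigenspace : ∀ {n} → Matrix n → Matrix n → Carrier → Set (c ⊔ ℓ)
  IsProjectionOntoEigenspace P A a =
    (P *ₘ P ≈ₘ P) × (∀ v → InEigenspace A a v ⇔ (∃[ w ] P *ᵥ w ≈ᵥ v))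

-- For a fixed prime p, a nonnegative real r is given by its upper cut
-- { q ∈ ℚ ∣ r ≤ p^q }, so an absolute value |·| is given by the relation
-- |x| ≤ p^q between elements x and rational exponents q. Discs are
-- likewise indexed by the exponent: D a q is the closed disc of centre a
-- and radius p^q.

module AbsoluteValue (R : RawRing c ℓ) (∣_∣≤p^_ : RawRing.Carrier R → ℚ → Set ℓ′) where
  open RawRing R

  D : Carrier → ℚ → Pred Carrier ℓ′
  D a q x = ∣ x + - a ∣≤p^ q

  ∣_∣<1 : Carrier → Set ℓ′
  ∣ x ∣<1 = ∃[ q ] q ℚ.< 0ℚ × ∣ x ∣≤p^ q

  ∣_∣≡1 : Carrier → Set ℓ′
  ∣ x ∣≡1 = ∀ q → (∣ x ∣≤p^ q) ⇔ (0ℚ ℚ.≤ q)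

  IsCauchy : (ℕ → Carrier) → Set ℓ′
  IsCauchy s = ∀ q → ∃[ N ] ∀ m n → N ℕ.≤ m → N ℕ.≤ n → ∣ s m + - s n ∣≤p^ q

  infix 4 _⟶_
  _⟶_ : (ℕ → Carrier) → Carrier → Set ℓ′
  s ⟶ a = ∀ q → ∃[ N ] ∀ n → N ℕ.≤ n → ∣ s n + - a ∣≤p^ q

module PAdic {p : ℕ} (p-prime : Prime p) where

  private
    instance
      p-nonZero : ℕ.NonZero p
      p-nonZero = prime⇒nonZero p-prime

  p^_ : ℕ → ℤ
  p^ n = + (p ℕ.^ n)

  -- ℤₚ is the inverse limit of the rings ℤ/pⁿ, and ℚₚ = ℤₚ[1/p]: an element
  -- stands for numerator / p^exponent.

  record ℤₚ : Set where
    no-eta-equality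
    field
      residue  : ℕ → ℤ
      coherent : ∀ n → p^ n ∣ residue (suc n) ℤ.- residue n

  open ℤₚ public

  record ℚₚ : Set where
    no-eta-equality
    field
      numerator : ℤₚ
      exponent  : ℕ

  open ℚₚ public

  private
    ∣-≡ : ∀ {d x y} → x ≡ y → d ∣ x → d ∣ y
    ∣-≡ {d} = subst (d ∣_)

    ∣-comb : ∀ {d u v} s t → d ∣ u → d ∣ v → d ∣ s ℤ.* u ℤ.+ t ℤ.* v
    ∣-comb s t du dv = ∣m∣n⇒∣m+n (∣n⇒∣m*n s du) (∣n⇒∣m*n t dv)

    x-x : ∀ x → + 0 ≡ x ℤ.- x
    x-x = solve-∀

    p^-+ : ∀ m n → p^ (m ℕ.+ n) ≡ p^ m ℤ.* p^ n
    p^-+ m n = ≡.trans (cong +_ (^-distribˡ-+-* p m n)) (ℤ.pos-* (p ℕ.^ m) (p ℕ.^ n))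
      where open import Data.Nat.Properties using (^-distribˡ-+-*)

  fromℤₚ : ℤ → ℤₚ
  fromℤₚ z .residue  n = z
  fromℤₚ z .coherent n = ∣-≡ (x-x z) (divides (+ 0) ≡.refl)

  addℤₚ mulℤₚ : ℤₚ → ℤₚ → ℤₚ
  addℤₚ x y .residue  n = residue x n ℤ.+ residue y n
  addℤₚ x y .coherent n =
    ∣-≡ (eq (residue x (suc n)) (residue x n) (residue y (suc n)) (residue y n))
        (∣m∣n⇒∣m+n (coherent x n) (coherent y n))
    where
    eq : ∀ a b c d → (a ℤ.- b) ℤ.+ (c ℤ.- d) ≡ (a ℤ.+ c) ℤ.- (b ℤ.+ d)
    eq = solve-∀
  mulℤₚ x y .residue  n = residue x n ℤ.* residue y n
  mulℤₚ x y .coherent n =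
    ∣-≡ (eq (residue x (suc n)) (residue x n) (residue y (suc n)) (residue y n))
        (∣-comb (residue y (suc n)) (residue x n) (coherent x n) (coherent y n))
    where
    eq : ∀ a b c d → c ℤ.* (a ℤ.- b) ℤ.+ b ℤ.* (c ℤ.- d) ≡ a ℤ.* c ℤ.- b ℤ.* d
    eq = solve-∀

  num : ℚₚ → ℕ → ℤ
  num x = residue (numerator x)

  den : ℚₚ → ℤ
  den x = p^ exponent x

  infix 4 _≈_
  record _≈_ (x y : ℚₚ) : Set where
    constructor cross
    field
      uncross : ∀ n → p^ n ∣ den y ℤ.* num x n ℤ.- den x ℤ.* num y n
  open _≈_ public

  infixl 6 _+_
  infixl 7 _*_
  infix  8 -_

  _+_ _*_ : ℚₚ → ℚₚ → ℚₚ
  (x + y) .numerator = addℤₚ (mulℤₚ (fromℤₚ (den y)) (numerator x))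
                             (mulℤₚ (fromℤₚ (den x)) (numerator y))
  (x + y) .exponent  = exponent x ℕ.+ exponent y
  (x * y) .numerator = mulℤₚ (numerator x) (numerator y)
  (x * y) .exponent  = exponent x ℕ.+ exponent y

  -_ : ℚₚ → ℚₚ
  (- x) .numerator = mulℤₚ (fromℤₚ -[1+ 0 ]) (numerator x)
  (- x) .exponent  = exponent x

  fromℤ : ℤ → ℚₚ
  fromℤ z .numerator = fromℤₚ z
  fromℤ z .exponent  = 0

  0# 1# : ℚₚ
  0# = fromℤ (+ 0)
  1# = fromℤ (+ 1)

  _⁺ : ℤ → ℕ
  (+ n)    ⁺ = n
  -[1+ _ ] ⁺ = 0

  -- |a / pᵏ| ≤ p^q iff |a| ≤ p^(⌊q⌋ − k), as |a| is 0 or an integral power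
  -- of p; and |a| ≤ p⁻ᵐ, for m ≥ 0, iff a vanishes in ℤ/pᵐ.

  infix 4 ∣_∣≤p^_
  ∣_∣≤p^_ : ℚₚ → ℚ → Set
  ∣ x ∣≤p^ q = let m = (+ exponent x ℤ.- floor q) ⁺ in p^ m ∣ num x m

  private
    exact : ∀ (x y : ℚₚ) → (∀ n → den y ℤ.* num x n ≡ den x ℤ.* num y n) → x ≈ y
    exact x y eq = cross λ n →
      ∣-≡ (≡.trans (x-x (den y ℤ.* num x n))
                   (cong (λ t → den y ℤ.* num x n ℤ.- t) (eq n)))
          (divides (+ 0) ≡.refl)

    descend : ∀ (z : ℤₚ) n l → p^ n ∣ residue z (l ℕ.+ n) → p^ n ∣ residue z n
    descend z n zero    h = h
    descend z n (suc l) h = descend z n l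
      (∣-≡ (eq (residue z (suc (l ℕ.+ n))) (residue z (l ℕ.+ n)))
        (∣-comb (+ 1) -[1+ 0 ] h
          (∣-trans (divides (p^ l) (p^-+ l n)) (coherent z (l ℕ.+ n)))))
      where
      eq : ∀ a b → + 1 ℤ.* a ℤ.+ -[1+ 0 ] ℤ.* (a ℤ.- b) ≡ b
      eq = solve-∀

    cancel : ∀ (z : ℤₚ) l → (∀ n → p^ n ∣ p^ l ℤ.* residue z n) → ∀ n → p^ n ∣ residue z n
    cancel z l h n = descend z n l
      (*-cancelˡ-∣ (p^ l) {{ℤ-nonZero}}
        (subst (_∣ p^ l ℤ.* residue z (l ℕ.+ n)) (p^-+ l n) (h (l ℕ.+ n))))
      where
      open import Data.Nat.Properties using (m^n≢0)
      ℤ-nonZero : ℤ.NonZero (p^ l)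
      ℤ-nonZero = m^n≢0 p l

    ≈-refl : ∀ {x} → x ≈ x
    ≈-refl {x} = exact x x (λ _ → ≡.refl)

    ≈-sym : ∀ {x y} → x ≈ y → y ≈ x
    ≈-sym {x} {y} (cross h) = cross λ n →
      ∣-≡ (eq (den y ℤ.* num x n) (den x ℤ.* num y n)) (∣m⇒∣-m (h n))
      where
      eq : ∀ u v → ℤ.- (u ℤ.- v) ≡ v ℤ.- u
      eq = solve-∀

    ≈-trans : ∀ {x y z} → x ≈ y → y ≈ z → x ≈ z
    ≈-trans {x} {y} {z} (cross h₁) (cross h₂) = cross λ n →
      ∣-≡ (eq₂ (den z) (num x n) (den x) (num z n)) (cancel d (exponent y)
        (λ i → ∣-≡ (eq (den x) (den y) (den z) (num x i) (num y i) (num z i))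
                   (∣-comb (den z) (den x) (h₁ i) (h₂ i))) n)
      where
      d = addℤₚ (mulℤₚ (fromℤₚ (den z)) (numerator x))
                (mulℤₚ (fromℤₚ -[1+ 0 ]) (mulℤₚ (fromℤₚ (den x)) (numerator z)))
      eq : ∀ K L M a b c →
           M ℤ.* (L ℤ.* a ℤ.- K ℤ.* b) ℤ.+ K ℤ.* (M ℤ.* b ℤ.- L ℤ.* c) ≡
           L ℤ.* (M ℤ.* a ℤ.+ -[1+ 0 ] ℤ.* (K ℤ.* c))
      eq = solve-∀
      eq₂ : ∀ M a K c → M ℤ.* a ℤ.+ -[1+ 0 ] ℤ.* (K ℤ.* c) ≡ M ℤ.* a ℤ.- K ℤ.* c
      eq₂ = solve-∀

    den-* : ∀ x y → den (x * y) ≡ den x ℤ.* den y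
    den-* x y = p^-+ (exponent x) (exponent y)

    +-cong : ∀ {x y u v} → x ≈ y → u ≈ v → x + u ≈ y + v
    +-cong {x} {y} {u} {v} (cross h₁) (cross h₂) = cross λ n →
      ∣-≡ (eq {den x} {den y} {den u} {den v} (den-* x u) (den-* y v)
              (num x n) (num y n) (num u n) (num v n))
          (∣-comb (den u ℤ.* den v) (den x ℤ.* den y) (h₁ n) (h₂ n))
      where
      ring : ∀ K K′ L L′ a a′ b b′ →
           (L ℤ.* L′) ℤ.* (K′ ℤ.* a ℤ.- K ℤ.* a′) ℤ.+ (K ℤ.* K′) ℤ.* (L′ ℤ.* b ℤ.- L ℤ.* b′) ≡
           (K′ ℤ.* L′) ℤ.* (L ℤ.* a ℤ.+ K ℤ.* b) ℤ.- (K ℤ.* L) ℤ.* (L′ ℤ.* a′ ℤ.+ K′ ℤ.* b′)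
      ring = solve-∀
      eq : ∀ {K K′ L L′ KL K′L′} → KL ≡ K ℤ.* L → K′L′ ≡ K′ ℤ.* L′ → ∀ a a′ b b′ →
           (L ℤ.* L′) ℤ.* (K′ ℤ.* a ℤ.- K ℤ.* a′) ℤ.+ (K ℤ.* K′) ℤ.* (L′ ℤ.* b ℤ.- L ℤ.* b′) ≡
           K′L′ ℤ.* (L ℤ.* a ℤ.+ K ℤ.* b) ℤ.- KL ℤ.* (L′ ℤ.* a′ ℤ.+ K′ ℤ.* b′)
      eq {K} {K′} {L} {L′} ≡.refl ≡.refl = ring K K′ L L′

    *-cong : ∀ {x y u v} → x ≈ y → u ≈ v → x * u ≈ y * v
    *-cong {x} {y} {u} {v} (cross h₁) (cross h₂) = cross λ n →
      ∣-≡ (eq {den x} {den y} {den u} {den v} (den-* x u) (den-* y v)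
              (num x n) (num y n) (num u n) (num v n))
          (∣-comb (den v ℤ.* num u n) (den x ℤ.* num y n) (h₁ n) (h₂ n))
      where
      ring : ∀ K K′ L L′ a a′ b b′ →
           (L′ ℤ.* b) ℤ.* (K′ ℤ.* a ℤ.- K ℤ.* a′) ℤ.+ (K ℤ.* a′) ℤ.* (L′ ℤ.* b ℤ.- L ℤ.* b′) ≡
           (K′ ℤ.* L′) ℤ.* (a ℤ.* b) ℤ.- (K ℤ.* L) ℤ.* (a′ ℤ.* b′)
      ring = solve-∀
      eq : ∀ {K K′ L L′ KL K′L′} → KL ≡ K ℤ.* L → K′L′ ≡ K′ ℤ.* L′ → ∀ a a′ b b′ →
           (L′ ℤ.* b) ℤ.* (K′ ℤ.* a ℤ.- K ℤ.* a′) ℤ.+ (K ℤ.* a′) ℤ.* (L′ ℤ.* b ℤ.- L ℤ.* b′) ≡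
           K′L′ ℤ.* (a ℤ.* b) ℤ.- KL ℤ.* (a′ ℤ.* b′)
      eq {K} {K′} {L} {L′} ≡.refl ≡.refl = ring K K′ L L′

    -‿cong : ∀ {x y} → x ≈ y → - x ≈ - y
    -‿cong {x} {y} (cross h) = cross λ n →
      ∣-≡ (eq (den x) (den y) (num x n) (num y n)) (∣m⇒∣-m (h n))
      where
      eq : ∀ K L a b → ℤ.- (L ℤ.* a ℤ.- K ℤ.* b) ≡
           L ℤ.* (-[1+ 0 ] ℤ.* a) ℤ.- K ℤ.* (-[1+ 0 ] ℤ.* b)
      eq = solve-∀

    +-assoc : ∀ x y z → (x + y) + z ≈ x + (y + z)
    +-assoc x y z = exact ((x + y) + z) (x + (y + z)) λ n →
      lem n (den-* x y) (den-* y z) (den-* (x * y) z) (den-* x (y * z))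
      where
      eq : ∀ K L M a b c →
           (K ℤ.* (L ℤ.* M)) ℤ.* (M ℤ.* (L ℤ.* a ℤ.+ K ℤ.* b) ℤ.+ (K ℤ.* L) ℤ.* c) ≡
           ((K ℤ.* L) ℤ.* M) ℤ.* ((L ℤ.* M) ℤ.* a ℤ.+ K ℤ.* (M ℤ.* b ℤ.+ L ℤ.* c))
      eq = solve-∀
      lem : ∀ n {KL LM KL-M K-LM} → KL ≡ den x ℤ.* den y → LM ≡ den y ℤ.* den z →
            KL-M ≡ KL ℤ.* den z → K-LM ≡ den x ℤ.* LM →
            K-LM ℤ.* (den z ℤ.* (den y ℤ.* num x n ℤ.+ den x ℤ.* num y n) ℤ.+ KL ℤ.* num z n) ≡
            KL-M ℤ.* (LM ℤ.* num x n ℤ.+ den x ℤ.* (den z ℤ.* num y n ℤ.+ den y ℤ.* num z n))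
      lem n ≡.refl ≡.refl ≡.refl ≡.refl =
        eq (den x) (den y) (den z) (num x n) (num y n) (num z n)

    +-comm : ∀ x y → x + y ≈ y + x
    +-comm x y = exact (x + y) (y + x) λ n →
      lem n (den-* x y) (den-* y x)
      where
      eq : ∀ K L a b → (L ℤ.* K) ℤ.* (L ℤ.* a ℤ.+ K ℤ.* b) ≡ (K ℤ.* L) ℤ.* (K ℤ.* b ℤ.+ L ℤ.* a)
      eq = solve-∀
      lem : ∀ n {KL LK} → KL ≡ den x ℤ.* den y → LK ≡ den y ℤ.* den x →
            LK ℤ.* (den y ℤ.* num x n ℤ.+ den x ℤ.* num y n) ≡
            KL ℤ.* (den x ℤ.* num y n ℤ.+ den y ℤ.* num x n)
      lem n ≡.refl ≡.refl = eq (den x) (den y) (num x n) (num y n)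

    +-identityˡ : ∀ x → 0# + x ≈ x
    +-identityˡ x = exact (0# + x) x λ n → eq (den x) (num x n)
      where
      eq : ∀ K a → K ℤ.* (K ℤ.* + 0 ℤ.+ + 1 ℤ.* a) ≡ K ℤ.* a
      eq = solve-∀

    -‿inverseˡ : ∀ x → - x + x ≈ 0#
    -‿inverseˡ x = exact (- x + x) 0# λ n → eq (den x) (p^ (exponent x ℕ.+ exponent x)) (num x n)
      where
      eq : ∀ K KK a → + 1 ℤ.* (K ℤ.* (-[1+ 0 ] ℤ.* a) ℤ.+ K ℤ.* a) ≡ KK ℤ.* + 0
      eq = solve-∀

    *-assoc : ∀ x y z → (x * y) * z ≈ x * (y * z)
    *-assoc x y z = exact ((x * y) * z) (x * (y * z)) λ n →
      ≡.cong₂ ℤ._*_ (cong p^_ (≡.sym (ℕ-+-assoc (exponent x) (exponent y) (exponent z))))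
                    (ℤ.*-assoc (num x n) (num y n) (num z n))
      where open import Data.Nat.Properties renaming (+-assoc to ℕ-+-assoc)

    *-comm : ∀ x y → x * y ≈ y * x
    *-comm x y = exact (x * y) (y * x) λ n →
      ≡.cong₂ ℤ._*_ (cong p^_ (ℕ-+-comm (exponent y) (exponent x))) (ℤ.*-comm (num x n) (num y n))
      where open import Data.Nat.Properties renaming (+-comm to ℕ-+-comm)

    *-identityˡ : ∀ x → 1# * x ≈ x
    *-identityˡ x = exact (1# * x) x λ n → cong (den x ℤ.*_) (ℤ.*-identityˡ (num x n))

    *-distribʳ-+ : ∀ x y z → (y + z) * x ≈ y * x + z * x
    *-distribʳ-+ x y z = exact ((y + z) * x) (y * x + z * x) λ n →
      lem n (den-* y x) (den-* z x) (den-* y z) (den-* (y * z) x) (den-* (y * x) (z * x))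
      where
      eq : ∀ K L M a b c →
           ((L ℤ.* K) ℤ.* (M ℤ.* K)) ℤ.* ((M ℤ.* b ℤ.+ L ℤ.* c) ℤ.* a) ≡
           ((L ℤ.* M) ℤ.* K) ℤ.* ((M ℤ.* K) ℤ.* (b ℤ.* a) ℤ.+ (L ℤ.* K) ℤ.* (c ℤ.* a))
      eq = solve-∀
      lem : ∀ n {LK MK LM LMK LKMK} → LK ≡ den y ℤ.* den x → MK ≡ den z ℤ.* den x →
            LM ≡ den y ℤ.* den z →
            LMK ≡ LM ℤ.* den x → LKMK ≡ LK ℤ.* MK →
            LKMK ℤ.* ((den z ℤ.* num y n ℤ.+ den y ℤ.* num z n) ℤ.* num x n) ≡
            LMK ℤ.* (MK ℤ.* (num y n ℤ.* num x n) ℤ.+ LK ℤ.* (num z n ℤ.* num x n))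
      lem n ≡.refl ≡.refl ≡.refl ≡.refl ≡.refl =
        eq (den x) (den y) (den z) (num x n) (num y n) (num z n)

  ℚₚ-commutativeRing : CommutativeRing _ _
  ℚₚ-commutativeRing = record
    { Carrier = ℚₚ ; _≈_ = _≈_ ; _+_ = _+_ ; _*_ = _*_ ; -_ = -_ ; 0# = 0# ; 1# = 1#
    ; isCommutativeRing = record
      { isRing = record
        { +-isAbelianGroup = record
          { isGroup = record
            { isMonoid = record
              { isSemigroup = record
                { isMagma = record { isEquivalence = ≈-isEquivalence ; ∙-cong = +-cong }
                ; assoc = +-assoc }
              ; identity = comm∧idˡ⇒id +-comm +-identityˡ }
            ; inverse = comm∧invˡ⇒inv +-comm -‿inverseˡ
            ; ⁻¹-cong = -‿cong }
          ; comm = +-comm }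
        ; *-cong = *-cong
        ; *-assoc = *-assoc
        ; *-identity = comm∧idˡ⇒id *-comm *-identityˡ
        ; distrib = comm∧distrʳ⇒distr +-cong *-comm *-distribʳ-+ }
      ; *-comm = *-comm } }
    where
    open import Relation.Binary.Bundles using (Setoid)
    open import Relation.Binary.Structures using (IsEquivalence)
    ≈-isEquivalence : IsEquivalence _≈_
    ≈-isEquivalence = record
      { refl  = ≈-refl
      ; sym   = ≈-sym
      ; trans = ≈-trans }
    ≈-setoid : Setoid _ _
    ≈-setoid = record { isEquivalence = ≈-isEquivalence }
    open import Algebra.Consequences.Setoid ≈-setoid
      using (comm∧idˡ⇒id; comm∧invˡ⇒inv; comm∧distrʳ⇒distr)

  open CommutativeRing ℚₚ-commutativeRing public using () renaming (rawRing to ℚₚ-rawRing)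
  open AbsoluteValue ℚₚ-rawRing ∣_∣≤p^_ public

  -- The completion of the algebraic closure of ℚₚ is given by its
  -- characterization up to isometric isomorphism: a complete algebraically
  -- closed field with an absolute value extending that of ℚₚ, in which the
  -- elements algebraic over ℚₚ are dense.

  record ℂₚ (c ℓ : Level) : Set (Level.suc (c ⊔ ℓ)) where
    field
      heytingField : HeytingField c ℓ ℓ

    open HeytingField heytingField public
      using (Carrier; _#_)
      renaming (_≈_ to _≈ℂ_; _+_ to _+ℂ_; _*_ to _*ℂ_; 0# to 0ℂ; 1# to 1ℂ)

    rawRing : RawRing c ℓ
    rawRing = CommutativeRing.rawRing
      (HeytingCommutativeRing.commutativeRing
        (HeytingField.heytingCommutativeRing heytingField))

    field
      ∣_∣ℂ≤p^_ : Carrier → ℚ → Set ℓ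

    open AbsoluteValue rawRing ∣_∣ℂ≤p^_ public
      using () renaming (∣_∣<1 to ∣_∣ℂ<1; D to Dℂ; IsCauchy to IsCauchyℂ; _⟶_ to _⟶ℂ_)
    open Polynomials rawRing using (eval)

    field
      -- { q ∣ |x| ≤ p^q } is the located upper cut of a real in [0,∞)
      ∣∣-resp    : ∀ {x y q} → x ≈ℂ y → ∣ x ∣ℂ≤p^ q → ∣ y ∣ℂ≤p^ q
      ∣∣-mono    : ∀ {x q r} → q ℚ.≤ r → ∣ x ∣ℂ≤p^ q → ∣ x ∣ℂ≤p^ r
      ∣∣-closed  : ∀ {x q} → (∀ r → q ℚ.< r → ∣ x ∣ℂ≤p^ r) → ∣ x ∣ℂ≤p^ q
      ∣∣-located : ∀ x {q r} → q ℚ.< r → ∣ x ∣ℂ≤p^ r ⊎ ¬ (∣ x ∣ℂ≤p^ q)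
      ∣∣-finite  : ∀ x → ∃[ q ] ∣ x ∣ℂ≤p^ q

      -- |x| = 0 iff x = 0;  |x y| = |x| |y|;  |x + y| ≤ max(|x|,|y|)
      ∣∣-#0   : ∀ {x} → (x # 0ℂ) ⇔ (∃[ q ] ¬ (∣ x ∣ℂ≤p^ q))
      ∣∣-*-≤  : ∀ {x y q r} → ∣ x ∣ℂ≤p^ q → ∣ y ∣ℂ≤p^ r → ∣ x *ℂ y ∣ℂ≤p^ (q ℚ.+ r)
      ∣∣-*-≥  : ∀ {x y q r} → ∣ x *ℂ y ∣ℂ≤p^ (q ℚ.+ r) → ¬ (∣ x ∣ℂ≤p^ q) → ∣ y ∣ℂ≤p^ r
      ∣∣-+    : ∀ {x y q} → ∣ x ∣ℂ≤p^ q → ∣ y ∣ℂ≤p^ q → ∣ x +ℂ y ∣ℂ≤p^ q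

      ι                 : ℚₚ → Carrier
      ι-isHomomorphism  : RingMorphisms.IsRingHomomorphism ℚₚ-rawRing rawRing ι
      ι-isometry        : ∀ x q → (∣ ι x ∣ℂ≤p^ q) ⇔ (∣ x ∣≤p^ q)

      -- a ∷ f ++ 1ℂ ∷ [] is an arbitrary monic polynomial of positive degree
      algebraicallyClosed : ∀ a f → ∃[ x ] eval (a ∷ f ++ 1ℂ ∷ []) x ≈ℂ 0ℂ
      complete            : ∀ s → IsCauchyℂ s → ∃[ x ] s ⟶ℂ x

    Algebraic : Pred Carrier ℓ
    Algebraic x = ∃[ f ] eval (map ι (f ++ 1# ∷ [])) x ≈ℂ 0ℂ

    field
      algebraic-dense : ∀ x q → ∃[ y ] Algebraic y × y ∈ Dℂ x q

{-# OPTIONS --safe #-}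

-- The eigenvectors of A with first entry 1 are the zeros of the quadratic
-- map x ↦ (A x)₀ x - A x, whose derivative on vectors x ≡ 1 (mod p) is the
-- scalar n modulo p. As p ∤ n, Newton's iteration with a fixed inverse of
-- n modulo p converges and gives λmax = (A x)₀ ≡ n; the transpose gives a
-- left eigenvector y ≡ 1 for the same eigenvalue, because y · x ≡ n is a
-- unit. Column operations with x give
-- charPoly A = (X - λmax) charPoly M with M ≡ 0, and charPoly M does not
-- vanish at the unit λmax, so the root is simple. An eigenvector v of any
-- other eigenvalue μ satisfies y · v = 0, so μ v = (A - 1 yᵀ) v, and
-- A - 1 yᵀ ≡ 0. Finally P = x yᵀ / (y · x) satisfies
-- Bᵏ⁺¹ - P = (B - P)(Bᵏ - P) for B = A / λmax, and B ≡ P.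

module Submission where

open import Defs
open import Algebra.Apartness.Bundles using (HeytingField; module HeytingCommutativeRing)
open import Algebra.Bundles using (CommutativeMonoid; CommutativeRing)
open import Algebra.Bundles.Raw using (RawRing)
open import Algebra.Definitions.RawMagma using (_,_)
open import Algebra.Morphism.Structures using (module RingMorphisms)
import Algebra.Properties.AbelianGroup as AbelianGroupProperties
import Algebra.Properties.CommutativeSemigroup as CommutativeSemigroupProperties
import Algebra.Properties.Group as GroupProperties
import Algebra.Properties.Ring as RingProperties
import Algebra.Properties.Semiring.Exp as Exp
import Algebra.Properties.Semiring.Mult.TCOptimised as Mult′
import Algebra.Properties.Semiring.Sum as Sum
import Algebra.Solver.Ring as RingSolver
open import Algebra.Solver.Ring.AlmostCommutativeRing using (fromCommutativeRing; _-Raw-AlmostCommutative⟶_)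
open import Data.Bool.Base using (true; false; if_then_else_)
open import Data.Fin.Base using (Fin; zero; suc; toℕ; inject₁; punchIn; punchOut)
open import Data.Fin.Induction using (<-weakInduction)
import Data.Fin.Properties as Fin
open import Data.Integer.Base as ℤ using (ℤ; +_; -[1+_]; 0ℤ; +≤+; -≤+)
open import Data.Integer.Divisibility.Signed
  using ( _∣_; divides; quotient; ∣-trans; ∣m∣n⇒∣m+n; ∣m∣n⇒∣m-n; ∣m⇒∣-m; ∣n⇒∣m*n; ∣m⇒∣m*n; ∣⇒∣ᵤ
        ; *-cancelˡ-∣; *-cancelʳ-∣; *-monoʳ-∣; *-monoˡ-∣ )
open import Data.Integer.DivMod using (0≤n⇒0≤n/ℕd; [n/ℕd]*d≤n; div-pos-is-/ℕ)
import Data.Integer.Properties as ℤ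
open import Data.Integer.Tactic.RingSolver using (solve-∀)
open import Data.List.Base using (List; []; _∷_; map)
import Data.Maybe.Base as Maybe
open import Data.Nat.Base as ℕ using (ℕ; zero; suc; NonZero; _≤′_; ≤′-refl; ≤′-step)
open import Data.Nat.Coprimality using (Coprime; coprime-Bézout)
open import Data.Nat.Divisibility as ℕ using (_∤_; _∣0)
open import Data.Nat.GCD using (module Bézout)
open import Data.Nat.Primality using (Prime; prime⇒irreducible; prime⇒nonTrivial; prime⇒nonZero)
import Data.Nat.Properties as ℕ
open import Data.Product.Base using (∃-syntax; _×_; _,_; proj₁; proj₂)
open import Data.Rational.Base as ℚ using (ℚ; mkℚ; 0ℚ; 1ℚ; ½; floor) renaming (-_ to -ℚ_)
import Data.Rational.Properties as ℚ
import Data.Rational.Unnormalised.Base as ℚᵘ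
import Data.Rational.Unnormalised.Properties as ℚᵘ
open import Data.Sum.Base using (inj₁; inj₂)
open import Data.Vec.Functional using (Vector; updateAt) renaming (_∷_ to _∷ᵥ_)
open import Data.Vec.Functional.Properties using (updateAt-updates; updateAt-minimal)
open import Function.Base using (_∘_; const; flip)
open import Function.Bundles using (mk⇔; module Equivalence)
open import Level using (Level; _⊔_; 0ℓ)
open import Relation.Binary.Consequences using (dec⇒weaklyDec)
open import Relation.Binary.PropositionalEquality as ≡ using (_≡_; _≢_; cong; cong₂; subst; subst₂)
import Relation.Binary.Reasoning.Setoid as SetoidReasoning
open import Relation.Binary.Structures using (IsEquivalence)
open import Relation.Nullary.Decidable using (does; from-yes; yes; no)
open import Relation.Nullary.Negation using (¬_; contradiction)
open import Relation.Unary using (Pred; _∈_)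

-- The derivative of x ↦ (A x)₀ x - A x in direction d is (A x)₀ d + (A d)₀ x - A d. Modulo p all
-- rows of A coincide, so A d is the constant vector (A d)₀ there and cancels (A d)₀ x, as x ≡ 1;
-- what remains is n d. Taking (A x)₀ as the eigenvalue thus makes the Jacobian invertible, yields
-- eigenvalue and eigenvector together, and forces x₀ = 1. As n is inverted only modulo p, each step
-- of the iteration gains one power of p.
--
-- The construction of λmax, x, y and P takes place in a commutative ring with a filtration `I k`,
-- away from the residues and denominators of ℚₚ. Equality is not decided in either field, which
-- shapes the rest. Simplicity of the root is reached by cancelling X - λmax, which is possible over
-- every commutative ring. Over ℂₚ an eigenvector is merely unequal to zero, with no coordinate
-- known to be largest or invertible; so a μ that is not small is excluded by lowering every common
-- bound of the coordinates of v by a fixed factor, which forces v = 0.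

-- Normalisation of ring expressions with integer coefficients.

-- The ring solver with coefficients in ℤ rather than in the ring itself,
-- whose equality is not decidable, so that cancellations are recognised.
module IntegerSolver {c ℓ} (R : CommutativeRing c ℓ) where
  open CommutativeRing R
  open AbelianGroupProperties +-abelianGroup using (⁻¹-∙-comm; ⁻¹-involutive; ε⁻¹≈ε)
  open RingProperties ring using (-‿distribˡ-*; -‿distribʳ-*)
  open Mult′ semiring using (1+×; ×1-homo-*)
    renaming (_×_ to _×′_; ×-homo-+ to ×-homo)
  open SetoidReasoning setoid

  private
    ⟦_⟧ : ℤ → Carrier
    ⟦ + n ⟧      = n ×′ 1#
    ⟦ -[1+ n ] ⟧ = - (suc n ×′ 1#)

    neg-homo : ∀ i → ⟦ ℤ.- i ⟧ ≈ - ⟦ i ⟧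
    neg-homo (+ zero)   = sym ε⁻¹≈ε
    neg-homo (+ suc n)  = refl
    neg-homo -[1+ n ]   = sym (⁻¹-involutive _)

    ⊖-homo : ∀ m n → ⟦ m ℤ.⊖ n ⟧ ≈ ⟦ + m ⟧ - ⟦ + n ⟧
    ⊖-homo m zero = sym (trans (+-congˡ ε⁻¹≈ε) (+-identityʳ _))
    ⊖-homo zero (suc n) = sym (+-identityˡ _)
    ⊖-homo (suc m) (suc n) = begin
      ⟦ suc m ℤ.⊖ suc n ⟧                       ≡⟨ ≡.cong ⟦_⟧ (ℤ.[1+m]⊖[1+n]≡m⊖n m n) ⟩
      ⟦ m ℤ.⊖ n ⟧                               ≈⟨ ⊖-homo m n ⟩
      ⟦ + m ⟧ - ⟦ + n ⟧                         ≈⟨ +-congʳ (+-identityˡ _) ⟨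
      0# + ⟦ + m ⟧ - ⟦ + n ⟧                    ≈⟨ +-congʳ (+-congʳ (-‿inverseʳ 1#)) ⟨
      1# - 1# + ⟦ + m ⟧ - ⟦ + n ⟧               ≈⟨ +-congʳ (+-assoc _ _ _) ⟩
      1# + (- 1# + ⟦ + m ⟧) - ⟦ + n ⟧           ≈⟨ +-congʳ (+-congˡ (+-comm _ _)) ⟩
      1# + (⟦ + m ⟧ - 1#) - ⟦ + n ⟧             ≈⟨ +-congʳ (+-assoc _ _ _) ⟨
      1# + ⟦ + m ⟧ - 1# - ⟦ + n ⟧               ≈⟨ +-assoc _ _ _ ⟩
      1# + ⟦ + m ⟧ + (- 1# - ⟦ + n ⟧)           ≈⟨ +-cong (sym (1+× m 1#)) (trans (⁻¹-∙-comm _ _) (-‿cong (sym (1+× n 1#)))) ⟩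
      ⟦ + suc m ⟧ - ⟦ + suc n ⟧                 ∎

    +-homo : ∀ i j → ⟦ i ℤ.+ j ⟧ ≈ ⟦ i ⟧ + ⟦ j ⟧
    +-homo (+ m)    (+ n)    = ×-homo 1# m n
    +-homo (+ m)    -[1+ n ] = ⊖-homo m (suc n)
    +-homo -[1+ m ] (+ n)    = trans (⊖-homo n (suc m)) (+-comm _ _)
    +-homo -[1+ m ] -[1+ n ] = begin
      - ⟦ + suc (suc (m ℕ.+ n)) ⟧               ≡⟨ ≡.cong (λ k → - ⟦ + suc k ⟧) (≡.sym (ℕ.+-suc m n)) ⟩
      - ⟦ + (suc m ℕ.+ suc n) ⟧                 ≈⟨ -‿cong (×-homo 1# (suc m) (suc n)) ⟩
      - (⟦ + suc m ⟧ + ⟦ + suc n ⟧)             ≈⟨ ⁻¹-∙-comm _ _ ⟨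
      ⟦ -[1+ m ] ⟧ + ⟦ -[1+ n ] ⟧               ∎

    *-homo⁺ : ∀ i n → ⟦ i ℤ.* + n ⟧ ≈ ⟦ i ⟧ * ⟦ + n ⟧
    *-homo⁺ (+ m)    n = trans (reflexive (≡.cong ⟦_⟧ (≡.sym (ℤ.pos-* m n)))) (×1-homo-* m n)
    *-homo⁺ -[1+ m ] n = begin
      ⟦ -[1+ m ] ℤ.* + n ⟧                      ≡⟨ ≡.cong ⟦_⟧ (≡.sym (ℤ.neg-distribˡ-* (+ suc m) (+ n))) ⟩
      ⟦ ℤ.- (+ suc m ℤ.* + n) ⟧                 ≈⟨ neg-homo (+ suc m ℤ.* + n) ⟩
      - ⟦ + suc m ℤ.* + n ⟧                     ≈⟨ -‿cong (*-homo⁺ (+ suc m) n) ⟩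
      - (⟦ + suc m ⟧ * ⟦ + n ⟧)                 ≈⟨ -‿distribˡ-* _ _ ⟩
      ⟦ -[1+ m ] ⟧ * ⟦ + n ⟧                    ∎

    *-homo : ∀ i j → ⟦ i ℤ.* j ⟧ ≈ ⟦ i ⟧ * ⟦ j ⟧
    *-homo i (+ n)    = *-homo⁺ i n
    *-homo i -[1+ n ] = begin
      ⟦ i ℤ.* -[1+ n ] ⟧                        ≡⟨ ≡.cong ⟦_⟧ (≡.sym (ℤ.neg-distribʳ-* i (+ suc n))) ⟩
      ⟦ ℤ.- (i ℤ.* + suc n) ⟧                   ≈⟨ neg-homo (i ℤ.* + suc n) ⟩
      - ⟦ i ℤ.* + suc n ⟧                       ≈⟨ -‿cong (*-homo⁺ i (suc n)) ⟩
      - (⟦ i ⟧ * ⟦ + suc n ⟧)                   ≈⟨ -‿distribʳ-* _ _ ⟩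
      ⟦ i ⟧ * ⟦ -[1+ n ] ⟧                      ∎

    homomorphism : ℤ.+-*-rawRing -Raw-AlmostCommutative⟶ fromCommutativeRing R
    homomorphism = record
      { ⟦_⟧ = ⟦_⟧ ; +-homo = +-homo ; *-homo = *-homo ; -‿homo = neg-homo
      ; 0-homo = refl ; 1-homo = refl }

  open RingSolver ℤ.+-*-rawRing (fromCommutativeRing R) homomorphism
    (λ i j → Maybe.map (λ eq → reflexive (≡.cong ⟦_⟧ eq)) (dec⇒weaklyDec ℤ._≟_ i j)) public
    using (solve; con; _:=_; _:+_; _:*_; _:-_; :-_)

-- Determinants: linearity and alternation in the columns, and deflation by an eigenvector.

data Adjacent : ∀ {n} → Fin n → Fin n → Set where
  zero : ∀ {n} → Adjacent {suc (suc n)} zero (suc zero)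
  suc  : ∀ {n} {j k : Fin n} → Adjacent j k → Adjacent (suc j) (suc k)

adjacent-toℕ : ∀ {n} {j k : Fin n} → Adjacent j k → toℕ k ≡ suc (toℕ j)
adjacent-toℕ zero    = ≡.refl
adjacent-toℕ (suc a) = ≡.cong suc (adjacent-toℕ a)

-- Deleting a third column keeps two neighbours adjacent, so the induction in `det-adjacent` can
-- pass to minors.
adjacent-punchOut : ∀ {n} {j k l : Fin (suc n)} → Adjacent j k →
                    (l≢j : l ≢ j) (l≢k : l ≢ k) → Adjacent (punchOut l≢j) (punchOut l≢k)
adjacent-punchOut {l = zero}        zero    l≢j l≢k = contradiction ≡.refl l≢j
adjacent-punchOut {l = suc zero}    zero    l≢j l≢k = contradiction ≡.refl l≢k
adjacent-punchOut {suc (suc n)} {l = suc (suc l)} zero l≢j l≢k = zero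
adjacent-punchOut {l = zero}        (suc a) l≢j l≢k = a
adjacent-punchOut {suc n} {l = suc l} (suc a) l≢j l≢k =
  suc (adjacent-punchOut a (l≢j ∘ ≡.cong suc) (l≢k ∘ ≡.cong suc))

module Determinant {c ℓ} (R : CommutativeRing c ℓ) where
  open CommutativeRing R hiding (zero)
  open Matrices rawRing
  open IntegerSolver R
  open Sum semiring using (sum; sum-cong-≋; ∑-distrib-+; *-distribˡ-sum; sum-replicate-zero)
  open Exp semiring using (_^_)
  open SetoidReasoning setoid

  sum-zero : ∀ {n} {f : Vector Carrier n} → (∀ i → f i ≈ 0#) → sum f ≈ 0#
  sum-zero {n} f≈0 = trans (sum-cong-≋ f≈0) (sum-replicate-zero n)

  sum-*-1ₘ : ∀ {n} (i : Fin n) (v : Vector Carrier n) → sum (λ j → 1ₘ i j * v j) ≈ v i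
  sum-*-1ₘ {suc n} zero    v = trans (+-cong (*-identityˡ _) (sum-zero {n} λ j → zeroˡ _)) (+-identityʳ _)
  sum-*-1ₘ {suc n} (suc i) v = trans (+-cong (zeroˡ _) (sum-*-1ₘ i (v ∘ suc))) (+-identityˡ _)

  sum-1ₘ-* : ∀ {n} (j : Fin n) (v : Vector Carrier n) → sum (λ i → v i * 1ₘ i j) ≈ v j
  sum-1ₘ-* {suc n} zero    v = trans (+-cong (*-identityʳ _) (sum-zero {n} λ i → zeroʳ _)) (+-identityʳ _)
  sum-1ₘ-* {suc n} (suc j) v = trans (+-cong (zeroʳ _) (sum-1ₘ-* j (v ∘ suc))) (+-identityˡ _)

  private
    variable
      n : ℕ

    minor : Matrix (suc n) → Fin (suc n) → Matrix n
    minor A j i k = A (suc i) (punchIn j k)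

    sign : Fin n → Carrier
    sign j = (- 1#) ^ toℕ j

    term : Matrix (suc n) → Fin (suc n) → Carrier
    term A j = sign j * (A zero j * det (minor A j))

    infix 4 _≈[_]_
    _≈[_]_ : Matrix n → Fin n → Matrix n → Set ℓ
    A ≈[ j ] B = ∀ i k → k ≢ j → A i k ≈ B i k

  det-cong : {A B : Matrix n} → A ≈ₘ B → det A ≈ det B
  det-cong {zero}  A≈B = refl
  det-cong {suc n} A≈B = sum-cong-≋ {suc n} λ j →
    *-congˡ {sign j} (*-cong (A≈B zero j) (det-cong λ i k → A≈B (suc i) (punchIn j k)))

  -- A relation between three matrices instead of a column update, so that the induction applies to
  -- minors as they are: deleting column `j` makes the three minors agree, and deleting another
  -- column leaves the same hypotheses at `punchOut k≢j`.
  det-linear : ∀ (j : Fin n) {A B C : Matrix n} t → A ≈[ j ] B → A ≈[ j ] C →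
               (∀ i → A i j ≈ B i j + t * C i j) → det A ≈ det B + t * det C
  det-linear {suc n} j {A} {B} {C} t A≈B A≈C Aⱼ = begin
    sum (term A)                             ≈⟨ sum-cong-≋ {suc n} step ⟩
    sum (λ k → term B k + t * term C k)      ≈⟨ ∑-distrib-+ (term B) (λ k → t * term C k) ⟩
    sum (term B) + sum (λ k → t * term C k)  ≈⟨ +-congˡ (*-distribˡ-sum t (term C)) ⟨
    sum (term B) + t * sum (term C)          ∎
    where
    step : ∀ k → term A k ≈ term B k + t * term C k
    step k with k Fin.≟ j
    ... | yes ≡.refl = begin
      sign j * (A zero j * det (minor A j))
        ≈⟨ *-congˡ (*-congʳ (Aⱼ zero)) ⟩
      sign j * ((B zero j + t * C zero j) * det (minor A j))
        ≈⟨ solve 5 (λ s b t c m → s :* ((b :+ t :* c) :* m) := s :* (b :* m) :+ t :* (s :* (c :* m)))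
             refl (sign j) (B zero j) t (C zero j) (det (minor A j)) ⟩
      sign j * (B zero j * det (minor A j)) + t * (sign j * (C zero j * det (minor A j)))
        ≈⟨ +-cong (*-congˡ (*-congˡ (det-cong λ i l → A≈B (suc i) _ (Fin.punchInᵢ≢i j l))))
                  (*-congˡ (*-congˡ (*-congˡ (det-cong λ i l → A≈C (suc i) _ (Fin.punchInᵢ≢i j l))))) ⟩
      term B j + t * term C j ∎
    ... | no k≢j = begin
      sign k * (A zero k * det (minor A k))
        ≈⟨ *-congˡ (*-congˡ (det-linear (punchOut k≢j) t
             (λ i l l≢ → A≈B (suc i) _ (off l l≢)) (λ i l l≢ → A≈C (suc i) _ (off l l≢)) λ i → at (suc i))) ⟩
      sign k * (A zero k * (det (minor B k) + t * det (minor C k)))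
        ≈⟨ solve 5 (λ s a t b c → s :* (a :* (b :+ t :* c)) := s :* (a :* b) :+ t :* (s :* (a :* c)))
             refl (sign k) (A zero k) t (det (minor B k)) (det (minor C k)) ⟩
      sign k * (A zero k * det (minor B k)) + t * (sign k * (A zero k * det (minor C k)))
        ≈⟨ +-cong (*-congˡ (*-congʳ (A≈B zero k k≢j))) (*-congˡ (*-congˡ (*-congʳ (A≈C zero k k≢j)))) ⟩
      term B k + t * term C k ∎
      where
      off : ∀ l → l ≢ punchOut k≢j → punchIn k l ≢ j
      off l l≢ eq = l≢ (Fin.punchIn-injective k l (punchOut k≢j) (≡.trans eq (≡.sym (Fin.punchIn-punchOut k≢j))))
      at : ∀ i → A i (punchIn k (punchOut k≢j)) ≈ B i (punchIn k (punchOut k≢j)) + t * C i (punchIn k (punchOut k≢j))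
      at i rewrite Fin.punchIn-punchOut k≢j = Aⱼ i

  private
    sum-adjacent : ∀ {j k : Fin n} → Adjacent j k → (f : Vector Carrier n) →
                   (∀ l → l ≢ j → l ≢ k → f l ≈ 0#) → f j + f k ≈ 0# → sum f ≈ 0#
    sum-adjacent {suc (suc n)} zero f f≈0 f₀+f₁≈0 = begin
      f zero + (f (suc zero) + sum {n} (λ l → f (suc (suc l))))
        ≈⟨ +-assoc _ _ _ ⟨
      (f zero + f (suc zero)) + sum {n} (λ l → f (suc (suc l)))
        ≈⟨ +-cong f₀+f₁≈0 (sum-zero λ l → f≈0 (suc (suc l)) (λ ()) (λ ())) ⟩
      0# + 0#
        ≈⟨ +-identityˡ 0# ⟩
      0# ∎
    sum-adjacent (suc a) f f≈0 fⱼ+fₖ≈0 = trans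
      (+-cong (f≈0 zero (λ ()) (λ ()))
              (sum-adjacent a (f ∘ suc)
                (λ l l≢j l≢k → f≈0 (suc l) (l≢j ∘ Fin.suc-injective) (l≢k ∘ Fin.suc-injective)) fⱼ+fₖ≈0))
      (+-identityˡ 0#)

    -- After the deletion of `j`, column `k` stands in the place that `j` takes after the deletion
    -- of `k`; all other columns stay where they are.
    punchIn-adjacent : ∀ {n} {j k : Fin (suc n)} → Adjacent j k → (r : Vector Carrier (suc n)) → r j ≈ r k →
                       ∀ l → r (punchIn j l) ≈ r (punchIn k l)
    punchIn-adjacent zero    r eq zero    = sym eq
    punchIn-adjacent zero    r eq (suc l) = refl
    punchIn-adjacent {suc n} (suc a) r eq zero    = refl
    punchIn-adjacent {suc n} (suc a) r eq (suc l) = punchIn-adjacent a (r ∘ suc) eq l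

  -- In the expansion along the first row, the minors that keep both columns vanish by induction.
  -- The two remaining terms have equal minors, because the columns are neighbours, and opposite
  -- signs.
  det-adjacent : ∀ {j k : Fin n} → Adjacent j k → (A : Matrix n) → (∀ i → A i j ≈ A i k) → det A ≈ 0#
  det-adjacent {suc n} {j} {k} a A Aⱼ≈Aₖ = sum-adjacent a (term A) others pair
    where
    others : ∀ l → l ≢ j → l ≢ k → term A l ≈ 0#
    others l l≢j l≢k = begin
      sign l * (A zero l * det (minor A l))
        ≈⟨ *-congˡ (*-congˡ (det-adjacent (adjacent-punchOut a l≢j l≢k) (minor A l) eq)) ⟩
      sign l * (A zero l * 0#)
        ≈⟨ trans (*-congˡ (zeroʳ _)) (zeroʳ _) ⟩
      0# ∎
      where
      eq : ∀ i → minor A l i (punchOut l≢j) ≈ minor A l i (punchOut l≢k)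
      eq i rewrite Fin.punchIn-punchOut l≢j | Fin.punchIn-punchOut l≢k = Aⱼ≈Aₖ (suc i)
    pair : term A j + term A k ≈ 0#
    pair rewrite adjacent-toℕ a = begin
      sign j * (A zero j * det (minor A j)) + (- 1# * sign j) * (A zero k * det (minor A k))
        ≈⟨ +-congˡ (*-congˡ (*-cong (Aⱼ≈Aₖ zero)
             (det-cong λ i → punchIn-adjacent a (A (suc i)) (Aⱼ≈Aₖ (suc i))))) ⟨
      sign j * (A zero j * det (minor A j)) + (- 1# * sign j) * (A zero j * det (minor A j))
        ≈⟨ solve 3 (λ s x m → s :* (x :* m) :+ (:- con (+ 1) :* s) :* (x :* m) := con (+ 0))
             refl (sign j) (A zero j) (det (minor A j)) ⟩
      0# ∎

  infixl 9 _[_≔_]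
  _[_≔_] : Matrix n → Fin n → Vector Carrier n → Matrix n
  (A [ j ≔ v ]) i = updateAt (A i) j (const (v i))

  []≔-at : ∀ (A : Matrix n) j v i → (A [ j ≔ v ]) i j ≈ v i
  []≔-at A j v i = reflexive (updateAt-updates j (A i))

  []≔-off : ∀ (A : Matrix n) {j k} v → k ≢ j → ∀ i → (A [ j ≔ v ]) i k ≈ A i k
  []≔-off A {j} {k} v k≢j i = reflexive (updateAt-minimal k j (A i) k≢j)

  []≔-cong : ∀ {A B : Matrix n} j {v w} → A ≈[ j ] B → v ≈ᵥ w → A [ j ≔ v ] ≈ₘ B [ j ≔ w ]
  []≔-cong {A = A} {B} j {v} {w} A≈B v≈w i k with k Fin.≟ j
  ... | yes ≡.refl = trans ([]≔-at A j v i) (trans (v≈w i) (sym ([]≔-at B j w i)))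
  ... | no k≢j = trans ([]≔-off A v k≢j i) (trans (A≈B i k k≢j) (sym ([]≔-off B w k≢j i)))

  []≔-self : ∀ (A : Matrix n) j → A [ j ≔ (λ i → A i j) ] ≈ₘ A
  []≔-self A j i k with k Fin.≟ j
  ... | yes ≡.refl = []≔-at A j (λ i → A i j) i
  ... | no k≢j = []≔-off A (λ i → A i j) k≢j i

  det-[]≔-linear : ∀ (A : Matrix n) j u t v →
                   det (A [ j ≔ (λ i → u i + t * v i) ]) ≈ det (A [ j ≔ u ]) + t * det (A [ j ≔ v ])
  det-[]≔-linear A j u t v = det-linear j t
    (λ i k k≢j → trans ([]≔-off A u+tv k≢j i) (sym ([]≔-off A u k≢j i)))
    (λ i k k≢j → trans ([]≔-off A u+tv k≢j i) (sym ([]≔-off A v k≢j i)))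
    λ i → trans ([]≔-at A j u+tv i) (sym (+-cong ([]≔-at A j u i) (*-congˡ ([]≔-at A j v i))))
    where
    u+tv : Vector Carrier _
    u+tv i = u i + t * v i

  adjacent-≢ : {j k : Fin n} → Adjacent j k → k ≢ j
  adjacent-≢ (suc a) eq = adjacent-≢ a (Fin.suc-injective eq)

  -- Polarisation: the determinant with u + v in both places vanishes, and expanding it leaves only
  -- the two mixed terms.
  det-swap : ∀ {j k : Fin n} → Adjacent j k → (A : Matrix n) → ∀ u v →
             det (A [ j ≔ u ] [ k ≔ v ]) ≈ - det (A [ j ≔ v ] [ k ≔ u ])
  det-swap {n} {j} {k} a A u v = begin
    g u v                                ≈⟨ solve 2 (λ x y → x := (x :+ y) :- y) refl (g u v) (g v u) ⟩
    (g u v + g v u) - g v u              ≈⟨ +-congʳ (trans expand (alternating (u ⊕ v))) ⟩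
    0# - g v u                           ≈⟨ +-identityˡ _ ⟩
    - g v u                              ∎
    where
    _⊕_ : Vector Carrier n → Vector Carrier n → Vector Carrier n
    (u ⊕ v) i = u i + 1# * v i
    g : Vector Carrier n → Vector Carrier n → Carrier
    g u v = det (A [ j ≔ u ] [ k ≔ v ])
    at-j : ∀ x y i → (A [ j ≔ x ] [ k ≔ y ]) i j ≈ x i
    at-j x y i = trans ([]≔-off (A [ j ≔ x ]) y (adjacent-≢ a ∘ ≡.sym) i) ([]≔-at A j x i)
    alternating : ∀ x → g x x ≈ 0#
    alternating x = det-adjacent a (A [ j ≔ x ] [ k ≔ x ])
      λ i → trans (at-j x x i) (sym ([]≔-at (A [ j ≔ x ]) k x i))
    off : ∀ x y z → A [ j ≔ x ] [ k ≔ z ] ≈[ j ] A [ j ≔ y ] [ k ≔ z ]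
    off x y z i l l≢j with l Fin.≟ k
    ... | yes ≡.refl = trans ([]≔-at (A [ j ≔ x ]) l z i) (sym ([]≔-at (A [ j ≔ y ]) l z i))
    ... | no l≢k = trans ([]≔-off (A [ j ≔ x ]) z l≢k i) (trans ([]≔-off A x l≢j i)
                     (sym (trans ([]≔-off (A [ j ≔ y ]) z l≢k i) ([]≔-off A y l≢j i))))
    linearˡ : ∀ w → g (u ⊕ v) w ≈ g u w + 1# * g v w
    linearˡ w = det-linear j 1# (off (u ⊕ v) u w) (off (u ⊕ v) v w)
      λ i → trans (at-j (u ⊕ v) w i) (sym (+-cong (at-j u w i) (*-congˡ (at-j v w i))))
    expand : g u v + g v u ≈ g (u ⊕ v) (u ⊕ v)
    expand = sym (begin
      g (u ⊕ v) (u ⊕ v)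
        ≈⟨ det-[]≔-linear (A [ j ≔ u ⊕ v ]) k u 1# v ⟩
      g (u ⊕ v) u + 1# * g (u ⊕ v) v
        ≈⟨ +-cong (linearˡ u) (*-congˡ (linearˡ v)) ⟩
      (g u u + 1# * g v u) + 1# * (g u v + 1# * g v v)
        ≈⟨ +-cong (+-congʳ (alternating u)) (*-congˡ (+-congˡ (*-congˡ (alternating v)))) ⟩
      (0# + 1# * g v u) + 1# * (g u v + 1# * 0#)
        ≈⟨ solve 2 (λ x y → (con (+ 0) :+ con (+ 1) :* y) :+ con (+ 1) :* (x :+ con (+ 1) :* con (+ 0)) := x :+ y)
             refl (g u v) (g v u) ⟩
      g u v + g v u ∎)

  inject-adjacent : (j : Fin n) → Adjacent (inject₁ j) (suc j)
  inject-adjacent zero    = zero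
  inject-adjacent (suc j) = suc (inject-adjacent j)

  -- Adjacent swaps move the second of the equal columns left until it is next to column zero; the
  -- signs do not affect vanishing.
  det-equal-columns : ∀ (j : Fin n) (A : Matrix (suc n)) → (∀ i → A i zero ≈ A i (suc j)) → det A ≈ 0#
  det-equal-columns {suc n} = <-weakInduction _ (det-adjacent zero) step
    where
    step : ∀ j → (∀ A → (∀ i → A i zero ≈ A i (suc (inject₁ j))) → det A ≈ 0#) →
           ∀ A → (∀ i → A i zero ≈ A i (suc (suc j))) → det A ≈ 0#
    step j ih A A₀≈Aⱼ = begin
      det A                                    ≈⟨ det-cong self ⟨
      det (A [ j₁ ≔ w ] [ j₂ ≔ u ])            ≈⟨ det-swap (suc (inject-adjacent j)) A w u ⟩
      - det (A [ j₁ ≔ u ] [ j₂ ≔ w ])          ≈⟨ -‿cong (ih (A [ j₁ ≔ u ] [ j₂ ≔ w ]) equal) ⟩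
      - 0#                                     ≈⟨ solve 0 (:- con (+ 0) := con (+ 0)) refl ⟩
      0#                                       ∎
      where
      j₁ j₂ : Fin (suc (suc n))
      j₁ = suc (inject₁ j)
      j₂ = suc (suc j)
      u w : Vector Carrier (suc (suc n))
      w i = A i j₁
      u i = A i j₂
      j₁≢j₂ : j₁ ≢ j₂
      j₁≢j₂ = adjacent-≢ (suc (inject-adjacent j)) ∘ ≡.sym
      self : A [ j₁ ≔ w ] [ j₂ ≔ u ] ≈ₘ A
      self i k = trans ([]≔-cong j₂ {u} {u} (λ i k _ → []≔-self A j₁ i k) (λ _ → refl) i k) ([]≔-self A j₂ i k)
      equal : ∀ i → (A [ j₁ ≔ u ] [ j₂ ≔ w ]) i zero ≈ (A [ j₁ ≔ u ] [ j₂ ≔ w ]) i j₁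
      equal i = trans (A₀≈Aⱼ i) (sym (trans ([]≔-off (A [ j₁ ≔ u ]) w j₁≢j₂ i) ([]≔-at A j₁ u i)))

  det-[]≔-zero : ∀ (A : Matrix n) j → det (A [ j ≔ const 0# ]) ≈ 0#
  det-[]≔-zero A j = begin
    d                                       ≈⟨ solve 1 (λ x → x := (x :+ con (+ 1) :* x) :- x) refl d ⟩
    (d + 1# * d) - d                        ≈⟨ +-congʳ (det-[]≔-linear A j (const 0#) 1# (const 0#)) ⟨
    det (A [ j ≔ const (0# + 1# * 0#) ]) - d
      ≈⟨ +-congʳ (det-cong ([]≔-cong j (λ _ _ _ → refl)
           (λ _ → solve 0 (con (+ 0) :+ con (+ 1) :* con (+ 0) := con (+ 0)) refl))) ⟩
    d - d                                   ≈⟨ -‿inverseʳ d ⟩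
    0#                                      ∎
    where
    d = det (A [ j ≔ const 0# ])

  det-[]≔-sum : ∀ {m} (A : Matrix n) j (v : Vector (Vector Carrier n) m) (t : Vector Carrier m) →
                det (A [ j ≔ (λ i → sum (λ k → v k i * t k)) ]) ≈ sum (λ k → t k * det (A [ j ≔ v k ]))
  det-[]≔-sum {m = zero}  A j v t = det-[]≔-zero A j
  det-[]≔-sum {m = suc m} A j v t = begin
    det (A [ j ≔ (λ i → v zero i * t zero + rest i) ])
      ≈⟨ det-cong ([]≔-cong j (λ _ _ _ → refl) (λ i → trans (+-comm _ _) (+-congˡ (*-comm _ _)))) ⟩
    det (A [ j ≔ (λ i → rest i + t zero * v zero i) ])
      ≈⟨ det-[]≔-linear A j rest (t zero) (v zero) ⟩
    det (A [ j ≔ rest ]) + t zero * det (A [ j ≔ v zero ])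
      ≈⟨ +-comm _ _ ⟩
    t zero * det (A [ j ≔ v zero ]) + det (A [ j ≔ rest ])
      ≈⟨ +-congˡ (det-[]≔-sum A j (v ∘ suc) (t ∘ suc)) ⟩
    sum (λ k → t k * det (A [ j ≔ v k ])) ∎
    where
    rest : Vector Carrier _
    rest i = sum (λ k → v (suc k) i * t (suc k))

  -- Cramer's rule for the first unknown: A x is a combination of the columns of A, and every column
  -- but the first would occur twice.
  det-[zero≔A*x] : ∀ (A : Matrix (suc n)) x → det (A [ zero ≔ A *ᵥ x ]) ≈ x zero * det A
  det-[zero≔A*x] A x = begin
    det (A [ zero ≔ A *ᵥ x ])
      ≈⟨ det-[]≔-sum A zero (λ j i → A i j) x ⟩
    sum (λ j → x j * det (A [ zero ≔ (λ i → A i j) ]))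
      ≈⟨ +-cong (*-congˡ (det-cong ([]≔-self A zero))) (sum-zero λ j →
           trans (*-congˡ (det-equal-columns j (A [ zero ≔ (λ i → A i (suc j)) ]) λ i → refl)) (zeroʳ _)) ⟩
    x zero * det A + 0#
      ≈⟨ +-identityʳ _ ⟩
    x zero * det A ∎

  private
    -- `F` stands for the determinant as a function of some of its columns. Abstracting it lets the
    -- induction freeze the sheared first column `v₀` and continue with `λ w → F (v₀ ∷ᵥ w)`.
    shear-invariant : ∀ {m} (u : Vector Carrier n) (F : Vector (Vector Carrier n) m → Carrier) →
      (∀ {v w} → (∀ j → v j ≈ᵥ w j) → F v ≈ F w) →
      (∀ v j t → F (updateAt v j (λ w i → w i + t * u i)) ≈ F v) →
      ∀ v (t : Vector Carrier m) → F (λ j i → v j i + t j * u i) ≈ F v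
    shear-invariant {m = zero}  u F F-cong F-shear v t = F-cong λ ()
    shear-invariant {m = suc m} u F F-cong F-shear v t = begin
      F (λ j i → v j i + t j * u i)
        ≈⟨ F-cong (λ { zero _ → refl ; (suc j) _ → refl }) ⟩
      F (v₀ ∷ᵥ (λ j i → v (suc j) i + t (suc j) * u i))
        ≈⟨ shear-invariant u (λ w → F (v₀ ∷ᵥ w))
             (λ v≈w → F-cong λ { zero _ → refl ; (suc j) → v≈w j })
             (λ w j t → trans (F-cong (λ { zero _ → refl ; (suc _) _ → refl })) (F-shear (v₀ ∷ᵥ w) (suc j) t))
             (v ∘ suc) (t ∘ suc) ⟩
      F (v₀ ∷ᵥ v ∘ suc)
        ≈⟨ F-cong (λ { zero _ → refl ; (suc j) _ → refl }) ⟩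
      F (updateAt v zero (λ w i → w i + t zero * u i))
        ≈⟨ F-shear v zero (t zero) ⟩
      F v ∎
      where
      v₀ : Vector Carrier _
      v₀ i = v zero i + t zero * u i

  columns : Vector (Vector Carrier n) n → Matrix n
  columns v i j = v j i

  det-shear : ∀ (u : Vector Carrier (suc n)) v (t : Vector Carrier n) →
              det (columns (u ∷ᵥ (λ j i → v j i + t j * u i))) ≈ det (columns (u ∷ᵥ v))
  det-shear {n} u = shear-invariant u (λ v → det (columns (u ∷ᵥ v)))
    (λ {v} {w} v≈w → det-cong {A = columns (u ∷ᵥ v)} {columns (u ∷ᵥ w)}
      λ { i zero → refl ; i (suc j) → v≈w j i }) λ v j t → begin
      det (columns (u ∷ᵥ updateAt v j (λ w i → w i + t * u i)))
        ≈⟨ det-linear (suc j) {columns (u ∷ᵥ updateAt v j (λ w i → w i + t * u i))} {columns (u ∷ᵥ v)}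
             {columns (u ∷ᵥ v) [ suc j ≔ u ]} t
             (λ { i zero _ → refl ; i (suc k) k≢j → off v j t i k k≢j })
             (λ { i zero _ → refl ; i (suc k) k≢j →
                  trans (off v j t i k k≢j) (sym ([]≔-off (columns (u ∷ᵥ v)) u k≢j i)) })
             (λ i → trans (at v j t i) (+-congˡ (*-congˡ (sym ([]≔-at (columns (u ∷ᵥ v)) (suc j) u i))))) ⟩
      det (columns (u ∷ᵥ v)) + t * det (columns (u ∷ᵥ v) [ suc j ≔ u ])
        ≈⟨ +-congˡ (*-congˡ (det-equal-columns j (columns (u ∷ᵥ v) [ suc j ≔ u ])
             λ i → sym ([]≔-at (columns (u ∷ᵥ v)) (suc j) u i))) ⟩
      det (columns (u ∷ᵥ v)) + t * 0#
        ≈⟨ trans (+-congˡ (zeroʳ t)) (+-identityʳ _) ⟩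
      det (columns (u ∷ᵥ v)) ∎
    where
    off : ∀ (v : Vector (Vector Carrier (suc n)) n) j t i k → suc k ≢ suc j →
          updateAt v j (λ w i → w i + t * u i) k i ≈ v k i
    off v j t i k k≢j = reflexive (≡.cong (λ w → w i) (updateAt-minimal k j v (k≢j ∘ ≡.cong suc)))
    at : ∀ (v : Vector (Vector Carrier (suc n)) n) j t i →
         updateAt v j (λ w i → w i + t * u i) j i ≈ v j i + t * u i
    at v j t i = reflexive (≡.cong (λ w → w i) (updateAt-updates j v))

  -- For an eigenvector x with x₀ = 1 this is the map induced by A on the quotient by the line of x,
  -- in the basis e₁, ..., eₙ: there e₀ becomes the negative of the sum of the other xᵢ eᵢ.
  deflate : Matrix (suc n) → Vector Carrier (suc n) → Matrix n
  deflate A x i j = A (suc i) (suc j) - x (suc i) * A zero (suc j)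

  -- Replacing the first column by A x = ξ x and subtracting multiples of x
  -- from the other columns leaves (1, 0, …, 0) as the first row.
  det-deflate : ∀ (A : Matrix (suc n)) x ξ → x zero ≈ 1# → A *ᵥ x ≈ᵥ ξ ∙ᵥ x → det A ≈ ξ * det (deflate A x)
  det-deflate {n} A x ξ x₀≈1 Ax≈ξx = begin
    det A
      ≈⟨ *-identityˡ _ ⟨
    1# * det A
      ≈⟨ *-congʳ x₀≈1 ⟨
    x zero * det A
      ≈⟨ det-[zero≔A*x] A x ⟨
    det (A [ zero ≔ A *ᵥ x ])
      -- The new column is written as 0 + ξ x, so that the one linearity lemma also extracts the
      -- scalar ξ.
      ≈⟨ det-linear zero {A [ zero ≔ A *ᵥ x ]} {B = A [ zero ≔ const 0# ]} {C = columns (x ∷ᵥ v)} ξ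
           (λ { i zero k≢j → contradiction ≡.refl k≢j ; i (suc k) k≢j → refl })
           (λ { i zero k≢j → contradiction ≡.refl k≢j ; i (suc k) k≢j → refl })
           (λ i → trans (Ax≈ξx i) (sym (+-identityˡ _))) ⟩
    det (A [ zero ≔ const 0# ]) + ξ * det (columns (x ∷ᵥ v))
      ≈⟨ trans (+-congʳ (det-[]≔-zero A zero)) (+-identityˡ _) ⟩
    ξ * det (columns (x ∷ᵥ v))
      ≈⟨ *-congˡ (det-shear x v t) ⟨
    ξ * det B
      ≈⟨ *-congˡ (+-cong (trans (*-identityˡ _) (trans (*-congʳ x₀≈1) (*-identityˡ _))) (sum-zero λ j →
           trans (*-congˡ {sign (suc j)} (trans (*-congʳ (B₀≈0 j)) (zeroˡ _))) (zeroʳ _))) ⟩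
    ξ * (det (minor B zero) + 0#)
      ≈⟨ *-congˡ (trans (+-identityʳ _) (det-cong λ i j →
           solve 3 (λ a b y → a :+ (:- b) :* y := a :- y :* b) refl _ (A zero (suc j)) (x (suc i)))) ⟩
    ξ * det (deflate A x) ∎
    where
    v : Vector (Vector Carrier (suc n)) n
    v j i = A i (suc j)
    t : Vector Carrier n
    t j = - A zero (suc j)
    B : Matrix (suc n)
    B = columns (x ∷ᵥ (λ j i → v j i + t j * x i))
    B₀≈0 : ∀ j → B zero (suc j) ≈ 0#
    B₀≈0 j = trans (+-congˡ (trans (*-congˡ x₀≈1) (*-identityʳ _))) (-‿inverseʳ _)

-- The polynomial ring over a commutative ring, and evaluation.

module PolynomialRing {c ℓ} (R : CommutativeRing c ℓ) where
  open CommutativeRing R hiding (zero)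
  open IntegerSolver R
  open Polynomials rawRing

  private
    coeff-+ : ∀ f g k → coeff (f +ₚ g) k ≈ coeff f k + coeff g k
    coeff-+ []      g       k       = sym (+-identityˡ _)
    coeff-+ (a ∷ f) []      k       = sym (+-identityʳ _)
    coeff-+ (a ∷ f) (b ∷ g) zero    = refl
    coeff-+ (a ∷ f) (b ∷ g) (suc k) = coeff-+ f g k

    coeff-map : ∀ {h : Carrier → Carrier} → h 0# ≈ 0# → ∀ f k → coeff (map h f) k ≈ h (coeff f k)
    coeff-map h0≈0 []      k       = sym h0≈0
    coeff-map h0≈0 (a ∷ f) zero    = refl
    coeff-map h0≈0 (a ∷ f) (suc k) = coeff-map h0≈0 f k

    infixr 7 _·_
    _·_ : Carrier → List Carrier → List Carrier
    a · f = map (a *_) f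

    coeff-· : ∀ a f k → coeff (a · f) k ≈ a * coeff f k
    coeff-· a = coeff-map (zeroʳ a)

    coeff-neg : ∀ f k → coeff (map (-_) f) k ≈ - coeff f k
    coeff-neg = coeff-map (solve 0 (:- con (+ 0) := con (+ 0)) refl)

    -- A record, so that the two polynomials can be inferred from a proof.
    infix 4 _≋_
    record _≋_ (f g : List Carrier) : Set ℓ where
      constructor coefficientwise
      field at : ∀ k → coeff f k ≈ coeff g k
    open _≋_

    ≋-isEquivalence : IsEquivalence _≋_
    ≋-isEquivalence = record
      { refl  = coefficientwise λ k → refl
      ; sym   = λ p → coefficientwise λ k → sym (at p k)
      ; trans = λ p q → coefficientwise λ k → trans (at p k) (at q k) }
    open IsEquivalence ≋-isEquivalence using () renaming (refl to ≋-refl; sym to ≋-sym; trans to ≋-trans)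

    +ₚ-cong : ∀ {f f′ g g′} → f ≋ f′ → g ≋ g′ → f +ₚ g ≋ f′ +ₚ g′
    +ₚ-cong {f} {f′} {g} {g′} p q = coefficientwise λ k →
      trans (coeff-+ f g k) (trans (+-cong (at p k) (at q k)) (sym (coeff-+ f′ g′ k)))

    +ₚ-assoc : ∀ f g h → (f +ₚ g) +ₚ h ≋ f +ₚ (g +ₚ h)
    +ₚ-assoc f g h = coefficientwise λ k → trans (coeff-+ (f +ₚ g) h k)
      (trans (+-congʳ (coeff-+ f g k)) (trans (+-assoc _ _ _)
      (sym (trans (coeff-+ f (g +ₚ h) k) (+-congˡ (coeff-+ g h k))))))

    +ₚ-comm : ∀ f g → f +ₚ g ≋ g +ₚ f
    +ₚ-comm f g = coefficientwise λ k → trans (coeff-+ f g k) (trans (+-comm _ _) (sym (coeff-+ g f k)))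

    +ₚ-identityʳ : ∀ f → f +ₚ [] ≋ f
    +ₚ-identityʳ []      = ≋-refl
    +ₚ-identityʳ (a ∷ f) = ≋-refl

    negₚ-inverseˡ : ∀ f → map (-_) f +ₚ f ≋ []
    negₚ-inverseˡ f = coefficientwise λ k →
      trans (coeff-+ (map (-_) f) f k) (trans (+-congʳ (coeff-neg f k)) (-‿inverseˡ _))

    negₚ-inverseʳ : ∀ f → f +ₚ map (-_) f ≋ []
    negₚ-inverseʳ f = ≋-trans (+ₚ-comm f (map (-_) f)) (negₚ-inverseˡ f)

    negₚ-cong : ∀ {f g} → f ≋ g → map (-_) f ≋ map (-_) g
    negₚ-cong {f} {g} p = coefficientwise λ k →
      trans (coeff-neg f k) (trans (-‿cong (at p k)) (sym (coeff-neg g k)))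

    +ₚ-commutativeMonoid : CommutativeMonoid c ℓ
    +ₚ-commutativeMonoid = record
      { Carrier = List Carrier ; _≈_ = _≋_ ; _∙_ = _+ₚ_ ; ε = []
      ; isCommutativeMonoid = record
        { isMonoid = record
          { isSemigroup = record
            { isMagma = record { isEquivalence = ≋-isEquivalence ; ∙-cong = +ₚ-cong }
            ; assoc = +ₚ-assoc }
          ; identity = (λ _ → ≋-refl) , +ₚ-identityʳ }
        ; comm = +ₚ-comm } }
    open CommutativeMonoid +ₚ-commutativeMonoid using ()
      renaming (setoid to ≋-setoid; ∙-congˡ to +ₚ-congˡ)
    open CommutativeSemigroupProperties
      (CommutativeMonoid.commutativeSemigroup +ₚ-commutativeMonoid) using (interchange; x∙yz≈y∙xz)
    open SetoidReasoning ≋-setoid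

    ∷-cong : ∀ {a b f g} → a ≈ b → f ≋ g → a ∷ f ≋ b ∷ g
    ∷-cong a≈b f≋g = coefficientwise λ { zero → a≈b ; (suc k) → at f≋g k }

    tail-≋ : ∀ {a b f g} → a ∷ f ≋ b ∷ g → f ≋ g
    tail-≋ p = coefficientwise (at p ∘ suc)

    0∷[] : 0# ∷ [] ≋ []
    0∷[] = coefficientwise λ { zero → refl ; (suc k) → refl }

    0∷-≋ : ∀ {f} → f ≋ [] → 0# ∷ f ≋ []
    0∷-≋ p = ≋-trans (∷-cong refl p) 0∷[]

    0∷-+ : ∀ f g → 0# ∷ (f +ₚ g) ≋ (0# ∷ f) +ₚ (0# ∷ g)
    0∷-+ f g = ∷-cong (sym (+-identityˡ 0#)) ≋-refl

    ·-cong : ∀ {a b f g} → a ≈ b → f ≋ g → a · f ≋ b · g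
    ·-cong {a} {b} {f} {g} a≈b f≋g = coefficientwise λ k →
      trans (coeff-· a f k) (trans (*-cong a≈b (at f≋g k)) (sym (coeff-· b g k)))

    ·-distribˡ : ∀ a f g → a · (f +ₚ g) ≋ a · f +ₚ a · g
    ·-distribˡ a f g = coefficientwise λ k → trans (coeff-· a (f +ₚ g) k)
      (trans (*-congˡ (coeff-+ f g k)) (trans (distribˡ _ _ _)
      (sym (trans (coeff-+ (a · f) (a · g) k) (+-cong (coeff-· a f k) (coeff-· a g k))))))

    ·-distribʳ : ∀ a b f → (a + b) · f ≋ a · f +ₚ b · f
    ·-distribʳ a b f = coefficientwise λ k → trans (coeff-· (a + b) f k) (trans (distribʳ _ _ _)
      (sym (trans (coeff-+ (a · f) (b · f) k) (+-cong (coeff-· a f k) (coeff-· b f k)))))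

    ·-assoc : ∀ a b f → (a * b) · f ≋ a · b · f
    ·-assoc a b f = coefficientwise λ k → trans (coeff-· (a * b) f k) (trans (*-assoc _ _ _)
      (sym (trans (coeff-· a (b · f) k) (*-congˡ (coeff-· b f k)))))

    ·-zero : ∀ {a} f → a ≈ 0# → a · f ≋ []
    ·-zero {a} f a≈0 = coefficientwise λ k → trans (coeff-· a f k) (trans (*-congʳ a≈0) (zeroˡ _))

    *ₚ-zeroʳ : ∀ f → f *ₚ [] ≋ []
    *ₚ-zeroʳ []      = ≋-refl
    *ₚ-zeroʳ (a ∷ f) = 0∷-≋ (*ₚ-zeroʳ f)

    *ₚ-zeroˡ : ∀ f g → f ≋ [] → f *ₚ g ≋ []
    *ₚ-zeroˡ []      g f≋0 = ≋-refl
    *ₚ-zeroˡ (a ∷ f) g f≋0 =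
      +ₚ-cong (·-zero g (at f≋0 zero)) (0∷-≋ (*ₚ-zeroˡ f g (coefficientwise (at f≋0 ∘ suc))))

    *ₚ-congˡ : ∀ f {g h} → g ≋ h → f *ₚ g ≋ f *ₚ h
    *ₚ-congˡ []      g≋h = ≋-refl
    *ₚ-congˡ (a ∷ f) g≋h = +ₚ-cong (·-cong refl g≋h) (∷-cong refl (*ₚ-congˡ f g≋h))

    *ₚ-congʳ : ∀ {f g} h → f ≋ g → f *ₚ h ≋ g *ₚ h
    *ₚ-congʳ {[]}    {g}     h f≋g = ≋-sym (*ₚ-zeroˡ g h (≋-sym f≋g))
    *ₚ-congʳ {a ∷ f} {[]}    h f≋g = *ₚ-zeroˡ (a ∷ f) h f≋g
    *ₚ-congʳ {a ∷ f} {b ∷ g} h f≋g =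
      +ₚ-cong (·-cong (at f≋g zero) (≋-refl {h})) (∷-cong refl (*ₚ-congʳ h (tail-≋ f≋g)))

    *ₚ-distribʳ : ∀ h f g → (f +ₚ g) *ₚ h ≋ f *ₚ h +ₚ g *ₚ h
    *ₚ-distribʳ h []      g       = ≋-refl
    *ₚ-distribʳ h (a ∷ f) []      = ≋-sym (+ₚ-identityʳ ((a ∷ f) *ₚ h))
    *ₚ-distribʳ h (a ∷ f) (b ∷ g) = begin
      (a + b) · h +ₚ (0# ∷ (f +ₚ g) *ₚ h)
        ≈⟨ +ₚ-cong (·-distribʳ a b h) (≋-trans (∷-cong refl (*ₚ-distribʳ h f g)) (0∷-+ (f *ₚ h) (g *ₚ h))) ⟩
      (a · h +ₚ b · h) +ₚ ((0# ∷ f *ₚ h) +ₚ (0# ∷ g *ₚ h))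
        ≈⟨ interchange (a · h) (b · h) (0# ∷ f *ₚ h) (0# ∷ g *ₚ h) ⟩
      (a ∷ f) *ₚ h +ₚ (b ∷ g) *ₚ h ∎

    -- The mirror image of the defining recursion of the product; commutativity then follows by
    -- induction on one factor.
    *ₚ-∷ʳ : ∀ f b g → f *ₚ (b ∷ g) ≋ b · f +ₚ (0# ∷ f *ₚ g)
    *ₚ-∷ʳ []      b g = ≋-sym 0∷[]
    *ₚ-∷ʳ (a ∷ f) b g = ∷-cong (+-congʳ (*-comm a b)) (begin
      a · g +ₚ f *ₚ (b ∷ g)
        ≈⟨ +ₚ-congˡ {a · g} (*ₚ-∷ʳ f b g) ⟩
      a · g +ₚ (b · f +ₚ (0# ∷ f *ₚ g))
        ≈⟨ x∙yz≈y∙xz (a · g) (b · f) (0# ∷ f *ₚ g) ⟩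
      b · f +ₚ (a · g +ₚ (0# ∷ f *ₚ g)) ∎)

    *ₚ-comm : ∀ f g → f *ₚ g ≋ g *ₚ f
    *ₚ-comm []      g = ≋-sym (*ₚ-zeroʳ g)
    *ₚ-comm (a ∷ f) g = begin
      a · g +ₚ (0# ∷ f *ₚ g)  ≈⟨ +ₚ-congˡ {a · g} (∷-cong refl (*ₚ-comm f g)) ⟩
      a · g +ₚ (0# ∷ g *ₚ f)  ≈⟨ *ₚ-∷ʳ g a f ⟨
      g *ₚ (a ∷ f)            ∎

    ·-*ₚ : ∀ a f g → (a · f) *ₚ g ≋ a · (f *ₚ g)
    ·-*ₚ a []      g = ≋-refl
    ·-*ₚ a (b ∷ f) g = begin
      (a * b) · g +ₚ (0# ∷ (a · f) *ₚ g)
        ≈⟨ +ₚ-cong (·-assoc a b g) (∷-cong (sym (zeroʳ a)) (·-*ₚ a f g)) ⟩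
      a · b · g +ₚ a · (0# ∷ f *ₚ g)
        ≈⟨ ·-distribˡ a (b · g) (0# ∷ f *ₚ g) ⟨
      a · ((b ∷ f) *ₚ g) ∎

    *ₚ-assoc : ∀ f g h → (f *ₚ g) *ₚ h ≋ f *ₚ (g *ₚ h)
    *ₚ-assoc []      g h = ≋-refl
    *ₚ-assoc (a ∷ f) g h = begin
      (a · g +ₚ (0# ∷ f *ₚ g)) *ₚ h
        ≈⟨ *ₚ-distribʳ h (a · g) (0# ∷ f *ₚ g) ⟩
      (a · g) *ₚ h +ₚ (0# · h +ₚ (0# ∷ (f *ₚ g) *ₚ h))
        ≈⟨ +ₚ-cong (·-*ₚ a g h) (+ₚ-cong (·-zero h refl) (∷-cong refl (*ₚ-assoc f g h))) ⟩
      a · (g *ₚ h) +ₚ (0# ∷ f *ₚ (g *ₚ h)) ∎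

    *ₚ-identityˡ : ∀ f → (1# ∷ []) *ₚ f ≋ f
    *ₚ-identityˡ f = begin
      1# · f +ₚ (0# ∷ [])  ≈⟨ +ₚ-congˡ {1# · f} 0∷[] ⟩
      1# · f +ₚ []         ≈⟨ +ₚ-identityʳ (1# · f) ⟩
      1# · f               ≈⟨ coefficientwise (λ k → trans (coeff-· 1# f k) (*-identityˡ _)) ⟩
      f                    ∎

  polynomialCommutativeRing : CommutativeRing c ℓ
  polynomialCommutativeRing = record
    { RawRing polynomialRing
    ; isCommutativeRing = record
      { isRing = record
        { +-isAbelianGroup = record
          { isGroup = record
            { isMonoid = record
              { isSemigroup = record
                { isMagma = record
                  { isEquivalence = record
                    { refl  = λ k → refl
                    ; sym   = λ p k → sym (p k)
                    ; trans = λ p q k → trans (p k) (q k) }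
                  ; ∙-cong = λ {f} {f′} {g} {g′} p q →
                      at (+ₚ-cong {f} {f′} {g} {g′} (coefficientwise p) (coefficientwise q)) }
                ; assoc = λ f g h → at (+ₚ-assoc f g h) }
              ; identity = (λ f k → refl) , (λ f → at (+ₚ-identityʳ f)) }
            ; inverse = (λ f → at (negₚ-inverseˡ f)) , (λ f → at (negₚ-inverseʳ f))
            ; ⁻¹-cong = λ {f} {g} p → at (negₚ-cong {f} {g} (coefficientwise p)) }
          ; comm = λ f g → at (+ₚ-comm f g) }
        ; *-cong = λ {f} {f′} {g} {g′} p q → at (≋-trans
            (*ₚ-congʳ {f} {f′} g (coefficientwise p)) (*ₚ-congˡ f′ {g} {g′} (coefficientwise q)))
        ; *-assoc = λ f g h → at (*ₚ-assoc f g h)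
        ; *-identity = (λ f → at (*ₚ-identityˡ f)) ,
            (λ f → at (≋-trans (*ₚ-comm f (1# ∷ [])) (*ₚ-identityˡ f)))
        ; distrib = (λ f g h → at (begin
              f *ₚ (g +ₚ h)       ≈⟨ *ₚ-comm f (g +ₚ h) ⟩
              (g +ₚ h) *ₚ f       ≈⟨ *ₚ-distribʳ f g h ⟩
              g *ₚ f +ₚ h *ₚ f    ≈⟨ +ₚ-cong (*ₚ-comm g f) (*ₚ-comm h f) ⟩
              f *ₚ g +ₚ f *ₚ h    ∎)) ,
            (λ f g h → at (*ₚ-distribʳ f g h)) }
      ; *-comm = λ f g → at (*ₚ-comm f g) } }

  open RingMorphisms rawRing polynomialRing using () renaming (IsRingHomomorphism to IsConstantHomomorphism)
  open RingMorphisms polynomialRing rawRing using () renaming (IsRingHomomorphism to IsEvalHomomorphism)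

  constant-isRingHomomorphism : IsConstantHomomorphism constant
  constant-isRingHomomorphism = record
    { isSemiringHomomorphism = record
      { isNearSemiringHomomorphism = record
        { +-isMonoidHomomorphism = record
          { isMagmaHomomorphism = record
            { isRelHomomorphism = record { cong = λ a≈b → at (∷-cong a≈b ≋-refl) }
            ; homo = λ a b k → refl }
          ; ε-homo = at 0∷[] }
        ; *-homo = λ a b → at (∷-cong (sym (+-identityʳ (a * b))) ≋-refl) }
      ; 1#-homo = λ k → refl }
    ; -‿homo = λ a k → refl }

  private
    eval-zero : ∀ f x → f ≋ [] → eval f x ≈ 0#
    eval-zero []      x f≋0 = refl
    eval-zero (a ∷ f) x f≋0 = trans
      (+-cong (at f≋0 zero) (*-congˡ (eval-zero f x (coefficientwise (at f≋0 ∘ suc)))))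
      (solve 1 (λ x → con (+ 0) :+ x :* con (+ 0) := con (+ 0)) refl x)

    eval-cong : ∀ f g x → f ≋ g → eval f x ≈ eval g x
    eval-cong []      g       x f≋g = sym (eval-zero g x (≋-sym f≋g))
    eval-cong (a ∷ f) []      x f≋g = eval-zero (a ∷ f) x f≋g
    eval-cong (a ∷ f) (b ∷ g) x f≋g = +-cong (at f≋g zero) (*-congˡ (eval-cong f g x (tail-≋ f≋g)))

    eval-+ : ∀ f g x → eval (f +ₚ g) x ≈ eval f x + eval g x
    eval-+ []      g       x = sym (+-identityˡ _)
    eval-+ (a ∷ f) []      x = sym (+-identityʳ _)
    eval-+ (a ∷ f) (b ∷ g) x = trans (+-congˡ (*-congˡ (eval-+ f g x)))
      (solve 5 (λ a b x u v → a :+ b :+ x :* (u :+ v) := a :+ x :* u :+ (b :+ x :* v))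
        refl a b x (eval f x) (eval g x))

    eval-· : ∀ a f x → eval (a · f) x ≈ a * eval f x
    eval-· a []      x = sym (zeroʳ a)
    eval-· a (b ∷ f) x = trans (+-congˡ (*-congˡ (eval-· a f x)))
      (solve 4 (λ a b x u → a :* b :+ x :* (a :* u) := a :* (b :+ x :* u)) refl a b x (eval f x))

    eval-* : ∀ f g x → eval (f *ₚ g) x ≈ eval f x * eval g x
    eval-* []      g x = sym (zeroˡ _)
    eval-* (a ∷ f) g x = trans (eval-+ (a · g) (0# ∷ f *ₚ g) x)
      (trans (+-cong (eval-· a g x) (+-congˡ (*-congˡ (eval-* f g x))))
      (solve 4 (λ a x u v → a :* v :+ (con (+ 0) :+ x :* (u :* v)) := (a :+ x :* u) :* v)
        refl a x (eval f x) (eval g x)))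

    eval-neg : ∀ f x → eval (map (-_) f) x ≈ - eval f x
    eval-neg []      x = solve 0 (con (+ 0) := :- con (+ 0)) refl
    eval-neg (a ∷ f) x = trans (+-congˡ (*-congˡ (eval-neg f x)))
      (solve 3 (λ a x u → :- a :+ x :* (:- u) := :- (a :+ x :* u)) refl a x (eval f x))

  eval-isRingHomomorphism : ∀ x → IsEvalHomomorphism (λ f → eval f x)
  eval-isRingHomomorphism x = record
    { isSemiringHomomorphism = record
      { isNearSemiringHomomorphism = record
        { +-isMonoidHomomorphism = record
          { isMagmaHomomorphism = record
            { isRelHomomorphism = record { cong = λ {f} {g} f≈g → eval-cong f g x (coefficientwise f≈g) }
            ; homo = λ f g → eval-+ f g x }
          ; ε-homo = refl }
        ; *-homo = λ f g → eval-* f g x }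
      ; 1#-homo = solve 1 (λ x → con (+ 1) :+ x :* con (+ 0) := con (+ 1)) refl x }
    ; -‿homo = λ f → eval-neg f x }

  private
    -- A list is finite, so its coefficients are eventually zero, and the recursion carries this
    -- down to degree 0.
    geometric⇒zero : ∀ a f → (∀ k → coeff f k ≈ a * coeff f (suc k)) → f ≋ []
    geometric⇒zero a []      eq = ≋-refl
    geometric⇒zero a (b ∷ f) eq = coefficientwise λ
      { zero    → trans (eq 0) (trans (*-congˡ (at f≋0 0)) (zeroʳ a))
      ; (suc k) → at f≋0 k }
      where
      f≋0 : f ≋ []
      f≋0 = geometric⇒zero a f (eq ∘ suc)

  open CommutativeRing polynomialCommutativeRing using () renaming (_≈_ to _≈ₚ_)

  -- Coefficient k + 1 of the product is fₖ - a fₖ₊₁. As X - a is monic, it can be cancelled even if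
  -- the coefficient ring has zero divisors.
  X−a-cancel : ∀ a f → (X +ₚ constant (- a)) *ₚ f ≈ₚ [] → f ≈ₚ []
  X−a-cancel a f eq = at (geometric⇒zero a f λ k →
    trans (solve 3 (λ u v a → u := ((con (+ 0) :- a) :* v :+ (con (+ 1) :* u :+ con (+ 0))) :+ a :* v)
             refl (coeff f k) (coeff f (suc k)) a)
    (trans (+-congʳ (trans (sym (expand k)) (eq (suc k)))) (+-identityˡ _)))
    where
    expand : ∀ k → coeff ((X +ₚ constant (- a)) *ₚ f) (suc k) ≈
                   (0# - a) * coeff f (suc k) + (1# * coeff f k + 0#)
    expand k = trans (coeff-+ ((0# - a) · f) (0# ∷ (1# ∷ []) *ₚ f) (suc k))
      (+-cong (coeff-· (0# - a) f (suc k)) (trans (coeff-+ (1# · f) (0# ∷ []) k)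
        (+-cong (coeff-· 1# f k) (at 0∷[] k))))

-- Ring homomorphisms on determinants, and the characteristic matrix.

module RingHomomorphism
  {c ℓ c′ ℓ′} (R : CommutativeRing c ℓ) (S : CommutativeRing c′ ℓ′)
  {φ : CommutativeRing.Carrier R → CommutativeRing.Carrier S}
  (φ-isRingHomomorphism : RingMorphisms.IsRingHomomorphism
     (CommutativeRing.rawRing R) (CommutativeRing.rawRing S) φ)
  where
  private
    module R where
      open CommutativeRing R public
      open Matrices rawRing public
      open Exp semiring public using (_^_)
      open Sum semiring public using (sum)
    module S where
      open CommutativeRing S public
      open Matrices rawRing public
      open Exp semiring public using (_^_)
      open Sum semiring public using (sum; sum-cong-≋)
  open RingMorphisms.IsRingHomomorphism φ-isRingHomomorphism
  open S using (_≈_; trans; refl)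

  sum-homo : ∀ {n} (f : Vector R.Carrier n) → φ (R.sum f) ≈ S.sum (φ ∘ f)
  sum-homo {zero}  f = 0#-homo
  sum-homo {suc n} f = trans (+-homo _ _) (S.+-congˡ (sum-homo (f ∘ suc)))

  ^-homo : ∀ x k → φ (x R.^ k) ≈ φ x S.^ k
  ^-homo x zero    = 1#-homo
  ^-homo x (suc k) = trans (*-homo _ _) (S.*-congˡ (^-homo x k))

  det-homo : ∀ {n} (A : R.Matrix n) → φ (R.det A) ≈ S.det (λ i j → φ (A i j))
  det-homo {zero}  A = 1#-homo
  det-homo {suc n} A = trans (sum-homo {suc n} term) (S.sum-cong-≋ {suc n} λ j →
    trans (*-homo ((R.- R.1#) R.^ toℕ j) (A zero j R.* R.det (minor j))) (S.*-cong
      (trans (^-homo (R.- R.1#) (toℕ j)) (^-congˡ (toℕ j) (trans (-‿homo R.1#) (S.-‿cong 1#-homo))))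
      (trans (*-homo (A zero j) (R.det (minor j))) (S.*-congˡ (det-homo (minor j))))))
    where
    open Exp S.semiring using (^-congˡ)
    minor : Fin (suc n) → R.Matrix n
    minor j i k = A (suc i) (punchIn j k)
    term : Fin (suc n) → R.Carrier
    term j = (R.- R.1#) R.^ toℕ j R.* (A zero j R.* R.det (minor j))

module CharacteristicMatrix
  {c ℓ c′ ℓ′} (R : CommutativeRing c ℓ) (S : CommutativeRing c′ ℓ′)
  {κ : CommutativeRing.Carrier R → CommutativeRing.Carrier S}
  (κ-isRingHomomorphism : RingMorphisms.IsRingHomomorphism
     (CommutativeRing.rawRing R) (CommutativeRing.rawRing S) κ)
  (X : CommutativeRing.Carrier S)
  where
  private
    module R where
      open CommutativeRing R public
      open Matrices rawRing public
      open Determinant R public using (deflate)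
      open Sum semiring public using (sum)
  open RingMorphisms.IsRingHomomorphism κ-isRingHomomorphism
  open RingHomomorphism R S κ-isRingHomomorphism using (sum-homo)
  open CommutativeRing S hiding (zero)
  open Matrices rawRing
  open Determinant S
  open IntegerSolver S
  open Sum semiring using (sum; sum-cong-≋; ∑-distrib-+; *-distribˡ-sum)
  open SetoidReasoning setoid

  -- The negation stays inside `κ` so that, for constant polynomials, `det (χ A)` unfolds to
  -- `charPoly A`. Keeping `S` abstract leaves the lists of coefficients out of the calculations.
  χ : ∀ {n} → R.Matrix n → Matrix n
  χ A i j = X * 1ₘ i j + κ (R.- A i j)

  χ-eigenvector : ∀ {n} (A : R.Matrix n) v a → A R.*ᵥ v R.≈ᵥ a R.∙ᵥ v →
                  χ A *ᵥ (κ ∘ v) ≈ᵥ (X + κ (R.- a)) ∙ᵥ (κ ∘ v)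
  χ-eigenvector {n} A v a Av≈av i = begin
    sum (λ j → (X * 1ₘ i j + κ (R.- A i j)) * κ (v j))
      ≈⟨ sum-cong-≋ {n} step ⟩
    sum (λ j → X * (1ₘ i j * κ (v j)) + (- 1#) * κ (A i j R.* v j))
      ≈⟨ ∑-distrib-+ {n} (λ j → X * (1ₘ i j * κ (v j))) (λ j → (- 1#) * κ (A i j R.* v j)) ⟩
    sum (λ j → X * (1ₘ i j * κ (v j))) + sum (λ j → (- 1#) * κ (A i j R.* v j))
      ≈⟨ +-cong (*-distribˡ-sum X (λ j → 1ₘ i j * κ (v j))) (*-distribˡ-sum (- 1#) (λ j → κ (A i j R.* v j))) ⟨
    X * sum (λ j → 1ₘ i j * κ (v j)) + (- 1#) * sum (λ j → κ (A i j R.* v j))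
      ≈⟨ +-cong (*-congˡ (sum-*-1ₘ i (κ ∘ v))) (*-congˡ (begin
           sum (λ j → κ (A i j R.* v j))  ≈⟨ sum-homo (λ j → A i j R.* v j) ⟨
           κ ((A R.*ᵥ v) i)               ≈⟨ ⟦⟧-cong (Av≈av i) ⟩
           κ (a R.* v i)                  ≈⟨ *-homo a (v i) ⟩
           κ a * κ (v i)                  ∎)) ⟩
    X * κ (v i) + (- 1#) * (κ a * κ (v i))
      ≈⟨ solve 3 (λ X a v → X :* v :+ (:- con (+ 1)) :* (a :* v) := (X :+ :- a) :* v) refl X (κ a) (κ (v i)) ⟩
    (X + - κ a) * κ (v i)
      ≈⟨ *-congʳ (+-congˡ (-‿homo a)) ⟨
    (X + κ (R.- a)) * κ (v i) ∎
    where
    step : ∀ j → (X * 1ₘ i j + κ (R.- A i j)) * κ (v j) ≈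
                 X * (1ₘ i j * κ (v j)) + (- 1#) * κ (A i j R.* v j)
    step j = begin
      (X * 1ₘ i j + κ (R.- A i j)) * κ (v j)
        ≈⟨ *-congʳ (+-congˡ (-‿homo (A i j))) ⟩
      (X * 1ₘ i j + - κ (A i j)) * κ (v j)
        ≈⟨ solve 4 (λ X e a v → (X :* e :+ :- a) :* v := X :* (e :* v) :+ (:- con (+ 1)) :* (a :* v))
             refl X (1ₘ i j) (κ (A i j)) (κ (v j)) ⟩
      X * (1ₘ i j * κ (v j)) + (- 1#) * (κ (A i j) * κ (v j))
        ≈⟨ +-congˡ (*-congˡ (*-homo (A i j) (v j))) ⟨
      X * (1ₘ i j * κ (v j)) + (- 1#) * κ (A i j R.* v j) ∎

  -- The entries of row zero that deflation uses lie off the diagonal and contain no multiple of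
  -- `X`, so deflation acts on `A` alone.
  χ-deflate : ∀ {n} (A : R.Matrix (suc n)) v → deflate (χ A) (κ ∘ v) ≈ₘ χ (R.deflate A v)
  χ-deflate A v i j = begin
    (X * 1ₘ i j + κ (R.- a)) - κ x * (X * 0# + κ (R.- b))
      ≈⟨ +-cong (+-congˡ (-‿homo a)) (-‿cong (*-congˡ (+-congˡ (-‿homo b)))) ⟩
    (X * 1ₘ i j + - κ a) - κ x * (X * 0# + - κ b)
      ≈⟨ solve 5 (λ X e a x b → (X :* e :+ :- a) :- x :* (X :* con (+ 0) :+ :- b) :=
                                X :* e :+ (:- (a :+ :- (x :* b)))) refl X (1ₘ i j) (κ a) (κ x) (κ b) ⟩
    X * 1ₘ i j + - (κ a + - (κ x * κ b))
      ≈⟨ +-congˡ (-‿cong (+-congˡ (-‿cong (*-homo x b)))) ⟨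
    X * 1ₘ i j + - (κ a + - κ (x R.* b))
      ≈⟨ +-congˡ (-‿cong (+-congˡ (-‿homo (x R.* b)))) ⟨
    X * 1ₘ i j + - (κ a + κ (R.- (x R.* b)))
      ≈⟨ +-congˡ (-‿cong (+-homo a (R.- (x R.* b)))) ⟨
    X * 1ₘ i j + - κ (a R.- x R.* b)
      ≈⟨ +-congˡ (-‿homo (a R.- x R.* b)) ⟨
    X * 1ₘ i j + κ (R.- (a R.- x R.* b)) ∎
    where
    a = A (suc i) (suc j)
    x = v (suc i)
    b = A zero (suc j)

  det-χ : ∀ {n} (A : R.Matrix (suc n)) v a → v zero R.≈ R.1# → A R.*ᵥ v R.≈ᵥ a R.∙ᵥ v →
          det (χ A) ≈ (X + κ (R.- a)) * det (χ (R.deflate A v))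
  det-χ A v a v₀≈1 Av≈av = trans
    (det-deflate (χ A) (κ ∘ v) (X + κ (R.- a)) (trans (⟦⟧-cong v₀≈1) 1#-homo) (χ-eigenvector A v a Av≈av))
    (*-congˡ (det-cong (χ-deflate A v)))

-- Simple roots of the characteristic polynomial.

module _ {c ℓ} (R : CommutativeRing c ℓ) where
  open CommutativeRing R
  open IntegerSolver R

  -- Isolated in an arbitrary ring so that the solver sees a polynomial factor as a single variable;
  -- `x * (x * 1#)` is the unfolded square in the definition of multiplicity.
  square-factor : ∀ x q h f → q * (x * (x * 1#)) ≈ f → f ≈ x * h → x * (x * q + - h) ≈ 0#
  square-factor x q h f eq₁ eq₂ = trans
    (solve 3 (λ x q h → x :* (x :* q :+ :- h) := q :* (x :* (x :* con (+ 1))) :+ :- (x :* h)) refl x q h)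
    (trans (+-cong eq₁ (-‿cong (sym eq₂))) (-‿inverseʳ f))

module SimpleRoots {c ℓ} (R : CommutativeRing c ℓ) where
  open CommutativeRing R hiding (zero)
  open Polynomials rawRing
  open Eigenvalues rawRing
  open Determinant R using (deflate; det-cong)
  open PolynomialRing R
  private
    module P = CommutativeRing polynomialCommutativeRing
    module Pₘ = Matrices polynomialRing

  module _ {n} (A : Matrix (suc n)) v a (v₀≈1 : v zero ≈ 1#) (Av≈av : InEigenspace A a v) where

    private
      open CharacteristicMatrix R polynomialCommutativeRing constant-isRingHomomorphism X
      open RingMorphisms.IsRingHomomorphism (eval-isRingHomomorphism a)
      open RingHomomorphism polynomialCommutativeRing R (eval-isRingHomomorphism a) using (det-homo)
      X−a = X +ₚ constant (- a)
      h = Pₘ.det (χ (deflate A v))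

    charPoly-deflate : charPoly A P.≈ X−a P.* h
    charPoly-deflate = det-χ A v a v₀≈1 Av≈av

    eval-h : eval h a ≈ det (λ i j → a * 1ₘ i j + - deflate A v i j)
    eval-h = trans (det-homo (χ (deflate A v))) (det-cong λ i j →
      trans (+-homo (X *ₚ 1ₚ i j) (constant (- deflate A v i j)))
        (+-cong (trans (*-homo X (1ₚ i j)) (*-cong eval-X (eval-if (does (i Fin.≟ j))))) eval-constant))
      where
      1ₚ : ∀ {n} → Pₘ.Matrix n
      1ₚ = Pₘ.1ₘ
      eval-X : eval X a ≈ a
      eval-X = solve 1 (λ a → con (+ 0) :+ a :* (con (+ 1) :+ a :* con (+ 0)) := a) refl a
        where open IntegerSolver R
      eval-if : ∀ b → eval (if b then P.1# else P.0#) a ≈ (if b then 1# else 0#)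
      eval-if true  = 1#-homo
      eval-if false = refl
      eval-constant : ∀ {b} → eval (constant b) a ≈ b
      eval-constant {b} = trans (+-congˡ (zeroʳ a)) (+-identityʳ b)

    -- If (X - a)² q = charPoly A = (X - a) h, cancelling one factor gives h = (X - a) q, hence h(a)
    -- = 0. The hypothesis says that this value, computed entrywise by `eval-h`, is not zero.
    root-of-multiplicity-one : ¬ (det (λ i j → a * 1ₘ i j + - deflate A v i j) ≈ 0#) →
                               HasRootOfMultiplicity (charPoly A) a 1
    root-of-multiplicity-one h≉0 = (h , h·X−a≈charPoly) , λ { (q , eq) → h≉0 (trans (sym eval-h) (eval-h≈0 q eq)) }
      where
      h·X−a≈charPoly : h P.* (X−a P.* P.1#) P.≈ charPoly A
      h·X−a≈charPoly = begin
        h P.* (X−a P.* P.1#)  ≈⟨ P.*-congˡ {h} {X−a P.* P.1#} {X−a} (P.*-identityʳ X−a) ⟩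
        h P.* X−a             ≈⟨ P.*-comm h X−a ⟩
        X−a P.* h             ≈⟨ charPoly-deflate ⟨
        charPoly A            ∎
        where open SetoidReasoning P.setoid
      eval-h≈0 : ∀ q → q P.* (X−a P.* (X−a P.* P.1#)) P.≈ charPoly A → eval h a ≈ 0#
      eval-h≈0 q eq = begin
        eval h a
          ≈⟨ solve 3 (λ u v w → v := u :* w :+ (:- (u :* w :+ :- v))) refl (eval X−a a) (eval h a) (eval q a) ⟩
        eval X−a a * eval q a + - (eval X−a a * eval q a + - eval h a)
          ≈⟨ +-cong (*-congʳ eval-X−a) (-‿cong (trans (sym expand) (⟦⟧-cong {(X−a P.* q) P.+ (P.- h)} {P.0#} q·X−a≈h))) ⟩
        0# * eval q a + - 0#
          ≈⟨ solve 1 (λ x → con (+ 0) :* x :+ (:- con (+ 0)) := con (+ 0)) refl (eval q a) ⟩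
        0# ∎
        where
        open SetoidReasoning setoid
        open IntegerSolver R
        eval-X−a : eval X−a a ≈ 0#
        eval-X−a = solve 1 (λ a → (con (+ 0) :+ :- a) :+ a :* (con (+ 1) :+ a :* con (+ 0)) := con (+ 0)) refl a
        expand : eval ((X−a P.* q) P.+ (P.- h)) a ≈ eval X−a a * eval q a + - eval h a
        expand = trans (+-homo (X−a P.* q) (P.- h)) (+-cong (*-homo X−a q) (-‿homo h))
        q·X−a≈h : (X−a P.* q) P.+ (P.- h) P.≈ P.0#
        q·X−a≈h = X−a-cancel a ((X−a P.* q) P.+ (P.- h))
          (square-factor polynomialCommutativeRing X−a q h (charPoly A) eq charPoly-deflate)

-- Filtered rings: congruences, Newton's iteration and inverses.

-- I k abstracts the ideal pᵏℤₚ of ℚₚ.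
record Filtration {c ℓ} (R : CommutativeRing c ℓ) ℓ′ : Set (c ⊔ ℓ ⊔ Level.suc ℓ′) where
  open CommutativeRing R
  field
    I         : ℕ → Pred Carrier ℓ′
    I-resp    : ∀ {k x y} → x ≈ y → I k x → I k y
    I-suc     : ∀ {k x} → I (suc k) x → I k x
    I-0#      : ∀ {k} → I k 0#
    I-1#      : I 0 1#
    I-+       : ∀ {k x y} → I k x → I k y → I k (x + y)
    I-neg     : ∀ {k x} → I k x → I k (- x)
    I-*       : ∀ {j k x y} → I j x → I k y → I (j ℕ.+ k) (x * y)
    1#∉I₁     : ¬ I 1 1#
    separated : ∀ {x} → (∀ k → I k x) → x ≈ 0#
    -- The rate of convergence is part of the hypothesis, so the limit agrees with term k modulo
    -- `I k` and no modulus of convergence is carried along.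
    complete  : ∀ (s : ℕ → Carrier) → I 0 (s 0) → (∀ k → I (suc k) (s (suc k) - s k)) → ∃[ l ] ∀ k → I k (l - s k)
    -- Elements need not be integral: `b` is the power of p that a denominator of `y` can cost.
    bounded   : ∀ y → ∃[ b ] ∀ {k x} → I (b ℕ.+ k) x → I k (x * y)

module FiltrationProperties {c ℓ ℓ′} {R : CommutativeRing c ℓ} (F : Filtration R ℓ′) where
  open CommutativeRing R hiding (zero)
  open Filtration F
  open Matrices rawRing
  open IntegerSolver R
  open Determinant R
  open Exp semiring using (_^_)
  open Sum semiring using (sum)
  open SetoidReasoning setoid

  I-*ˡ : ∀ {k x y} → I 0 x → I k y → I k (x * y)
  I-*ˡ = I-*

  I-*ʳ : ∀ {k x y} → I k x → I 0 y → I k (x * y)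
  I-*ʳ x∈I y∈I = I-resp (*-comm _ _) (I-* y∈I x∈I)

  I-drop : ∀ j {k x} → I (j ℕ.+ k) x → I k x
  I-drop zero    x∈I = x∈I
  I-drop (suc j) x∈I = I-drop j (I-suc x∈I)

  I₀ : ∀ {k x} → I k x → I 0 x
  I₀ {zero}  x∈I = x∈I
  I₀ {suc k} x∈I = I₀ (I-suc x∈I)

  I₁ : ∀ {k x} → I (suc k) x → I 1 x
  I₁ {zero}  x∈I = x∈I
  I₁ {suc k} x∈I = I₁ (I-suc x∈I)

  I-sum : ∀ {k n} {f : Vector Carrier n} → (∀ i → I k (f i)) → I k (sum f)
  I-sum {n = zero}  f∈I = I-0#
  I-sum {n = suc n} f∈I = I-+ (f∈I zero) (I-sum (f∈I ∘ suc))

  infix 4 _≡_[mod_]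
  _≡_[mod_] : Carrier → Carrier → ℕ → Set ℓ′
  x ≡ y [mod k ] = I k (x - y)

  mod-reflexive : ∀ {k x y} → x ≈ y → x ≡ y [mod k ]
  mod-reflexive {x = x} x≈y = I-resp (trans (sym (-‿inverseʳ x)) (+-congˡ (-‿cong x≈y))) I-0#

  mod-resp : ∀ {k x x′ y y′} → x ≈ x′ → y ≈ y′ → x ≡ y [mod k ] → x′ ≡ y′ [mod k ]
  mod-resp x≈x′ y≈y′ = I-resp (+-cong x≈x′ (-‿cong y≈y′))

  mod-sym : ∀ {k x y} → x ≡ y [mod k ] → y ≡ x [mod k ]
  mod-sym {x = x} {y} p = I-resp (solve 2 (λ x y → :- (x :- y) := y :- x) refl x y) (I-neg p)

  mod-trans : ∀ {k x y z} → x ≡ y [mod k ] → y ≡ z [mod k ] → x ≡ z [mod k ]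
  mod-trans {x = x} {y} {z} p q =
    I-resp (solve 3 (λ x y z → (x :- y) :+ (y :- z) := x :- z) refl x y z) (I-+ p q)

  mod-+ : ∀ {k x x′ y y′} → x ≡ x′ [mod k ] → y ≡ y′ [mod k ] → x + y ≡ x′ + y′ [mod k ]
  mod-+ {x = x} {x′} {y} {y′} p q =
    I-resp (solve 4 (λ x x′ y y′ → (x :- x′) :+ (y :- y′) := (x :+ y) :- (x′ :+ y′)) refl x x′ y y′) (I-+ p q)

  mod-* : ∀ {k x x′ y y′} → I 0 x → I 0 y′ → x ≡ x′ [mod k ] → y ≡ y′ [mod k ] → x * y ≡ x′ * y′ [mod k ]
  mod-* {x = x} {x′} {y} {y′} x∈I y′∈I p q =
    I-resp (solve 4 (λ x x′ y y′ → x :* (y :- y′) :+ (x :- x′) :* y′ := x :* y :- x′ :* y′) refl x x′ y y′)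
      (I-+ (I-*ˡ x∈I q) (I-*ʳ p y′∈I))

  mod-sum : ∀ {k n} {f g : Vector Carrier n} → (∀ i → f i ≡ g i [mod k ]) → sum f ≡ sum g [mod k ]
  mod-sum {n = zero}  p = mod-reflexive refl
  mod-sum {n = suc n} p = mod-+ (p zero) (mod-sum (p ∘ suc))

  mod-I : ∀ {k x y} → x ≡ y [mod k ] → I k y → I k x
  mod-I {x = x} {y} p y∈I = I-resp (solve 2 (λ x y → (x :- y) :+ y := x) refl x y) (I-+ p y∈I)

  mod-I₀ : ∀ {k x y} → x ≡ y [mod k ] → I 0 y → I 0 x
  mod-I₀ p = mod-I (I₀ p)

  private
    -- With x′ = x - u g, the new value g′ is the error of the linear approximation with slope a,
    -- minus (u a - 1) g.
    newton-step : ∀ g′ g x u a → ((g′ - g) - a * ((x - u * g) - x)) + - ((u * a - 1#) * g) ≈ g′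
    newton-step = solve 5 (λ g′ g x u a →
      ((g′ :- g) :- a :* ((x :- u :* g) :- x)) :+ (:- ((u :* a :- con (+ 1)) :* g)) := g′) refl

    newton-limit : ∀ g h a d → ((g - h) - a * d) + (h + a * d) ≈ g
    newton-limit = solve 4 (λ g h a d → ((g :- h) :- a :* d) :+ (h :+ a :* d) := g) refl

  -- Newton's iteration x ↦ x - u G(x), where u inverts the derivative a of G.
  newton : ∀ {n} (G : Vector Carrier n → Vector Carrier n) (c : Vector Carrier n) a u →
    (∀ i → I 0 (c i)) → I 0 a → I 0 u → u * a ≡ 1# [mod 1 ] → (∀ i → I 1 (G c i)) →
    (∀ x y → (∀ i → x i ≡ c i [mod 1 ]) → (∀ i → y i ≡ c i [mod 1 ]) →
     ∀ k → (∀ i → x i ≡ y i [mod k ]) → ∀ i → G x i - G y i ≡ a * (x i - y i) [mod suc k ]) →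
    ∃[ x ] (∀ i → x i ≡ c i [mod 1 ]) × (∀ i → G x i ≈ 0#)
  newton {n} G c a u c∈I a∈I u∈I ua≡1 Gc∈I₁ G-derivative = l , l≡c , λ i → separated (Gl∈I i)
    where
    s : ℕ → Vector Carrier n
    s zero    = c
    s (suc k) i = s k i - u * G (s k) i
    s-invariant : ∀ k → (∀ i → s k i ≡ c i [mod 1 ]) × (∀ i → I (suc k) (G (s k) i))
    s-step : ∀ k i → s (suc k) i ≡ s k i [mod suc k ]
    s-step k i = I-resp (solve 2 (λ x d → :- d := (x :- d) :- x) refl (s k i) (u * G (s k) i))
      (I-neg (I-*ˡ u∈I (proj₂ (s-invariant k) i)))
    s-invariant zero    = (λ i → mod-reflexive refl) , Gc∈I₁
    s-invariant (suc k) = s′≡c , λ i → I-resp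
        (newton-step (G (s (suc k)) i) (G (s k) i) (s k i) u a)
        -- Both summands lie in `I (2 + k)`: the derivative estimate gains one level over `s-step`,
        -- and `u * a - 1#` in `I 1` gains one level over the current value of `G`.
        (I-+ (G-derivative (s (suc k)) (s k) s′≡c s≡c (suc k) (s-step k) i)
             (I-neg (I-* ua≡1 (proj₂ (s-invariant k) i))))
      where
      s≡c = proj₁ (s-invariant k)
      s′≡c : ∀ i → s (suc k) i ≡ c i [mod 1 ]
      s′≡c i = mod-trans (I₁ (s-step k i)) (s≡c i)
    limit : ∀ i → ∃[ l ] ∀ k → l ≡ s k i [mod k ]
    limit i = complete (λ k → s k i) (c∈I i) (λ k → s-step k i)
    l : Vector Carrier n
    l i = proj₁ (limit i)
    l≡c : ∀ i → l i ≡ c i [mod 1 ]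
    l≡c i = mod-trans (proj₂ (limit i) 1) (proj₁ (s-invariant 1) i)
    Gl∈I : ∀ i k → I k (G l i)
    Gl∈I i k = I-resp
      (newton-limit (G l i) (G (s k) i) a (l i - s k i))
      (I-+ (I-suc (G-derivative l (s k) l≡c (proj₁ (s-invariant k)) k (λ j → proj₂ (limit j) k) i))
           (I-+ (I-suc (proj₂ (s-invariant k) i)) (I-*ˡ a∈I (proj₂ (limit i) k))))

  -- Newton's iteration in one coordinate for x ↦ a x - 1, started at `u`; the map is affine with
  -- slope exactly `a`.
  inverse : ∀ {a u} → I 0 a → I 0 u → u * a ≡ 1# [mod 1 ] → ∃[ b ] (b ≡ u [mod 1 ]) × a * b ≈ 1#
  inverse {a} {u} a∈I u∈I ua≡1 = proj₁ root zero , proj₁ (proj₂ root) zero ,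
    trans (solve 2 (λ a x → a :* x := (a :* x :- con (+ 1)) :+ con (+ 1)) refl a (proj₁ root zero))
      (trans (+-congʳ (proj₂ (proj₂ root) zero)) (+-identityˡ 1#))
    where
    root : ∃[ x ] ((i : Fin 1) → x i ≡ u [mod 1 ]) × (∀ i → a * x i - 1# ≈ 0#)
    root = newton {1} (λ x i → a * x i - 1#) (λ _ → u) a u (λ _ → u∈I) a∈I u∈I ua≡1
      (λ _ → I-resp (+-congʳ (*-comm u a)) ua≡1)
      (λ x y _ _ k _ i → mod-reflexive
        (solve 3 (λ a x y → (a :* x :- con (+ 1)) :- (a :* y :- con (+ 1)) := a :* (x :- y)) refl a (x i) (y i)))

  sum-sub : ∀ {n} (f g : Vector Carrier n) → sum f - sum g ≈ sum (λ i → f i - g i)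
  sum-sub {zero}  f g = -‿inverseʳ 0#
  sum-sub {suc n} f g = trans
    (solve 4 (λ a s b t → (a :+ s) :- (b :+ t) := (a :- b) :+ (s :- t)) refl
      (f zero) (sum (f ∘ suc)) (g zero) (sum (g ∘ suc)))
    (+-congˡ (sum-sub (f ∘ suc) (g ∘ suc)))

  sign-integral : ∀ k → I 0 ((- 1#) ^ k)
  sign-integral zero    = I-1#
  sign-integral (suc k) = I-*ˡ (I-neg I-1#) (sign-integral k)

  det-integral : ∀ {n} (A : Matrix n) → (∀ i j → I 0 (A i j)) → I 0 (det A)
  det-integral {zero}  A A∈I = I-1#
  det-integral {suc n} A A∈I = I-sum {n = suc n} λ j → I-*ˡ (sign-integral (toℕ j))
    (I-*ˡ (A∈I zero j) (det-integral _ λ i k → A∈I (suc i) (punchIn j k)))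

-- Bilinear sums, and powers of a matrix on its fixed vectors.

module BilinearSums {c ℓ} (R : CommutativeRing c ℓ) where
  open CommutativeRing R hiding (zero)
  open Matrices rawRing
  open IntegerSolver R
  open Determinant R using (sum-*-1ₘ; sum-1ₘ-*)
  open Sum semiring using (sum; sum-cong-≋; *-distribˡ-sum; *-distribʳ-sum; ∑-comm)
  open SetoidReasoning setoid

  infix 8 _∙_
  _∙_ : ∀ {n} → Vector Carrier n → Vector Carrier n → Carrier
  u ∙ v = sum (λ i → u i * v i)

  infixl 7 _ᵥ*_
  _ᵥ*_ : ∀ {n} → Vector Carrier n → Matrix n → Vector Carrier n
  (u ᵥ* A) j = sum (λ i → u i * A i j)

  ∙-congˡ : ∀ {n} (u : Vector Carrier n) {v w} → v ≈ᵥ w → u ∙ v ≈ u ∙ w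
  ∙-congˡ {n} u v≈w = sum-cong-≋ {n} λ i → *-congˡ (v≈w i)

  ∙-congʳ : ∀ {n} {u v : Vector Carrier n} w → u ≈ᵥ v → u ∙ w ≈ v ∙ w
  ∙-congʳ {n} w u≈v = sum-cong-≋ {n} λ i → *-congʳ (u≈v i)

  ∙-scaleˡ : ∀ {n} a (u v : Vector Carrier n) → (a ∙ᵥ u) ∙ v ≈ a * u ∙ v
  ∙-scaleˡ {n} a u v = trans (sum-cong-≋ {n} λ i → *-assoc a (u i) (v i)) (sym (*-distribˡ-sum a (λ i → u i * v i)))

  ∙-scaleʳ : ∀ {n} a (u v : Vector Carrier n) → u ∙ (a ∙ᵥ v) ≈ a * u ∙ v
  ∙-scaleʳ {n} a u v = trans
    (sum-cong-≋ {n} λ i → solve 3 (λ u a v → u :* (a :* v) := a :* (u :* v)) refl (u i) a (v i))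
    (sym (*-distribˡ-sum a (λ i → u i * v i)))

  ∙-*ᵥ : ∀ {n} (u : Vector Carrier n) A v → u ∙ (A *ᵥ v) ≈ (u ᵥ* A) ∙ v
  ∙-*ᵥ {n} u A v = begin
    sum (λ i → u i * sum (λ j → A i j * v j))
      ≈⟨ sum-cong-≋ {n} (λ i → *-distribˡ-sum (u i) (λ j → A i j * v j)) ⟩
    sum (λ i → sum (λ j → u i * (A i j * v j)))
      ≈⟨ ∑-comm (λ i j → u i * (A i j * v j)) ⟩
    sum (λ j → sum (λ i → u i * (A i j * v j)))
      ≈⟨ sum-cong-≋ {n} (λ j → sum-cong-≋ {n} λ i → sym (*-assoc (u i) (A i j) (v j))) ⟩
    sum (λ j → sum (λ i → u i * A i j * v j))
      ≈⟨ sum-cong-≋ {n} (λ j → sym (*-distribʳ-sum (v j) (λ i → u i * A i j))) ⟩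
    sum (λ j → sum (λ i → u i * A i j) * v j) ∎

  ∙-sub : ∀ {n} (a b u v : Vector Carrier n) →
          (λ i → a i - b i) ∙ (λ i → u i - v i) ≈ (a ∙ u - a ∙ v) - (b ∙ u - b ∙ v)
  ∙-sub {zero}  a b u v = solve 0 (con (+ 0) := (con (+ 0) :- con (+ 0)) :- (con (+ 0) :- con (+ 0))) refl
  ∙-sub {suc n} a b u v = trans (+-congˡ (∙-sub (a ∘ suc) (b ∘ suc) (u ∘ suc) (v ∘ suc)))
    (solve 8 (λ a b u v p q r s →
        (a :- b) :* (u :- v) :+ ((p :- q) :- (r :- s)) :=
        ((a :* u :+ p) :- (a :* v :+ q)) :- ((b :* u :+ r) :- (b :* v :+ s)))
      refl (a zero) (b zero) (u zero) (v zero)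
      ((a ∘ suc) ∙ (u ∘ suc)) ((a ∘ suc) ∙ (v ∘ suc)) ((b ∘ suc) ∙ (u ∘ suc)) ((b ∘ suc) ∙ (v ∘ suc)))

  ∙-subˡ : ∀ {n} (a b v : Vector Carrier n) → (λ i → a i - b i) ∙ v ≈ a ∙ v - b ∙ v
  ∙-subˡ {zero}  a b v = sym (-‿inverseʳ 0#)
  ∙-subˡ {suc n} a b v = trans (+-congˡ (∙-subˡ (a ∘ suc) (b ∘ suc) (v ∘ suc)))
    (solve 5 (λ a b v p q → (a :- b) :* v :+ (p :- q) := (a :* v :+ p) :- (b :* v :+ q))
      refl (a zero) (b zero) (v zero) ((a ∘ suc) ∙ (v ∘ suc)) ((b ∘ suc) ∙ (v ∘ suc)))

  ^ₘ-fixed : ∀ {n} (B : Matrix n) v → B *ᵥ v ≈ᵥ v → ∀ k → B ^ₘ k *ᵥ v ≈ᵥ v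
  ^ₘ-fixed B v Bv≈v zero    i = sum-*-1ₘ i v
  ^ₘ-fixed B v Bv≈v (suc k) i = begin
    (B i ᵥ* B ^ₘ k) ∙ v     ≈⟨ ∙-*ᵥ (B i) (B ^ₘ k) v ⟨
    B i ∙ (B ^ₘ k *ᵥ v)     ≈⟨ ∙-congˡ (B i) (^ₘ-fixed B v Bv≈v k) ⟩
    B i ∙ v                 ≈⟨ Bv≈v i ⟩
    v i                     ∎

  ^ₘ-fixedˡ : ∀ {n} (B : Matrix n) u → u ᵥ* B ≈ᵥ u → ∀ k → u ᵥ* B ^ₘ k ≈ᵥ u
  ^ₘ-fixedˡ B u uB≈u zero    j = sum-1ₘ-* j u
  ^ₘ-fixedˡ B u uB≈u (suc k) j = begin
    u ∙ (B *ᵥ λ i → (B ^ₘ k) i j)     ≈⟨ ∙-*ᵥ u B (λ i → (B ^ₘ k) i j) ⟩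
    (u ᵥ* B) ∙ (λ i → (B ^ₘ k) i j)   ≈⟨ ∙-congʳ (λ i → (B ^ₘ k) i j) uB≈u ⟩
    (u ᵥ* B ^ₘ k) j                   ≈⟨ ^ₘ-fixedˡ B u uB≈u k j ⟩
    u j                               ∎

-- The dominant eigenvalue over a filtered ring.

module PerronTheory {c ℓ ℓ′} {R : CommutativeRing c ℓ} (F : Filtration R ℓ′) (m : ℕ) where
  open CommutativeRing R hiding (zero)
  open Filtration F
  open Eigenvalues rawRing
  open IntegerSolver R
  open Determinant R using (deflate)
  open FiltrationProperties F
  open BilinearSums R
  open Sum semiring using (sum; sum-cong-≋)
  open SetoidReasoning setoid

  n : ℕ
  n = suc m

  -- The integer n in `R`, as a sum of ones, so that congruences such as A x ≡ n follow term by
  -- term.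
  ν : Carrier
  ν = sum {n} (λ _ → 1#)

  ν-integral : I 0 ν
  ν-integral = I-sum {n = n} λ _ → I-1#

  -- Needed because eigenvectors of A may have denominators. The losses of the single coordinates
  -- are added up, which is a crude but sufficient bound.
  ∙-bounded : ∀ {r} (v : Vector Carrier r) →
              ∃[ b ] ∀ {k} {w : Vector Carrier r} → (∀ i → I (b ℕ.+ k) (w i)) → I k (w ∙ v)
  ∙-bounded {zero}  v = 0 , λ _ → I-0#
  ∙-bounded {suc r} v = b₀ ℕ.+ b , λ {k} {w} w∈I → I-+
    (I-drop b (proj₂ (bounded (v zero)) (subst (λ e → I e (w zero)) (ℕ.+-assoc b₀ b k) (w∈I zero))))
    (proj₂ (∙-bounded (v ∘ suc)) λ i →
      I-drop b₀ (subst (λ e → I e (w (suc i))) (ℕ.+-assoc b₀ b k) (w∈I (suc i))))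
    where
    b₀ = proj₁ (bounded (v zero))
    b  = proj₁ (∙-bounded (v ∘ suc))

  1ₘ-integral : ∀ {r} (i j : Fin r) → I 0 (1ₘ i j)
  1ₘ-integral zero    zero    = I-1#
  1ₘ-integral zero    (suc j) = I-0#
  1ₘ-integral (suc i) zero    = I-0#
  1ₘ-integral (suc i) (suc j) = 1ₘ-integral i j

  module Invertible (u : Carrier) (u-integral : I 0 u) (uν≡1 : u * ν ≡ 1# [mod 1 ]) where

    record PerronPair (A : Matrix n) : Set (c ⊔ ℓ ⊔ ℓ′) where
      field
        eigenvalue    : Carrier
        eigenvalue≡ν  : eigenvalue ≡ ν [mod 1 ]
        eigenvalue⁻¹  : Carrier
        eigenvalue⁻¹≡u : eigenvalue⁻¹ ≡ u [mod 1 ]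
        invertible    : eigenvalue * eigenvalue⁻¹ ≈ 1#
        eigenvector   : Vector Carrier n
        eigenvector≡1 : ∀ i → eigenvector i ≡ 1# [mod 1 ]
        eigenvector₀  : eigenvector zero ≈ 1#
        eigen         : InEigenspace A eigenvalue eigenvector

    -- Serves both for the eigenvalue and for y · x, each of which is congruent to n; that the
    -- inverses share the residue `u` is what later makes B ≡ P.
    inverse-of-ν : ∀ {a} → a ≡ ν [mod 1 ] → ∃[ b ] (b ≡ u [mod 1 ]) × a * b ≈ 1#
    inverse-of-ν a≡ν = inverse (mod-I₀ a≡ν ν-integral) u-integral
      (mod-trans (mod-* u-integral ν-integral (mod-reflexive refl) a≡ν) uν≡1)

    -- The eigenvectors with first entry 1 are the zeros of
    -- x ↦ (A x)₀ x - A x, whose derivative is n modulo p on vectors ≡ 1.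
    perronPair : (A : Matrix n) → (∀ i j → A i j ≡ 1# [mod 1 ]) → PerronPair A
    perronPair A A≡1 = record
      { eigenvalue     = e
      ; eigenvalue≡ν   = Ax≡ν x≡1 zero
      ; eigenvalue⁻¹   = e⁻¹
      ; eigenvalue⁻¹≡u = proj₁ (proj₂ e-inverse)
      ; invertible     = ee⁻¹≈1
      ; eigenvector    = x
      ; eigenvector≡1  = x≡1
      -- `e` is itself (A x)₀, so row zero of the eigenvector equation reads e x₀ = e, and e is a
      -- unit.
      ; eigenvector₀   = begin
          x zero                ≈⟨ *-identityˡ _ ⟨
          1# * x zero           ≈⟨ *-congʳ ee⁻¹≈1 ⟨
          e * e⁻¹ * x zero      ≈⟨ solve 3 (λ e e⁻¹ x → e :* e⁻¹ :* x := e⁻¹ :* (e :* x)) refl e e⁻¹ (x zero) ⟩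
          e⁻¹ * (e * x zero)    ≈⟨ *-congˡ (eigen zero) ⟨
          e⁻¹ * e               ≈⟨ *-comm e⁻¹ e ⟩
          e * e⁻¹               ≈⟨ ee⁻¹≈1 ⟩
          1#                    ∎
      ; eigen          = eigen
      }
      where
      A∈I : ∀ i j → I 0 (A i j)
      A∈I i j = mod-I₀ (A≡1 i j) I-1#
      Ax≡ν : ∀ {x} → (∀ i → x i ≡ 1# [mod 1 ]) → ∀ i → (A *ᵥ x) i ≡ ν [mod 1 ]
      Ax≡ν x≡1 i = mod-sum {n = n} λ j →
        mod-resp refl (*-identityʳ 1#) (mod-* (A∈I i j) I-1# (A≡1 i j) (x≡1 j))
      G : Vector Carrier n → Vector Carrier n
      G x i = (A *ᵥ x) zero * x i - (A *ᵥ x) i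
      G-one : ∀ i → I 1 (G (λ _ → 1#) i)
      G-one i = mod-trans (mod-resp (sym (*-identityʳ _)) refl (Ax≡ν (λ _ → mod-reflexive refl) zero))
        (mod-sym (Ax≡ν (λ _ → mod-reflexive refl) i))
      G-derivative : ∀ x y → (∀ i → x i ≡ 1# [mod 1 ]) → (∀ i → y i ≡ 1# [mod 1 ]) →
        ∀ k → (∀ i → x i ≡ y i [mod k ]) → ∀ i → G x i - G y i ≡ ν * (x i - y i) [mod suc k ]
      G-derivative x y x≡1 y≡1 k x≡y i = I-resp
        (identity ((A *ᵥ x) zero) ((A *ᵥ y) zero) ((A *ᵥ x) i) ((A *ᵥ y) i) (x i) (y i) ν)
        -- Three error terms, with d = x - y: ((A x)₀ - n) dᵢ, then (yᵢ - 1)(A d)₀, then the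
        -- difference of rows zero and i of A applied to d. Each is built from products of a factor
        -- in `I 1` and one in `I k`.
        (I-+ (I-* (Ax≡ν x≡1 zero) (x≡y i))
        (I-+ (I-* (y≡1 i) (Ax≡Ay zero))
             (I-resp (+-cong (Aδ zero) (-‿cong (Aδ i)))
               (mod-resp refl refl (mod-sum {n = n} λ j → rows-agree j)))))
        where
        δ : Vector Carrier n
        δ j = x j - y j
        Aδ : ∀ i → A i ∙ δ ≈ (A *ᵥ x) i - (A *ᵥ y) i
        Aδ i = trans (sum-cong-≋ {n} λ j → solve 3 (λ a x y → a :* (x :- y) := a :* x :- a :* y) refl (A i j) (x j) (y j))
          (sym (sum-sub (λ j → A i j * x j) (λ j → A i j * y j)))
        Ax≡Ay : ∀ i → (A *ᵥ x) i ≡ (A *ᵥ y) i [mod k ]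
        Ax≡Ay i = I-resp (Aδ i) (I-sum {n = n} λ j → I-*ˡ (A∈I i j) (x≡y j))
        rows-agree : ∀ j → A zero j * δ j ≡ A i j * δ j [mod suc k ]
        rows-agree j = I-resp (solve 3 (λ a b d → (a :- b) :* d := a :* d :- b :* d) refl (A zero j) (A i j) (δ j))
          (I-* (mod-trans (A≡1 zero j) (mod-sym (A≡1 i j))) (x≡y j))
        identity : ∀ p q r s x y ν → (p - ν) * (x - y) + ((y - 1#) * (p - q) + ((p - q) - (r - s))) ≈
                   ((p * x - r) - (q * y - s)) - ν * (x - y)
        identity = solve 7 (λ p q r s x y ν →
          (p :- ν) :* (x :- y) :+ ((y :- con (+ 1)) :* (p :- q) :+ ((p :- q) :- (r :- s))) :=
          ((p :* x :- r) :- (q :* y :- s)) :- ν :* (x :- y)) refl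
      root : ∃[ x ] (∀ i → x i ≡ 1# [mod 1 ]) × (∀ i → G x i ≈ 0#)
      root = newton G (λ _ → 1#) ν u (λ _ → I-1#) ν-integral u-integral uν≡1 G-one G-derivative
      x : Vector Carrier n
      x = proj₁ root
      x≡1 : ∀ i → x i ≡ 1# [mod 1 ]
      x≡1 = proj₁ (proj₂ root)
      e : Carrier
      e = (A *ᵥ x) zero
      eigen : InEigenspace A e x
      eigen i = trans (solve 2 (λ p q → q := p :- (p :- q)) refl (e * x i) ((A *ᵥ x) i))
        (trans (+-congˡ (-‿cong (proj₂ (proj₂ root) i))) (solve 1 (λ p → p :- con (+ 0) := p) refl (e * x i)))
      e-inverse : ∃[ b ] (b ≡ u [mod 1 ]) × e * b ≈ 1#
      e-inverse = inverse-of-ν (Ax≡ν x≡1 zero)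
      e⁻¹ : Carrier
      e⁻¹ = proj₁ e-inverse
      ee⁻¹≈1 : e * e⁻¹ ≈ 1#
      ee⁻¹≈1 = proj₂ (proj₂ e-inverse)

    -- All entries of the first row but the leading one lie in `I 1`, so det B ≡ a det(minor). As
    -- `a` is a unit, membership in `I 1` would descend through the minors to the empty determinant
    -- 1.
    det-nonzero : ∀ {k a b} (B : Matrix k) → I 0 a → I 0 b → a * b ≈ 1# →
                  (∀ i j → B i j ≡ a * 1ₘ i j [mod 1 ]) → ¬ I 1 (det B)
    det-nonzero {zero}  B a∈I b∈I ab≈1 B≡a det∈I = 1#∉I₁ det∈I
    det-nonzero {suc k} {a} {b} B a∈I b∈I ab≈1 B≡a det∈I =
      det-nonzero minor a∈I b∈I ab≈1 (λ i j → B≡a (suc i) (suc j)) (I-resp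
        (trans (solve 3 (λ a b d → b :* (a :* con (+ 1) :* d) := (a :* b) :* d) refl a b (det minor))
               (trans (*-congʳ ab≈1) (*-identityˡ _)))
        (I-*ˡ b∈I (mod-I (mod-sym leading) det∈I)))
      where
      minor : Matrix k
      minor i j = B (suc i) (suc j)
      B∈I : ∀ i j → I 0 (B i j)
      B∈I i j = mod-I₀ (B≡a i j) (I-*ˡ a∈I (1ₘ-integral i j))
      minor-integral : ∀ j → I 0 (det (λ i l → B (suc i) (punchIn (suc j) l)))
      minor-integral j = det-integral _ λ i l → B∈I (suc i) (punchIn (suc j) l)
      leading : det B ≡ a * 1# * det minor [mod 1 ]
      leading = mod-resp refl (trans (+-identityʳ _) (*-identityˡ _))
        (mod-+ (mod-* I-1# (I-*ˡ (I-*ˡ a∈I I-1#) (det-integral minor λ i j → B∈I (suc i) (suc j))) (mod-reflexive refl)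
                 (mod-* (B∈I zero zero) (det-integral minor λ i j → B∈I (suc i) (suc j)) (B≡a zero zero) (mod-reflexive refl)))
               (I-resp (sym (solve 1 (λ x → x :- con (+ 0) := x) refl _))
                 (I-sum {n = k} λ j → I-*ˡ (sign-integral (suc (toℕ j))) (I-*ʳ
                   (mod-I (B≡a zero (suc j)) (I-resp (sym (zeroʳ a)) I-0#)) (minor-integral j)))))

    -- What the final theorem draws on, with the witnesses as fields, so that `dominantEigenvalue`
    -- can be abstract and the limits behind the witnesses do not unfold. `leftEigen` and `A≡y` are
    -- there for the eigenvalues in ℂₚ.
    record DominantEigenvalue (A : Matrix n) : Set (c ⊔ ℓ ⊔ ℓ′) where
      field
        {λ₁ λ₁⁻¹}          : Carrier
        {x y}              : Vector Carrier n
        {P}                : Matrix n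
        isSimpleEigenvalue : IsSimpleEigenvalue A λ₁
        λ₁-integral        : I 0 λ₁
        λ₁∉I₁              : ¬ I 1 λ₁
        λ₁≡ν               : λ₁ ≡ ν [mod 1 ]
        invertible         : λ₁ * λ₁⁻¹ ≈ 1#
        isEigenvector      : IsEigenvector A λ₁ x
        x≡1                : ∀ i → x i ≡ 1# [mod 1 ]
        leftEigen          : y ᵥ* A ≈ᵥ λ₁ ∙ᵥ y
        A≡y                : ∀ i j → A i j ≡ y j [mod 1 ]
        powers-converge    : ∀ k i j → ((λ₁⁻¹ ∙ₘ A) ^ₘ k) i j ≡ P i j [mod k ]
        isProjection       : IsProjectionOntoEigenspace P A λ₁

    module Construction (A : Matrix n) (A≡1 : ∀ i j → A i j ≡ 1# [mod 1 ]) where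
      private
        right = perronPair A A≡1
        left  = perronPair (flip A) (flip A≡1)

      open PerronPair right public
        using (eigenvalue≡ν; invertible; eigenvector₀; eigen)
        renaming ( eigenvalue to λ₁; eigenvalue⁻¹ to λ₁⁻¹; eigenvalue⁻¹≡u to λ₁⁻¹≡u
                 ; eigenvector to x; eigenvector≡1 to x≡1)
      open PerronPair left public using () renaming (eigenvector to y; eigenvector≡1 to y≡1)
      private
        module Left = PerronPair left

      λ₁-integral : I 0 λ₁
      λ₁-integral = mod-I₀ eigenvalue≡ν ν-integral

      λ₁⁻¹-integral : I 0 λ₁⁻¹
      λ₁⁻¹-integral = mod-I₀ λ₁⁻¹≡u u-integral

      λ₁∉I₁ : ¬ I 1 λ₁
      λ₁∉I₁ λ₁∈I = 1#∉I₁ (I-resp invertible (I-*ʳ λ₁∈I λ₁⁻¹-integral))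

      x-integral : ∀ i → I 0 (x i)
      x-integral i = mod-I₀ (x≡1 i) I-1#

      y-integral : ∀ i → I 0 (y i)
      y-integral i = mod-I₀ (y≡1 i) I-1#

      y∙x : Carrier
      y∙x = y ∙ x

      y∙x⁻¹ : ∃[ s ] (s ≡ u [mod 1 ]) × y∙x * s ≈ 1#
      y∙x⁻¹ = inverse-of-ν (mod-sum {n = n} λ i →
        mod-resp refl (*-identityʳ 1#) (mod-* (y-integral i) I-1# (y≡1 i) (x≡1 i)))

      s : Carrier
      s = proj₁ y∙x⁻¹

      s-integral : I 0 s
      s-integral = mod-I₀ (proj₁ (proj₂ y∙x⁻¹)) u-integral

      leftEigen′ : y ᵥ* A ≈ᵥ Left.eigenvalue ∙ᵥ y
      leftEigen′ j = trans (sum-cong-≋ {n} λ i → *-comm (y i) (A i j)) (Left.eigen j)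

      -- The two eigenvalues come from independent iterations; evaluating y A x from either side
      -- shows that they agree after multiplication by y · x, which has the inverse `s`.
      left≈right : Left.eigenvalue ≈ λ₁
      left≈right = begin
        Left.eigenvalue                   ≈⟨ *-identityʳ _ ⟨
        Left.eigenvalue * 1#              ≈⟨ *-congˡ (proj₂ (proj₂ y∙x⁻¹)) ⟨
        Left.eigenvalue * (y∙x * s)       ≈⟨ *-assoc _ _ _ ⟨
        Left.eigenvalue * y∙x * s         ≈⟨ *-congʳ (∙-scaleˡ Left.eigenvalue y x) ⟨
        (Left.eigenvalue ∙ᵥ y) ∙ x * s    ≈⟨ *-congʳ (∙-congʳ x leftEigen′) ⟨
        (y ᵥ* A) ∙ x * s                  ≈⟨ *-congʳ (∙-*ᵥ y A x) ⟨
        y ∙ (A *ᵥ x) * s                  ≈⟨ *-congʳ (∙-congˡ y eigen) ⟩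
        y ∙ (λ₁ ∙ᵥ x) * s                 ≈⟨ *-congʳ (∙-scaleʳ λ₁ y x) ⟩
        λ₁ * y∙x * s                      ≈⟨ *-assoc _ _ _ ⟩
        λ₁ * (y∙x * s)                    ≈⟨ *-congˡ (proj₂ (proj₂ y∙x⁻¹)) ⟩
        λ₁ * 1#                           ≈⟨ *-identityʳ _ ⟩
        λ₁                                ∎

      leftEigen : y ᵥ* A ≈ᵥ λ₁ ∙ᵥ y
      leftEigen j = trans (leftEigen′ j) (*-congʳ left≈right)

      x≉0 : ¬ (x ≈ᵥ λ _ → 0#)
      x≉0 x≈0 = 1#∉I₁ (I-resp (trans (sym (x≈0 zero)) eigenvector₀) I-0#)

      isSimpleEigenvalue : IsSimpleEigenvalue A λ₁
      isSimpleEigenvalue = (x , x≉0 , eigen) , root-of-multiplicity-one A x λ₁ eigenvector₀ eigen λ det≈0 →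
        det-nonzero (λ i j → λ₁ * 1ₘ i j + - deflate A x i j) λ₁-integral λ₁⁻¹-integral invertible
          -- Each entry of `deflate A x` is 1 - 1 · 1 modulo `I 1`, so the matrix is congruent to
          -- the scalar matrix λ₁.
          (λ i j → I-resp (solve 2 (λ p d → :- d := (p :+ :- d) :- p) refl (λ₁ * 1ₘ i j) (deflate A x i j))
            (I-neg (mod-trans (A≡1 (suc i) (suc j)) (mod-sym
              (mod-resp refl (*-identityʳ 1#) (mod-* (x-integral (suc i)) I-1# (x≡1 (suc i)) (A≡1 zero (suc j))))))))
          (I-resp (sym det≈0) I-0#)
        where open SimpleRoots R using (root-of-multiplicity-one)

      P B : Matrix n
      P i j = x i * (s * y j)
      B = λ₁⁻¹ ∙ₘ A

      Bx≈x : B *ᵥ x ≈ᵥ x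
      Bx≈x i = begin
        (λ₁⁻¹ ∙ᵥ A i) ∙ x     ≈⟨ ∙-scaleˡ λ₁⁻¹ (A i) x ⟩
        λ₁⁻¹ * (A *ᵥ x) i     ≈⟨ *-congˡ (eigen i) ⟩
        λ₁⁻¹ * (λ₁ * x i)     ≈⟨ solve 3 (λ b a x → b :* (a :* x) := (a :* b) :* x) refl λ₁⁻¹ λ₁ (x i) ⟩
        λ₁ * λ₁⁻¹ * x i       ≈⟨ trans (*-congʳ invertible) (*-identityˡ _) ⟩
        x i                   ∎

      yB≈y : y ᵥ* B ≈ᵥ y
      yB≈y j = begin
        y ∙ (λ₁⁻¹ ∙ᵥ λ i → A i j)   ≈⟨ ∙-scaleʳ λ₁⁻¹ y (λ i → A i j) ⟩
        λ₁⁻¹ * (y ᵥ* A) j           ≈⟨ *-congˡ (leftEigen j) ⟩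
        λ₁⁻¹ * (λ₁ * y j)           ≈⟨ solve 3 (λ b a x → b :* (a :* x) := (a :* b) :* x) refl λ₁⁻¹ λ₁ (y j) ⟩
        λ₁ * λ₁⁻¹ * y j             ≈⟨ trans (*-congʳ invertible) (*-identityˡ _) ⟩
        y j                         ∎

      P*ᵥ : ∀ w → P *ᵥ w ≈ᵥ (s * y ∙ w) ∙ᵥ x
      P*ᵥ w i = begin
        sum (λ j → x i * (s * y j) * w j)
          ≈⟨ sum-cong-≋ {n} (λ j → solve 4 (λ x s y w → x :* (s :* y) :* w := (x :* s) :* y :* w)
               refl (x i) s (y j) (w j)) ⟩
        ((x i * s) ∙ᵥ y) ∙ w
          ≈⟨ ∙-scaleˡ (x i * s) y w ⟩
        x i * s * y ∙ w
          ≈⟨ solve 3 (λ x s t → x :* s :* t := s :* t :* x) refl (x i) s (y ∙ w) ⟩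
        s * y ∙ w * x i ∎

      *P : ∀ (r : Vector Carrier n) j → r ∙ (λ i → P i j) ≈ r ∙ x * (s * y j)
      *P r j = trans
        (sum-cong-≋ {n} λ i → solve 3 (λ r x t → r :* (x :* t) := r :* (t :* x)) refl (r i) (x i) (s * y j))
        (trans (∙-scaleʳ (s * y j) r x) (*-comm _ _))

      Px≈x : P *ᵥ x ≈ᵥ x
      Px≈x i = trans (P*ᵥ x i) (trans (*-congʳ (trans (*-comm s y∙x) (proj₂ (proj₂ y∙x⁻¹)))) (*-identityˡ _))

      P-idempotent : P *ₘ P ≈ₘ P
      P-idempotent i j = trans (*P (P i) j) (*-congʳ (Px≈x i))

      -- All entries of both matrices are congruent to `u`: `λ₁⁻¹` and `s` are, while A, x and y
      -- have entries congruent to 1.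
      B≡P : ∀ i j → B i j ≡ P i j [mod 1 ]
      B≡P i j = mod-trans
        (mod-resp refl (*-identityʳ u) (mod-* λ₁⁻¹-integral I-1# λ₁⁻¹≡u (A≡1 i j)))
        (mod-sym (mod-resp refl (solve 1 (λ u → con (+ 1) :* (u :* con (+ 1)) := u) refl u)
          (mod-* (x-integral i) (I-*ˡ u-integral I-1#) (x≡1 i)
            (mod-* s-integral I-1# (proj₁ (proj₂ y∙x⁻¹)) (y≡1 j)))))

      P-integral : ∀ i j → I 0 (P i j)
      P-integral i j = I-*ˡ (x-integral i) (I-*ˡ s-integral (y-integral j))

      -- Bᵏ⁺¹ - P = (B - P)(Bᵏ - P), as B P = P = P Bᵏ.
      powers-converge : ∀ k i j → (B ^ₘ k) i j ≡ P i j [mod k ]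
      -- At level 0 the congruence asks only for integrality of the two matrices.
      powers-converge zero    i j = I-+ (1ₘ-integral i j) (I-neg (P-integral i j))
      powers-converge (suc k) i j = I-resp
        (begin
          (λ l → B i l - P i l) ∙ (λ l → (B ^ₘ k) l j - P l j)
            ≈⟨ ∙-sub (B i) (P i) (λ l → (B ^ₘ k) l j) (λ l → P l j) ⟩
          ((B ^ₘ suc k) i j - B i ∙ (λ l → P l j)) - (P i ∙ (λ l → (B ^ₘ k) l j) - (P *ₘ P) i j)
            ≈⟨ +-cong (+-congˡ (-‿cong (trans (*P (B i) j) (*-congʳ (Bx≈x i)))))
                      (-‿cong (+-cong PBᵏ≈P (-‿cong (P-idempotent i j)))) ⟩
          ((B ^ₘ suc k) i j - P i j) - (P i j - P i j)
            ≈⟨ solve 2 (λ b p → (b :- p) :- (p :- p) := b :- p) refl ((B ^ₘ suc k) i j) (P i j) ⟩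
          (B ^ₘ suc k) i j - P i j ∎)
        (I-sum {n = n} λ l → I-* (B≡P i l) (powers-converge k l j))
        where
        PBᵏ≈P : P i ∙ (λ l → (B ^ₘ k) l j) ≈ P i j
        PBᵏ≈P = trans (P*ᵥ (λ l → (B ^ₘ k) l j) i)
          (trans (*-congʳ (*-congˡ (^ₘ-fixedˡ B y yB≈y k j))) (*-comm _ _))

      -- Convergence settles this: Bᵏ v = v for all k while Bᵏ tends to P, so v - P v lies in every
      -- `I k`. The power is taken b steps further to absorb the denominators of v.
      P-fixes-eigenspace : ∀ v → InEigenspace A λ₁ v → P *ᵥ v ≈ᵥ v
      P-fixes-eigenspace v Av≈λ₁v i = begin
        (P *ᵥ v) i
          ≈⟨ solve 2 (λ p w → p := w :- (w :- p)) refl ((P *ᵥ v) i) (v i) ⟩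
        v i - (v i - (P *ᵥ v) i)
          ≈⟨ +-congˡ (-‿cong (separated difference∈I)) ⟩
        v i - 0#
          ≈⟨ solve 1 (λ w → w :- con (+ 0) := w) refl (v i) ⟩
        v i ∎
        where
        Bv≈v : B *ᵥ v ≈ᵥ v
        Bv≈v i = begin
          (λ₁⁻¹ ∙ᵥ A i) ∙ v     ≈⟨ ∙-scaleˡ λ₁⁻¹ (A i) v ⟩
          λ₁⁻¹ * (A *ᵥ v) i     ≈⟨ *-congˡ (Av≈λ₁v i) ⟩
          λ₁⁻¹ * (λ₁ * v i)     ≈⟨ solve 3 (λ b a x → b :* (a :* x) := (a :* b) :* x) refl λ₁⁻¹ λ₁ (v i) ⟩
          λ₁ * λ₁⁻¹ * v i       ≈⟨ trans (*-congʳ invertible) (*-identityˡ _) ⟩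
          v i                   ∎
        difference∈I : ∀ k → I k (v i - (P *ᵥ v) i)
        difference∈I k = I-resp
          (trans (∙-subˡ ((B ^ₘ (b ℕ.+ k)) i) (P i) v) (+-congʳ (^ₘ-fixed B v Bv≈v (b ℕ.+ k) i)))
          (bound λ j → powers-converge (b ℕ.+ k) i j)
          where
          b = proj₁ (∙-bounded v)
          bound = proj₂ (∙-bounded v)

      isProjection : IsProjectionOntoEigenspace P A λ₁
      isProjection = P-idempotent , λ v → mk⇔ (λ Av≈λ₁v → v , P-fixes-eigenspace v Av≈λ₁v) λ { (w , Pw≈v) i →
        let t = s * y ∙ w
            tx≈v : t ∙ᵥ x ≈ᵥ v
            tx≈v j = trans (sym (P*ᵥ w j)) (Pw≈v j)
        in begin
        (A *ᵥ v) i           ≈⟨ ∙-congˡ (A i) tx≈v ⟨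
        A i ∙ (t ∙ᵥ x)       ≈⟨ ∙-scaleʳ t (A i) x ⟩
        t * (A *ᵥ x) i       ≈⟨ *-congˡ (eigen i) ⟩
        t * (λ₁ * x i)       ≈⟨ solve 3 (λ t a x → t :* (a :* x) := a :* (t :* x)) refl t λ₁ (x i) ⟩
        λ₁ * (t * x i)       ≈⟨ *-congˡ (tx≈v i) ⟩
        λ₁ * v i             ∎ }

    abstract
      dominantEigenvalue : ∀ (A : Matrix n) → (∀ i j → A i j ≡ 1# [mod 1 ]) → DominantEigenvalue A
      dominantEigenvalue A A≡1 = record
        { isSimpleEigenvalue = isSimpleEigenvalue
        ; λ₁-integral        = λ₁-integral
        ; λ₁∉I₁              = λ₁∉I₁
        ; λ₁≡ν               = eigenvalue≡ν
        ; invertible         = invertible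
        ; isEigenvector      = x≉0 , eigen
        ; x≡1                = x≡1
        ; leftEigen          = leftEigen
        ; A≡y                = λ i j → mod-trans (A≡1 i j) (mod-sym (y≡1 j))
        ; powers-converge    = powers-converge
        ; isProjection       = isProjection
        }
        where open Construction A A≡1

-- The filtration of ℚₚ by the powers of p, and its relation to the absolute value.

module PAdicFiltration {p : ℕ} (p-prime : Prime p) where
  open PAdic p-prime
  open CommutativeRing ℚₚ-commutativeRing using (_-_; sym)

  open CommutativeSemigroupProperties ℕ.+-commutativeSemigroup using (interchange; x∙yz≈y∙xz)

  private
    instance
      p-nonZero : ℕ.NonZero p
      p-nonZero = prime⇒nonZero p-prime

    p^-nonZero : ∀ n → ℤ.NonZero (p^ n)
    p^-nonZero n = ℕ.m^n≢0 p n

    p^-+ : ∀ m n → p^ (m ℕ.+ n) ≡ p^ m ℤ.* p^ n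
    p^-+ m n = ≡.trans (cong +_ (ℕ.^-distribˡ-+-* p m n)) (ℤ.pos-* (p ℕ.^ m) (p ℕ.^ n))

    p^-∣ : ∀ m n → p^ m ∣ p^ (n ℕ.+ m)
    p^-∣ m n = divides (p^ n) (p^-+ n m)

    p^-mono : ∀ {m n} → m ℕ.≤ n → p^ m ∣ p^ n
    p^-mono {m} {n} m≤n = subst (λ k → p^ m ∣ p^ k) (ℕ.m∸n+n≡m m≤n) (p^-∣ m (n ℕ.∸ m))

    ∣-zero : ∀ {d} → d ∣ 0ℤ
    ∣-zero = divides 0ℤ ≡.refl

    ∣-≡ : ∀ {d i j} → i ≡ j → d ∣ i → d ∣ j
    ∣-≡ {d} = subst (d ∣_)

    residues-agree : ∀ (z : ℤₚ) {j M} → j ≤′ M → p^ j ∣ residue z M ℤ.- residue z j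
    residues-agree z {j} ≤′-refl = ∣-≡ (≡.sym (ℤ.+-inverseʳ (residue z j))) ∣-zero
    residues-agree z {j} (≤′-step {M} j≤M) =
      ∣-≡ (telescope (residue z (suc M)) (residue z M) (residue z j))
        (∣m∣n⇒∣m+n (∣-trans (p^-mono (ℕ.≤′⇒≤ j≤M)) (coherent z M)) (residues-agree z j≤M))
      where
      telescope : ∀ a b c → (a ℤ.- b) ℤ.+ (b ℤ.- c) ≡ a ℤ.- c
      telescope = solve-∀

    -- Divisibility by `p^ j` may be tested at any level from `j` on.
    residue-∣ : ∀ (z : ℤₚ) {j M N} → j ℕ.≤ M → j ℕ.≤ N → p^ j ∣ residue z M → p^ j ∣ residue z N
    residue-∣ z {j} {M} {N} j≤M j≤N d =
      ∣-≡ (eq (residue z M) (residue z j) (residue z N))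
        (∣m∣n⇒∣m+n (∣m∣n⇒∣m-n d (residues-agree z (ℕ.≤⇒≤′ j≤M))) (residues-agree z (ℕ.≤⇒≤′ j≤N)))
      where
      eq : ∀ a b c → a ℤ.- (a ℤ.- b) ℤ.+ (c ℤ.- b) ≡ c
      eq = solve-∀

  -- z / pᵉ lies in pᵏℤₚ iff z vanishes modulo pᵉ⁺ᵏ. In this form `pᵏℤₚ 1` unfolds to the bound with
  -- exponent -1, as the floor computes, so congruences modulo p serve as disc memberships without
  -- conversion.
  pᵏℤₚ : ℕ → ℚₚ → Set
  pᵏℤₚ k x = p^ (exponent x ℕ.+ k) ∣ num x (exponent x ℕ.+ k)

  private
    num-∣ : ∀ x {k N} → pᵏℤₚ k x → exponent x ℕ.+ k ℕ.≤ N → p^ (exponent x ℕ.+ k) ∣ num x N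
    num-∣ x x∈ e+k≤N = residue-∣ (numerator x) ℕ.≤-refl e+k≤N x∈

    -- The cross-multiplied equality is read at level `n`, high enough for exponent y + k powers of
    -- p to remain after the denominator of `x` is cancelled.
    resp : ∀ {k x y} → x ≈ y → pᵏℤₚ k x → pᵏℤₚ k y
    resp {k} {x} {y} x≈y x∈ = residue-∣ (numerator y) (ℕ.m≤n+m (ey ℕ.+ k) ex) ℕ.≤-refl
      (*-cancelˡ-∣ (den x) {{p^-nonZero ex}} (subst (_∣ den x ℤ.* num y n) (p^-+ ex (ey ℕ.+ k)) pⁿ∣))
      where
      ex ey n : ℕ
      ex = exponent x
      ey = exponent y
      n = ex ℕ.+ (ey ℕ.+ k)
      n≡ : ey ℕ.+ (ex ℕ.+ k) ≡ n
      n≡ = x∙yz≈y∙xz ey ex k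
      pⁿ∣y*x : p^ n ∣ den y ℤ.* num x n
      pⁿ∣y*x = subst (_∣ den y ℤ.* num x n) (≡.trans (≡.sym (p^-+ ey (ex ℕ.+ k))) (cong p^_ n≡))
        (*-monoʳ-∣ (den y) (num-∣ x x∈ (subst (ex ℕ.+ k ℕ.≤_) n≡ (ℕ.m≤n+m (ex ℕ.+ k) ey))))
      pⁿ∣ : p^ n ∣ den x ℤ.* num y n
      pⁿ∣ = ∣-≡ (eq (den y ℤ.* num x n) (den x ℤ.* num y n)) (∣m∣n⇒∣m-n pⁿ∣y*x (uncross x≈y n))
        where
        eq : ∀ a b → a ℤ.- (a ℤ.- b) ≡ b
        eq = solve-∀

    scaled-∣ : ∀ x {k} e → pᵏℤₚ k x → ∀ {n} → e ℕ.+ (exponent x ℕ.+ k) ≡ n → p^ n ∣ p^ e ℤ.* num x n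
    scaled-∣ x {k} e x∈ {n} ≡.refl = subst (_∣ p^ e ℤ.* num x n) (≡.sym (p^-+ e (exponent x ℕ.+ k)))
      (*-monoʳ-∣ (p^ e) (num-∣ x x∈ (ℕ.m≤n+m (exponent x ℕ.+ k) e)))

    add : ∀ {k x y} → pᵏℤₚ k x → pᵏℤₚ k y → pᵏℤₚ k (x + y)
    add {k} {x} {y} x∈ y∈ = ∣m∣n⇒∣m+n
      (scaled-∣ x (exponent y) x∈ (≡.trans (x∙yz≈y∙xz (exponent y) (exponent x) k)
        (≡.sym (ℕ.+-assoc (exponent x) (exponent y) k))))
      (scaled-∣ y (exponent x) y∈ (≡.sym (ℕ.+-assoc (exponent x) (exponent y) k)))

    multiply : ∀ {j k x y} → pᵏℤₚ j x → pᵏℤₚ k y → pᵏℤₚ (j ℕ.+ k) (x * y)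
    multiply {j} {k} {x} {y} x∈ y∈ = subst (_∣ num x n ℤ.* num y n)
      (≡.trans (≡.sym (p^-+ (ex ℕ.+ j) (ey ℕ.+ k))) (cong p^_ n≡))
      (∣-trans (*-monoˡ-∣ (p^ (ey ℕ.+ k)) (num-∣ x x∈ (subst (ex ℕ.+ j ℕ.≤_) n≡ (ℕ.m≤m+n _ _))))
               (*-monoʳ-∣ (num x n) (num-∣ y y∈ (subst (ey ℕ.+ k ℕ.≤_) n≡ (ℕ.m≤n+m (ey ℕ.+ k) (ex ℕ.+ j))))))
      where
      ex ey n : ℕ
      ex = exponent x
      ey = exponent y
      n = ex ℕ.+ ey ℕ.+ (j ℕ.+ k)
      n≡ : (ex ℕ.+ j) ℕ.+ (ey ℕ.+ k) ≡ n
      n≡ = interchange ex j ey k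

    -- The numerator of `y` is integral, so multiplication by `y` costs at most its denominator.
    bound : ∀ y {k x} → pᵏℤₚ (exponent y ℕ.+ k) x → pᵏℤₚ k (x * y)
    bound y {k} {x} x∈ = ∣m⇒∣m*n (num y n)
      (subst (λ n → p^ n ∣ num x n) (≡.sym (ℕ.+-assoc (exponent x) (exponent y) k)) x∈)
      where n = exponent x ℕ.+ exponent y ℕ.+ k

    drop : ∀ {k x} → pᵏℤₚ (suc k) x → pᵏℤₚ k x
    drop {k} {x} x∈ = residue-∣ (numerator x) e+k≤ ℕ.≤-refl (∣-trans (p^-mono e+k≤) x∈)
      where
      e+k≤ : exponent x ℕ.+ k ℕ.≤ exponent x ℕ.+ suc k
      e+k≤ = ℕ.+-monoʳ-≤ (exponent x) (ℕ.n≤1+n k)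

    1∉p : ¬ pᵏℤₚ 1 1#
    1∉p p∣1 = ℕ.nonTrivial⇒≢1 {{prime⇒nonTrivial p-prime}} (≡.trans (≡.sym (ℕ.*-identityʳ p)) (ℕ.∣1⇒≡1 (∣⇒∣ᵤ p∣1)))

    vanishes : ∀ {x} → (∀ k → pᵏℤₚ k x) → x ≈ 0#
    vanishes {x} x∈ = cross λ n → ∣-≡ (eq (den x) (num x n))
      (residue-∣ (numerator x) (ℕ.m≤n+m n (exponent x)) ℕ.≤-refl
        (∣-trans (p^-∣ n (exponent x)) (x∈ n)))
      where
      eq : ∀ d a → a ≡ + 1 ℤ.* a ℤ.- d ℤ.* + 0
      eq = solve-∀

  fromIntegral : ℤₚ → ℚₚ
  fromIntegral z .numerator = z
  fromIntegral z .exponent  = 0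

  abstract
    -- Division of the numerator by pᵉ loses e levels, so residue n of the quotient is computed from
    -- residue n + e; coherence follows by cancelling pᵉ.
    integral-representative : ∀ x → pᵏℤₚ 0 x → ∃[ z ] x ≈ fromIntegral z
    integral-representative x x∈ = z , cross λ n → ∣-≡
      (≡.trans (cong (λ t → ℤ.- (t ℤ.- num x n)) (num≡ n)) (eq (q n) (num x n) (p^ e)))
      (∣m⇒∣-m (residues-agree (numerator x) (ℕ.≤⇒≤′ (ℕ.m≤m+n n e))))
      where
      e : ℕ
      e = exponent x
      pᵉ∣ : ∀ n → p^ e ∣ num x (n ℕ.+ e)
      pᵉ∣ n = residue-∣ (numerator x) (ℕ.m≤m+n e 0) (ℕ.m≤n+m e n)
        (subst (λ k → p^ k ∣ num x (e ℕ.+ 0)) (ℕ.+-identityʳ e) x∈)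
      q : ℕ → ℤ
      q n = quotient (pᵉ∣ n)
      num≡ : ∀ n → num x (n ℕ.+ e) ≡ q n ℤ.* p^ e
      num≡ n = _∣_.equality (pᵉ∣ n)
      eq : ∀ q a d → ℤ.- (q ℤ.* d ℤ.- a) ≡ + 1 ℤ.* a ℤ.- d ℤ.* q
      eq = solve-∀
      factor : ∀ a b d → a ℤ.* d ℤ.- b ℤ.* d ≡ (a ℤ.- b) ℤ.* d
      factor = solve-∀
      z : ℤₚ
      z .residue  = q
      z .coherent n = *-cancelʳ-∣ (p^ e) {{p^-nonZero e}}
        (≡.subst₂ _∣_ (p^-+ n e)
          (≡.trans (cong₂ ℤ._-_ (num≡ (suc n)) (num≡ n)) (factor (q (suc n)) (q n) (p^ e)))
          (coherent (numerator x) (n ℕ.+ e)))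

  private
    negate : ∀ {k x} → pᵏℤₚ k x → pᵏℤₚ k (- x)
    negate = ∣n⇒∣m*n -[1+ 0 ]

    -- The terms may have different exponents, so their residues are not comparable. After passing
    -- to representatives with exponent 0, the limit is the diagonal sequence of residues.
    converges : ∀ (s : ℕ → ℚₚ) → pᵏℤₚ 0 (s 0) → (∀ k → pᵏℤₚ (suc k) (s (suc k) - s k)) →
                ∃[ l ] ∀ k → pᵏℤₚ k (l - s k)
    converges s s₀∈ step = fromIntegral l , λ k →
      resp {k} {fromIntegral l - fromIntegral (z k)} {fromIntegral l - s k}
        (sub-cong (fromIntegral l) (fromIntegral l) (fromIntegral (z k)) (s k) refl
          (sym {s k} {fromIntegral (z k)} (s≈z k)))
        -- At level `k` the residue of the diagonal `l` is that of `z k` by definition, so the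
        -- difference is literally zero.
        (∣-≡ (zero-difference (residue (z k) k)) ∣-zero)
      where
      open CommutativeRing ℚₚ-commutativeRing using (refl; trans; +-cong; +-assoc; -‿cong; -‿inverseˡ; +-congˡ; +-identityʳ)
      sub-cong : ∀ x x′ y y′ → x ≈ x′ → y ≈ y′ → x - y ≈ x′ - y′
      sub-cong x x′ y y′ x≈x′ y≈y′ = +-cong {x} {x′} {CommutativeRing.-_ ℚₚ-commutativeRing y} x≈x′ (-‿cong {y} {y′} y≈y′)
      zero-difference : ∀ a → + 0 ≡ + 1 ℤ.* a ℤ.+ + 1 ℤ.* (-[1+ 0 ] ℤ.* a)
      zero-difference = solve-∀
      s∈ : ∀ k → pᵏℤₚ 0 (s k)
      s∈ zero    = s₀∈
      s∈ (suc k) = resp {0} {(s (suc k) - s k) + s k} {s (suc k)}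
        (trans (+-assoc (s (suc k)) (- s k) (s k)) (trans (+-congˡ (-‿inverseˡ (s k))) (+-identityʳ (s (suc k)))))
        (add {0} {s (suc k) - s k} {s k} (integral (suc k) {s (suc k) - s k} (step k)) (s∈ k))
        where
        integral : ∀ k {x} → pᵏℤₚ k x → pᵏℤₚ 0 x
        integral zero    x∈ = x∈
        integral (suc k) {x} x∈ = integral k {x} (drop {k} {x} x∈)
      z : ℕ → ℤₚ
      z k = proj₁ (integral-representative (s k) (s∈ k))
      s≈z : ∀ k → s k ≈ fromIntegral (z k)
      s≈z k = proj₂ (integral-representative (s k) (s∈ k))
      close : ∀ n → p^ n ∣ residue (z (suc n)) n ℤ.- residue (z n) n
      close n = ∣-≡ (eq (residue (z (suc n)) n) (residue (z n) n))
        (drop {n} {fromIntegral (z (suc n)) - fromIntegral (z n)}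
          (resp {suc n} {s (suc n) - s n} {fromIntegral (z (suc n)) - fromIntegral (z n)}
            (sub-cong (s (suc n)) (fromIntegral (z (suc n))) (s n) (fromIntegral (z n))
              (s≈z (suc n)) (s≈z n))
            (step n)))
        where
        eq : ∀ a b → + 1 ℤ.* a ℤ.+ + 1 ℤ.* (-[1+ 0 ] ℤ.* b) ≡ a ℤ.- b
        eq = solve-∀
      l : ℤₚ
      l .residue  n = residue (z n) n
      l .coherent n = ∣-≡ (eq (residue (z (suc n)) (suc n)) (residue (z (suc n)) n) (residue (z n) n))
        (∣m∣n⇒∣m+n (coherent (z (suc n)) n) (close n))
        where
        eq : ∀ a b c → (a ℤ.- b) ℤ.+ (b ℤ.- c) ≡ a ℤ.- c
        eq = solve-∀

  filtration : Filtration ℚₚ-commutativeRing 0ℓ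
  filtration = record
    { I         = pᵏℤₚ
    ; I-resp    = λ {k} {x} {y} → resp {k} {x} {y}
    ; I-suc     = λ {k} {x} → drop {k} {x}
    ; I-0#      = ∣-zero
    ; I-1#      = divides (+ 1) ≡.refl
    ; I-+       = λ {k} {x} {y} → add {k} {x} {y}
    ; I-neg     = λ {k} {x} → negate {k} {x}
    ; I-*       = λ {j} {k} {x} {y} → multiply {j} {k} {x} {y}
    ; 1#∉I₁     = 1∉p
    ; separated = vanishes
    ; complete  = converges
    ; bounded   = λ y → exponent y , λ {k} {x} → bound y {k} {x}
    }

  private
    ⁺-≤ : ∀ {i n} → i ℤ.≤ + n → i ⁺ ℕ.≤ n
    ⁺-≤ (+≤+ m≤n) = m≤n
    ⁺-≤ -≤+       = ℕ.z≤n

    ≤-⁺ : ∀ i → i ℤ.≤ + (i ⁺)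
    ≤-⁺ (+ n)    = ℤ.≤-refl
    ≤-⁺ -[1+ n ] = -≤+

    +≤⇒≤⁺ : ∀ {n i} → + n ℤ.≤ i → n ℕ.≤ i ⁺
    +≤⇒≤⁺ (+≤+ m≤n) = m≤n

    floor-nonNegative : ∀ q → 0ℚ ℚ.≤ q → 0ℤ ℤ.≤ floor q
    floor-nonNegative (mkℚ n d _) (ℚ.*≤* 0≤n) = subst (0ℤ ℤ.≤_) (≡.sym (div-pos-is-/ℕ n (suc d)))
      (0≤n⇒0≤n/ℕd n (suc d) (≡.subst (0ℤ ℤ.≤_) (ℤ.*-identityʳ n) 0≤n))

    floor-negative : ∀ q → q ℚ.< 0ℚ → floor q ℤ.< 0ℤ
    floor-negative (mkℚ n d _) (ℚ.*<* n<0) = subst (ℤ._< 0ℤ) (≡.sym (div-pos-is-/ℕ n (suc d)))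
      (ℤ.*-cancelʳ-<-nonNeg (+ suc d) (ℤ.≤-<-trans ([n/ℕd]*d≤n n (suc d)) (subst (ℤ._< 0ℤ) (ℤ.*-identityʳ n) n<0)))

  ∣∣≤p^-from : ∀ {k x} q → ℤ.- floor q ℤ.≤ + k → pᵏℤₚ k x → ∣ x ∣≤p^ q
  ∣∣≤p^-from {k} {x} q -⌊q⌋≤k x∈ = residue-∣ (numerator x) m≤e+k ℕ.≤-refl (∣-trans (p^-mono m≤e+k) x∈)
    where
    m≤e+k : (+ exponent x ℤ.- floor q) ⁺ ℕ.≤ exponent x ℕ.+ k
    m≤e+k = ⁺-≤ (ℤ.+-monoʳ-≤ (+ exponent x) -⌊q⌋≤k)

  ∣∣≤p^-nonNegative : ∀ {x} q → 0ℚ ℚ.≤ q → pᵏℤₚ 0 x → ∣ x ∣≤p^ q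
  ∣∣≤p^-nonNegative {x} q 0≤q = ∣∣≤p^-from {0} {x} q (ℤ.neg-mono-≤ (floor-nonNegative q 0≤q))

  -- The value group is discrete: for q < 0 the floor is at most -1, so a radius below 1 already
  -- means at most 1/p.
  ∣∣≤p^-negative : ∀ {x} q → q ℚ.< 0ℚ → ∣ x ∣≤p^ q → pᵏℤₚ 1 x
  ∣∣≤p^-negative {x} q q<0 x∈ = residue-∣ (numerator x) e+1≤m ℕ.≤-refl (∣-trans (p^-mono e+1≤m) x∈)
    where
    e+1≤m : exponent x ℕ.+ 1 ℕ.≤ (+ exponent x ℤ.- floor q) ⁺
    e+1≤m = +≤⇒≤⁺ (ℤ.+-monoʳ-≤ (+ exponent x) (ℤ.neg-mono-≤ (ℤ.i<j⇒i≤pred[j] (floor-negative q q<0))))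

  ⟶-from : ∀ {s : ℕ → ℚₚ} {l} → (∀ k → pᵏℤₚ k (s k - l)) → s ⟶ l
  ⟶-from {s} {l} s∈ q = (ℤ.- floor q) ⁺ , λ n N≤n →
    ∣∣≤p^-from {n} {s n - l} q (ℤ.≤-trans (≤-⁺ (ℤ.- floor q)) (+≤+ N≤n)) (s∈ n)

-- The archimedean property of rational exponents.

infixl 6 _+ℕ_
-- Adds the units on the side of `q`, which is the shape that the recursion in `descend-by` peels
-- off.
_+ℕ_ : ℚ → ℕ → ℚ
q +ℕ zero  = q
q +ℕ suc k = (q ℚ.+ 1ℚ) +ℕ k

private
  fromℕ : ℕ → ℚ
  fromℕ k = + k ℚ./ 1

  fromℕ-suc : ∀ k → fromℕ (suc k) ≡ 1ℚ ℚ.+ fromℕ k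
  fromℕ-suc k = ℚ.toℚᵘ-injective (begin
    ℚ.toℚᵘ (+ suc k ℚ./ 1)       ≈⟨ ℚ.toℚᵘ-fromℚᵘ (ℚᵘ.mkℚᵘ (+ suc k) 0) ⟩
    ℚᵘ.mkℚᵘ (+ suc k) 0           ≈⟨ ℚᵘ.*≡* (cong (ℤ._* + 1) (cong (ℤ._+_ (+ 1)) (≡.sym (ℤ.*-identityʳ (+ k))))) ⟩
    ℚᵘ.1ℚᵘ ℚᵘ.+ ℚᵘ.mkℚᵘ (+ k) 0   ≈⟨ ℚᵘ.+-congʳ ℚᵘ.1ℚᵘ (ℚᵘ.≃-sym (ℚ.toℚᵘ-fromℚᵘ (ℚᵘ.mkℚᵘ (+ k) 0))) ⟩
    ℚ.toℚᵘ 1ℚ ℚᵘ.+ ℚ.toℚᵘ (fromℕ k)  ≈⟨ ℚᵘ.≃-sym (ℚ.toℚᵘ-homo-+ 1ℚ (fromℕ k)) ⟩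
    ℚ.toℚᵘ (1ℚ ℚ.+ fromℕ k) ∎)
    where open SetoidReasoning ℚᵘ.≃-setoid

  +ℕ-fromℕ : ∀ q k → q +ℕ k ≡ q ℚ.+ fromℕ k
  +ℕ-fromℕ q zero    = ≡.sym (ℚ.+-identityʳ q)
  +ℕ-fromℕ q (suc k) = ≡.trans (+ℕ-fromℕ (q ℚ.+ 1ℚ) k)
    (≡.trans (ℚ.+-assoc q 1ℚ (fromℕ k)) (cong (ℚ._+_ q) (≡.sym (fromℕ-suc k))))

  ≤-fromℕ : ∀ q → ∃[ k ] q ℚ.≤ fromℕ k
  ≤-fromℕ q@(mkℚ n d _) = ℤ.∣ n ∣ , ℚ.toℚᵘ-cancel-≤ (ℚᵘ.≤-trans
    (ℚᵘ.*≤* (ℤ.≤-trans (ℤ.≤-reflexive (ℤ.*-identityʳ n)) (ℤ.≤-trans (i≤∣i∣ n)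
      (subst (+ ℤ.∣ n ∣ ℤ.≤_) (ℤ.pos-* ℤ.∣ n ∣ (suc d)) (ℤ.+≤+ (ℕ.m≤m*n ℤ.∣ n ∣ (suc d)))))))
    (ℚᵘ.≤-reflexive (ℚᵘ.≃-sym (ℚ.toℚᵘ-fromℚᵘ (ℚᵘ.mkℚᵘ (+ ℤ.∣ n ∣) 0)))))
    where
    i≤∣i∣ : ∀ i → i ℤ.≤ + ℤ.∣ i ∣
    i≤∣i∣ (+ n)    = ℤ.≤-refl
    i≤∣i∣ -[1+ n ] = ℤ.-≤+

archimedean : ∀ q r → ∃[ k ] q ℚ.≤ r +ℕ k
archimedean q r = k , (begin
  q                  ≡⟨ GroupProperties.//-rightDividesˡ ℚ.+-0-group r q ⟨
  q ℚ.- r ℚ.+ r      ≤⟨ ℚ.+-monoˡ-≤ r (proj₂ (≤-fromℕ (q ℚ.- r))) ⟩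
  fromℕ k ℚ.+ r      ≡⟨ ℚ.+-comm (fromℕ k) r ⟩
  r ℚ.+ fromℕ k      ≡⟨ +ℕ-fromℕ r k ⟨
  r +ℕ k             ∎)
  where
  open ℚ.≤-Reasoning
  k = proj₁ (≤-fromℕ (q ℚ.- r))

-- Eigenvalues in ℂₚ.

module ComplexEigenvalues {c ℓ} {p : ℕ} (p-prime : Prime p) (K : PAdic.ℂₚ p-prime c ℓ) where
  open PAdic p-prime using (ℚₚ; ℚₚ-commutativeRing; ℚₚ-rawRing; module ℂₚ)
  open PAdicFiltration p-prime using (pᵏℤₚ)
  open ℂₚ K using
    ( heytingField; ∣_∣ℂ≤p^_; ∣_∣ℂ<1; ∣∣-resp; ∣∣-mono; ∣∣-located; ∣∣-finite; ∣∣-#0; ∣∣-*-≤; ∣∣-*-≥; ∣∣-+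
    ; ι; ι-isHomomorphism; ι-isometry )

  ℂₚ-commutativeRing : CommutativeRing c ℓ
  ℂₚ-commutativeRing =
    HeytingCommutativeRing.commutativeRing (HeytingField.heytingCommutativeRing heytingField)

  open HeytingField heytingField using (tight)
  open CommutativeRing ℂₚ-commutativeRing hiding (zero)
  open Eigenvalues rawRing using (Matrix; IsEigenvalue; _≈ᵥ_; _∙ᵥ_; _*ᵥ_)
  open BilinearSums ℂₚ-commutativeRing
  open IntegerSolver ℂₚ-commutativeRing
  open Sum semiring using (sum; sum-cong-≋)
  open SetoidReasoning setoid
  private
    module ι = RingHomomorphism ℚₚ-commutativeRing ℂₚ-commutativeRing ι-isHomomorphism
    open RingMorphisms.IsRingHomomorphism ι-isHomomorphism
    module Q where
      open CommutativeRing ℚₚ-commutativeRing public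
      open Matrices ℚₚ-rawRing public
      open BilinearSums ℚₚ-commutativeRing public

  private
    -½ -⅓ : ℚ
    -½ = ℚ.- ½
    -⅓ = -[1+ 0 ] ℚ./ 3

  -- By tightness it is enough to refute apartness from zero, and apartness comes with an exponent
  -- at which the bound fails.
  ∣∣≤⇒≈0 : ∀ {x} → (∀ q → ∣ x ∣ℂ≤p^ q) → x ≈ 0#
  ∣∣≤⇒≈0 {x} x≤ = proj₁ (tight x 0#) λ x#0 →
    let q , x≰q = Equivalence.to ∣∣-#0 x#0 in x≰q (x≤ q)

  -- Transported from ℚₚ along `ι`; `∣∣-#0` by itself would give the bound only up to double
  -- negation.
  ≈0⇒∣∣≤ : ∀ {x} q → x ≈ 0# → ∣ x ∣ℂ≤p^ q
  ≈0⇒∣∣≤ q x≈0 = ∣∣-resp (trans 0#-homo (sym x≈0))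
    (Equivalence.from (ι-isometry Q.0# q) (divides (+ 0) ≡.refl))

  ∣∣-sum : ∀ {n q} {f : Vector Carrier n} → (∀ i → ∣ f i ∣ℂ≤p^ q) → ∣ sum f ∣ℂ≤p^ q
  ∣∣-sum {zero}  f≤ = ≈0⇒∣∣≤ _ refl
  ∣∣-sum {suc n} f≤ = ∣∣-+ (f≤ zero) (∣∣-sum (f≤ ∘ suc))

  -- `a` is only unequal to zero, so no inverse of it is at hand. Instead `w` is assumed apart from
  -- zero; dividing the zero product by its lower bound then bounds `a` by every power of p.
  *-cancel-≈0 : ∀ {a w} → a * w ≈ 0# → ¬ (a ≈ 0#) → w ≈ 0#
  *-cancel-≈0 {a} {w} aw≈0 a≉0 = proj₁ (tight w 0#) λ w#0 →
    let q , w≰q = Equivalence.to ∣∣-#0 w#0 in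
    a≉0 (∣∣≤⇒≈0 λ r → ∣∣-*-≥ (≈0⇒∣∣≤ (q ℚ.+ r) (trans (*-comm w a) aw≈0)) w≰q)

  common-bound : ∀ {n} (v : Vector Carrier n) → ∃[ q ] ∀ i → ∣ v i ∣ℂ≤p^ q
  common-bound {zero}  v = 0ℚ , λ ()
  common-bound {suc n} v = q₀ ℚ.⊔ q , λ
    { zero    → ∣∣-mono (ℚ.p≤p⊔q q₀ q) (proj₂ (∣∣-finite (v zero)))
    ; (suc i) → ∣∣-mono (ℚ.p≤q⊔p q₀ q) (proj₂ (common-bound (v ∘ suc)) i) }
    where
    q₀ = proj₁ (∣∣-finite (v zero))
    q  = proj₁ (common-bound (v ∘ suc))

  -- Any common bound can be lowered below every exponent. The hypothesis speaks of bounds on all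
  -- coordinates at once, so no coordinate of largest absolute value has to be selected; two
  -- shrinkings make up one unit of `_+ℕ_`.
  shrinking⇒≈0 : ∀ {n} (v : Vector Carrier n) →
                 (∀ q → (∀ i → ∣ v i ∣ℂ≤p^ q) → ∀ i → ∣ v i ∣ℂ≤p^ (q ℚ.+ -½)) → ∀ i → v i ≈ 0#
  shrinking⇒≈0 v shrink i = ∣∣≤⇒≈0 λ r → descend r i
    where
    shift : ∀ r → r ℚ.+ 1ℚ ℚ.+ -½ ℚ.+ -½ ≡ r
    shift r = ≡.trans (ℚ.+-assoc (r ℚ.+ 1ℚ) -½ -½)
      (≡.trans (ℚ.+-assoc r 1ℚ (-½ ℚ.+ -½)) (ℚ.+-identityʳ r))
    descend-by : ∀ k r → (∀ i → ∣ v i ∣ℂ≤p^ (r +ℕ k)) → ∀ i → ∣ v i ∣ℂ≤p^ r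
    descend-by zero    r v≤ = v≤
    descend-by (suc k) r v≤ i = subst (∣ v i ∣ℂ≤p^_) (shift r)
      (shrink (r ℚ.+ 1ℚ ℚ.+ -½) (shrink (r ℚ.+ 1ℚ) (descend-by k (r ℚ.+ 1ℚ) v≤)) i)
    descend : ∀ r i → ∣ v i ∣ℂ≤p^ r
    descend r = let q , v≤q = common-bound v ; k , q≤ = archimedean q r in
      descend-by k r λ i → ∣∣-mono q≤ (v≤q i)

  module _ {n} (A : Q.Matrix n) (λ₁ : ℚₚ) (y : Vector ℚₚ n)
    (yA≈λ₁y : y Q.ᵥ* A Q.≈ᵥ λ₁ Q.∙ᵥ y) (A≡y : ∀ i j → pᵏℤₚ 1 (A i j Q.- y j)) where

    private
      Â : Matrix n
      Â i j = ι (A i j)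
      ŷ : Vector Carrier n
      ŷ j = ι (y j)

      ŷÂ≈λ₁ŷ : ŷ ᵥ* Â ≈ᵥ ι λ₁ ∙ᵥ ŷ
      ŷÂ≈λ₁ŷ j = begin
        sum (λ i → ι (y i) * ι (A i j))   ≈⟨ sum-cong-≋ {n} (λ i → sym (*-homo (y i) (A i j))) ⟩
        sum (λ i → ι (y i Q.* A i j))     ≈⟨ ι.sum-homo (λ i → y i Q.* A i j) ⟨
        ι ((y Q.ᵥ* A) j)                  ≈⟨ ⟦⟧-cong (yA≈λ₁y j) ⟩
        ι (λ₁ Q.* y j)                    ≈⟨ *-homo λ₁ (y j) ⟩
        ι λ₁ * ι (y j)                    ∎

      Â≡ŷ : ∀ i j → ∣ Â i j - ŷ j ∣ℂ≤p^ (ℚ.- 1ℚ)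
      Â≡ŷ i j = ∣∣-resp (trans (+-homo (A i j) (Q.- y j)) (+-congˡ (-‿homo (y j))))
        (Equivalence.from (ι-isometry (A i j Q.- y j) (ℚ.- 1ℚ)) (A≡y i j))

    -- A further eigenvector v satisfies y · v = 0, hence μ v = (A - 1 yᵀ) v,
    -- where A - 1 yᵀ vanishes modulo p.
    other-eigenvalues : ∀ μ → IsEigenvalue Â μ → ¬ (μ ≈ ι λ₁) → ∣ μ ∣ℂ<1
    -- Location of |μ| can only separate two distinct exponents. A bound by -1/3 proves the claim;
    -- failure of the bound by -1/2 leaves a contraction by the exponent -1/2, since the entries of
    -- A - 1 yᵀ have exponent -1.
    other-eigenvalues μ (v , v≉0 , Âv≈μv) μ≉λ₁ with ∣∣-located μ {ℚ.- ½} { -⅓} (from-yes (-½ ℚ.<? -⅓))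
    ... | inj₁ μ≤ = -⅓ , from-yes (-⅓ ℚ.<? 0ℚ) , μ≤
    ... | inj₂ μ≰ = contradiction (shrinking⇒≈0 v shrink) v≉0
      where
      ŷ∙v≈0 : ŷ ∙ v ≈ 0#
      -- Evaluating y A v from both sides gives (μ - λ₁)(y · v) = 0.
      ŷ∙v≈0 = *-cancel-≈0 (begin
        (μ - ι λ₁) * ŷ ∙ v
          ≈⟨ solve 3 (λ m l w → (m :- l) :* w := m :* w :- l :* w) refl μ (ι λ₁) (ŷ ∙ v) ⟩
        μ * ŷ ∙ v - ι λ₁ * ŷ ∙ v
          ≈⟨ +-cong (∙-scaleʳ μ ŷ v) (-‿cong (∙-scaleˡ (ι λ₁) ŷ v)) ⟨
        ŷ ∙ (μ ∙ᵥ v) - (ι λ₁ ∙ᵥ ŷ) ∙ v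
          ≈⟨ +-cong (∙-congˡ ŷ Âv≈μv) (-‿cong (∙-congʳ v ŷÂ≈λ₁ŷ)) ⟨
        ŷ ∙ (Â *ᵥ v) - (ŷ ᵥ* Â) ∙ v
          ≈⟨ +-congʳ (∙-*ᵥ ŷ Â v) ⟩
        (ŷ ᵥ* Â) ∙ v - (ŷ ᵥ* Â) ∙ v
          ≈⟨ -‿inverseʳ _ ⟩
        0# ∎)
        λ μ-λ₁≈0 → μ≉λ₁ (GroupProperties.x∙y⁻¹≈ε⇒x≈y +-group μ (ι λ₁) μ-λ₁≈0)
      μv≈ : ∀ i → (λ j → Â i j - ŷ j) ∙ v ≈ μ * v i
      μv≈ i = begin
        (λ j → Â i j - ŷ j) ∙ v   ≈⟨ ∙-subˡ (Â i) ŷ v ⟩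
        (Â *ᵥ v) i - ŷ ∙ v        ≈⟨ +-cong (Âv≈μv i) (-‿cong ŷ∙v≈0) ⟩
        μ * v i - 0#              ≈⟨ solve 1 (λ x → x :- con (+ 0) := x) refl (μ * v i) ⟩
        μ * v i                   ∎
      shift : ∀ q → ℚ.- 1ℚ ℚ.+ q ≡ -½ ℚ.+ (q ℚ.+ -½)
      shift q = ≡.trans (ℚ.+-assoc -½ -½ q) (cong (-½ ℚ.+_) (ℚ.+-comm -½ q))
      shrink : ∀ q → (∀ i → ∣ v i ∣ℂ≤p^ q) → ∀ i → ∣ v i ∣ℂ≤p^ (q ℚ.+ -½)
      -- |μ vᵢ| is at most p to the exponent -1 + q, split as -1/2 and q - 1/2; since |μ| exceeds
      -- the first part, |vᵢ| obeys the second.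
      shrink q v≤ i = ∣∣-*-≥ (∣∣-resp (μv≈ i)
        (∣∣-sum {n} λ j → subst (∣ (Â i j - ŷ j) * v j ∣ℂ≤p^_) (shift q) (∣∣-*-≤ (Â≡ŷ i j) (v≤ j)))) μ≰

-- The inverse of n modulo p, n as a sum of ones, and the result over ℚₚ.

∤⇒coprime : ∀ {p n} → Prime p → p ∤ n → Coprime p n
∤⇒coprime p-prime p∤n (i∣p , i∣n) with prime⇒irreducible p-prime i∣p
... | inj₁ i≡1    = i≡1
... | inj₂ ≡.refl = contradiction i∣n p∤n

private
  integer-identity : ∀ a b c d → 1 ℕ.+ a ℕ.* b ≡ c ℕ.* d → + 1 ℤ.+ + a ℤ.* + b ≡ + c ℤ.* + d
  integer-identity a b c d eq =
    ≡.trans (cong (ℤ._+_ (+ 1)) (≡.sym (ℤ.pos-* a b))) (≡.trans (cong +_ eq) (ℤ.pos-* c d))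

inverse-modulo : ∀ {p n} → Coprime p n → ∃[ u ] + p ∣ u ℤ.* + n ℤ.- + 1
inverse-modulo {p} {n} coprime with coprime-Bézout coprime
... | Bézout.+- x y eq = ℤ.- + y , divides (ℤ.- + x) (≡.trans (rearrange (+ y) (+ n))
        (≡.trans (cong ℤ.-_ (integer-identity y n x p eq)) (ℤ.neg-distribˡ-* (+ x) (+ p))))
  where
  rearrange : ∀ y n → (ℤ.- y) ℤ.* n ℤ.- + 1 ≡ ℤ.- (+ 1 ℤ.+ y ℤ.* n)
  rearrange = solve-∀
... | Bézout.-+ x y eq = + y , divides (+ x)
        (≡.trans (cong (ℤ._- + 1) (≡.sym (integer-identity x p y n eq))) (cancel (+ x) (+ p)))
  where
  cancel : ∀ x p → + 1 ℤ.+ x ℤ.* p ℤ.- + 1 ≡ x ℤ.* p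
  cancel = solve-∀

module _ {p : ℕ} (p-prime : Prime p) where
  open PAdic p-prime
  open PAdicFiltration p-prime
  open CommutativeRing ℚₚ-commutativeRing using (semiring; sym; trans; +-congˡ)
  open Sum semiring using (sum)

  fromℤ-+ : ∀ i j → fromℤ (i ℤ.+ j) ≈ fromℤ i + fromℤ j
  fromℤ-+ i j = cross λ n → divides (+ 0) (eq i j)
    where
    eq : ∀ i j → + 1 ℤ.* (i ℤ.+ j) ℤ.- + 1 ℤ.* (+ 1 ℤ.* i ℤ.+ + 1 ℤ.* j) ≡ + 0
    eq = solve-∀

  -- Identifies `ν` of the filtered argument with the centre of the disc in (b), and with the n that
  -- Bézout's identity inverts.
  sum-1#≈fromℤ : ∀ n → sum {n} (λ _ → 1#) ≈ fromℤ (+ n)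
  sum-1#≈fromℤ zero    = CommutativeRing.refl ℚₚ-commutativeRing {0#}
  sum-1#≈fromℤ (suc n) = trans {1# + sum {n} (λ _ → 1#)} {1# + fromℤ (+ n)} {fromℤ (+ suc n)}
    (+-congˡ {1#} {sum {n} (λ _ → 1#)} {fromℤ (+ n)} (sum-1#≈fromℤ n))
    (sym {fromℤ (+ suc n)} {1# + fromℤ (+ n)} (fromℤ-+ (+ 1) (+ n)))

theorem3 :
    ∀ {c ℓ : Level} {p : ℕ} (p-prime : Prime p) (n : ℕ) .{{_ : NonZero n}} → p ∤ n →
    let open PAdic p-prime
        open Eigenvalues ℚₚ-rawRing
    in
    (A : Matrix n) → (∀ i j → A i j ∈ D 1# (-ℚ 1ℚ)) →
    ∃[ λmax ]
      -- (a)
      ( IsSimpleEigenvalue A λmax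
      × ∣ λmax ∣≡1
      × (∀ (K : ℂₚ c ℓ) → let open ℂₚ K in
           ∀ μ → Eigenvalues.IsEigenvalue rawRing (λ i j → ι (A i j)) μ →
           ¬ (μ ≈ℂ ι λmax) → ∣ μ ∣ℂ<1)
      )
      -- (b)
      × λmax ∈ D (fromℤ (+ n)) (-ℚ 1ℚ)
      -- (c)
      × (∃[ x ] IsEigenvector A λmax x × (∀ i → x i ∈ D 1# (-ℚ 1ℚ)))
      -- (d)
      × (∃[ λmax⁻¹ ] λmax * λmax⁻¹ ≈ 1# ×
          (∃[ P ] (∀ i j → (λ k → ((λmax⁻¹ ∙ₘ A) ^ₘ k) i j) ⟶ P i j)
                × IsProjectionOntoEigenspace P A λmax))
theorem3 p-prime zero    p∤0 A A≡1 = contradiction (_ ∣0) p∤0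
theorem3 {p = p} p-prime (suc m) p∤n A A≡1 =
  λ₁ ,
  ( isSimpleEigenvalue
  -- An exponent below 0 would put λ₁ into pℤₚ, where a unit cannot lie; for exponents from 0 on,
  -- integrality gives the bound.
  , (λ q → mk⇔ (λ λ₁≤ → ℚ.≮⇒≥ λ q<0 → λ₁∉I₁ (∣∣≤p^-negative {λ₁} q q<0 λ₁≤))
               (λ 0≤q → ∣∣≤p^-nonNegative {λ₁} q 0≤q λ₁-integral))
  , (λ K → ComplexEigenvalues.other-eigenvalues p-prime K A λ₁ y leftEigen A≡y)
  ) ,
  mod-trans {1} {λ₁} {ν} {fromℤ (+ suc m)} λ₁≡ν ν≡n ,
  (x , isEigenvector , x≡1) ,
  (λ₁⁻¹ , invertible , P ,
    (λ i j → ⟶-from {λ k → ((λ₁⁻¹ ∙ₘ A) ^ₘ k) i j} {P i j} (λ k → powers-converge k i j)) , isProjection)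
  where
  open PAdic p-prime
  open Eigenvalues ℚₚ-rawRing using (_∙ₘ_; _^ₘ_)
  open PAdicFiltration p-prime
  open FiltrationProperties filtration using (mod-trans; mod-*; mod-reflexive; _≡_[mod_])
  open Filtration filtration using (I)
  open PerronTheory filtration m using (ν; module Invertible)
  ν≡n : ν ≡ fromℤ (+ suc m) [mod 1 ]
  ν≡n = mod-reflexive {1} {ν} {fromℤ (+ suc m)} (sum-1#≈fromℤ p-prime (suc m))
  inverse : ∃[ u ] + p ∣ u ℤ.* + suc m ℤ.- + 1
  inverse = inverse-modulo (∤⇒coprime p-prime p∤n)
  u : ℚₚ
  u = fromℤ (proj₁ inverse)
  u-integral : I 0 u
  u-integral = divides (proj₁ inverse) (≡.sym (ℤ.*-identityʳ (proj₁ inverse)))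
  un≡1 : u * fromℤ (+ suc m) ≡ 1# [mod 1 ]
  un≡1 = subst₂ _∣_ (cong +_ (≡.sym (ℕ.*-identityʳ p))) (identity (proj₁ inverse ℤ.* + suc m)) (proj₂ inverse)
    where
    identity : ∀ i → i ℤ.- + 1 ≡ + 1 ℤ.* i ℤ.+ + 1 ℤ.* (-[1+ 0 ] ℤ.* + 1)
    identity = solve-∀
  uν≡1 : u * ν ≡ 1# [mod 1 ]
  uν≡1 = mod-trans {1} {u * ν} {u * fromℤ (+ suc m)} {1#}
    (mod-* {1} {u} {u} {ν} {fromℤ (+ suc m)} u-integral (divides (+ suc m) (≡.sym (ℤ.*-identityʳ (+ suc m))))
      (mod-reflexive {1} {u} {u} (CommutativeRing.refl ℚₚ-commutativeRing {u})) ν≡n) un≡1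
  open Invertible u u-integral uν≡1
  open DominantEigenvalue (dominantEigenvalue A A≡1)
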